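{- Let $r\geq 3$ and $0<c<\frac{1}{2}$. Then for $n$ sufficiently large, \[ ex_r(n;\mathcal{L}_{n,cn}^{(r)})=\binom{n}{r}-\binom{n-\frac{cn}{r}}{r}+o(n^r). \]
   Context: An $r$-graph is a hypergraph all of whose edges have exactly $r$ vertices. A tight path is an $r$-graph whose vertices can be ordered $v_1,\dots,v_m$ so that its edges are exactly $\{v_i,\dots,v_{i+r-1}\}$ for $i=1,\dots,m-r+1$. A tight linear forest is an $r$-graph each of whose connected components is a tight path or an isolated vertex. $\mathcal{L}_{n,k}^{(r)}$ is the family of all tight linear forests on $n$ vertices with $k$ edges. $ex_r(n;\mathcal{F})$ is the maximum number of edges in an $r$-graph on $n$ vertices containing no subgraph isomorphic to a member of $\mathcal{F}$. Quantities such as $cn$ and $cn/r$ are treated as integers (rounded); $o(n^r)$ is as $n\to\infty$ with $r,c$ fixed.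
   Formalization: The constant c is taken to be a rational number p/q with 0 < c < 1/2, whereas the statement allows any real c in that range. -}

module Defs where

open import Data.Nat using (ℕ; zero; suc; _+_; _*_; _∸_; _^_; _≤_; _<_; _≤ᵇ_; ∣_-_∣; NonZero; _/_)
open import Data.Nat.Combinatorics using (_C_)
open import Data.Bool using (if_then_else_)
open import Data.Fin using (Fin)
open import Data.Fin.Subset using (Subset; ⁅_⁆; _∪_; _∈_; ∣_∣) renaming (⊥ to ∅)
open import Data.List using (List; []; _∷_; length; take; foldr; concatMap; concat)
open import Data.List.Relation.Unary.All using (All)
open import Data.List.Relation.Unary.Unique.Propositional using (Unique)
import Data.List.Membership.Propositional as LM
open import Data.Product using (Σ; ∃; _×_)
open import Function.Definitions using (Injective)
open import Function.Bundles using (_⇔_)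
open import Relation.Binary.PropositionalEquality using (_≡_)
open import Relation.Nullary using (¬_)

record Hypergraph (r n : ℕ) : Set where
  field
    edges   : List (Subset n)
    uniform : All (λ e → ∣ e ∣ ≡ r) edges
    simple  : Unique edges
open Hypergraph public

e[_] : ∀ {r n} → Hypergraph r n → ℕ
e[ G ] = length (edges G)

toSubset : ∀ {n} → List (Fin n) → Subset n
toSubset = foldr (λ v s → ⁅ v ⁆ ∪ s) ∅

-- edges of the tight path with vertex order vs: the sets {v_i,...,v_{i+r-1}}
windows : ∀ {n} → ℕ → List (Fin n) → List (Subset n)
windows r [] = []
windows r (v ∷ vs) =
  if r ≤ᵇ suc (length vs) then toSubset (take r (v ∷ vs)) ∷ windows r vs else []

-- H is a tight linear forest: there are vertex-disjoint vertex sequences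
-- (tight paths) whose windows are exactly the edges of H; all other
-- vertices are isolated.
IsTightLinearForest : ∀ {r n} → Hypergraph r n → Set
IsTightLinearForest {r} {n} H =
  Σ (List (List (Fin n))) λ ps →
    Unique (concat ps) ×
    (∀ e → (e LM.∈ edges H) ⇔ (e LM.∈ concatMap (windows r) ps))

InL : ∀ {r n} → ℕ → Hypergraph r n → Set
InL k H = IsTightLinearForest H × e[ H ] ≡ k

IsImage : ∀ {n m} → (Fin n → Fin m) → Subset n → Subset m → Set
IsImage {n} f e e' = ∀ j → (j ∈ e') ⇔ (Σ (Fin n) λ i → i ∈ e × f i ≡ j)

ContainsCopy : ∀ {r n m} → Hypergraph r m → Hypergraph r n → Set
ContainsCopy {m = m} G H =
  Σ (Fin _ → Fin m) λ f → Injective _≡_ _≡_ f ×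
    All (λ e → Σ (Subset m) λ e' → e' LM.∈ edges G × IsImage f e e') (edges H)

ContainsL : ∀ {r n} → ℕ → Hypergraph r n → Set
ContainsL {r} {n} k G = Σ (Hypergraph r n) λ H → InL k H × ContainsCopy G H

IsExL : ℕ → ℕ → ℕ → ℕ → Set
IsExL r n k m =
  (Σ (Hypergraph r n) λ G → ¬ ContainsL k G × e[ G ] ≡ m) ×
  (∀ (G : Hypergraph r n) → ¬ ContainsL k G → e[ G ] ≤ m)

{-# OPTIONS --safe #-}
module Submission where

-- Lower bound: a vertex lies in at most r edges of a tight linear forest, so the r-sets
-- meeting a fixed set of fewer than k / r vertices contain no such forest with k edges.
--
-- Upper bound: a complete r-partite r-graph with parts of size t (a tile) contains a tight
-- path through all its vertices, so it suffices to cover slightly more than c n vertices by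
-- disjoint tiles.  A tiling covering less is improved at the price of a smaller t.  Sample
-- boundedly many blocks, in proportion some tiles and some sets of uncovered vertices, and
-- one vertex from every part of each block.  If there are too many edges, a positive fraction
-- of the samples spans a matching with more edges than there are sampled tiles: this is
-- Frankl's case of the Erdős matching conjecture, whose range is exactly c < 1/2.  One such
-- matching occurs on a whole product of t′-sets, one in every sampled part (Erdős's theorem
-- on complete multipartite hypergraphs), and turns into tiles of part size t′.  Since every
-- exchange takes equally many vertices from all parts of an old tile, the remainder of that
-- tile can still be cut into tiles of part size t′.  The exchanges can be repeated until a
-- constant fraction of the vertices has been gained, so boundedly many stages suffice.

open import Defs
open import Data.Bool using (Bool; true; false; _∧_; _∨_; not; if_then_else_; T)
import Data.Bool.Properties as 𝔹
open import Data.Empty using (⊥; ⊥-elim)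
open import Data.Fin using (Fin; zero; suc; toℕ; fromℕ<; inject≤; combine; remQuot; splitAt; _↑ˡ_; _↑ʳ_)
import Data.Fin.Properties as 𝔽
open import Data.Fin.Subset using (Subset; ⁅_⁆; _∪_; ∣_∣) renaming (⊥ to ∅)
import Data.Fin.Subset.Properties as 𝕊
open import Data.List using (List; []; _∷_; _++_; length; map; concat; concatMap; filter; take; allFin; upTo; cartesianProduct; cartesianProductWith) renaming (lookup to lookupᴸ)
import Data.List.Properties as 𝕃
open import Data.List.Membership.Propositional using (_∈_; find)
import Data.List.Membership.Propositional.Properties as ∈ₚ
open import Data.List.Relation.Unary.All as All using (All; []; _∷_)
import Data.List.Relation.Unary.All.Properties as Allₚ
open import Data.List.Relation.Unary.Any as Any using (Any; here; there)
open import Data.List.Relation.Unary.AllPairs as AllPairs using (AllPairs; []; _∷_)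
import Data.List.Relation.Unary.AllPairs.Properties as APₚ
open import Data.List.Relation.Unary.Unique.Propositional using (Unique)
import Data.List.Relation.Unary.Unique.Propositional.Properties as Uₚ
open import Data.Nat using (ℕ; zero; suc; _+_; _*_; _∸_; _^_; _≤_; _<_; z≤n; s≤s; _≤?_; _<?_; _≡ᵇ_; ∣_-_∣; NonZero; >-nonZero; >-nonZero⁻¹; _/_; _%_; _!; _≤ᵇ_)
open import Data.Nat.Combinatorics using (_C_; k>n⇒nCk≡0; nCk+nC[k+1]≡[n+1]C[k+1])
import Data.Nat.DivMod as ÷
open import Data.Nat.Properties
open import Data.Nat.Tactic.RingSolver using (solve-∀)
open import Data.Product using (Σ; ∃; _×_; _,_; proj₁; proj₂)
open import Data.Sum using (_⊎_; inj₁; inj₂)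
open import Data.Unit using (tt)
open import Data.Vec using (Vec; []; _∷_; lookup; _[_]≔_; tabulate) renaming (_++_ to _++ᵛ_)
import Data.Vec.Properties as 𝕍
open import Function using (_∘_; id)
open import Function.Bundles using (mk⇔; Equivalence)
open import Function.Definitions using (Injective)
open import Relation.Binary.PropositionalEquality hiding ([_]; J)
open import Relation.Nullary using (¬_; Dec; yes; no; does)
open import Relation.Nullary.Decidable using (¬?; _×-dec_; _→-dec_)

-- Finite sums

-- The accounting behind an exchange: `s₀` is slightly more than c times the number `B` of columns,
-- so as long as the tiling is too small to contain the forest, its tiles fit into `s₀` columns. An
-- exchange uses one block of every column, hence destroys the worth of at most `s₀` small tiles and
-- creates `s₀ + 1`. Uncovered vertices are arranged in blocks of the same shape, so that a sample
-- treats both kinds alike. The obstacle is that each stage shrinks the tiles while the gain must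
-- not shrink with them. Measured in vertices the gain of a stage is a fixed share of n that depends
-- only on the number `M` of sampled positions. So the number of stages is known in advance, part
-- sizes can be chosen from the last stage backwards, and the threshold on n is fixed before the
-- graph is given. Frankl's bound is proved by contradiction and yields a matching only under double
-- negation; an explicit one is recovered by counting over the finitely many candidates.
-- Probabilities appear as counts with cleared denominators.

∑ : {A : Set} → List A → (A → ℕ) → ℕ
∑ []       f = 0
∑ (x ∷ xs) f = f x + ∑ xs f

⟦_⟧ : Bool → ℕ
⟦ true ⟧  = 1
⟦ false ⟧ = 0

⟦⟧≤1 : ∀ b → ⟦ b ⟧ ≤ 1
⟦⟧≤1 true  = ≤-refl
⟦⟧≤1 false = z≤n

⟦⟧-mono : ∀ {a b} → (a ≡ true → b ≡ true) → ⟦ a ⟧ ≤ ⟦ b ⟧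
⟦⟧-mono {false}        _ = z≤n
⟦⟧-mono {true} {b}     f rewrite f refl = ≤-refl

⟦∧⟧ : ∀ a b → ⟦ a ∧ b ⟧ ≡ ⟦ a ⟧ * ⟦ b ⟧
⟦∧⟧ true  b = sym (*-identityˡ ⟦ b ⟧)
⟦∧⟧ false b = refl

true≢false : ∀ {A : Set} {b} → b ≡ true → b ≡ false → A
true≢false refl ()

dec-true : ∀ {P : Set} (d : Dec P) → P → does d ≡ true
dec-true (yes _) _ = refl
dec-true (no ¬p) p = ⊥-elim (¬p p)

true-dec : ∀ {P : Set} (d : Dec P) → does d ≡ true → P
true-dec (yes p) _ = p

dec-false : ∀ {P : Set} (d : Dec P) → ¬ P → does d ≡ false
dec-false (yes p) ¬p = ⊥-elim (¬p p)
dec-false (no _)  _  = refl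

∧-true : ∀ {a b} → a ∧ b ≡ true → a ≡ true × b ≡ true
∧-true {true} e = refl , e

module _ {A : Set} where

  ∑-mono-∈ : ∀ (xs : List A) {f g} → (∀ {x} → x ∈ xs → f x ≤ g x) → ∑ xs f ≤ ∑ xs g
  ∑-mono-∈ []       h = z≤n
  ∑-mono-∈ (x ∷ xs) h = +-mono-≤ (h (here refl)) (∑-mono-∈ xs (h ∘ there))

  ∑-mono : ∀ (xs : List A) {f g} → (∀ x → f x ≤ g x) → ∑ xs f ≤ ∑ xs g
  ∑-mono xs h = ∑-mono-∈ xs (λ {x} _ → h x)

  ∑-cong-∈ : ∀ (xs : List A) {f g} → (∀ {x} → x ∈ xs → f x ≡ g x) → ∑ xs f ≡ ∑ xs g
  ∑-cong-∈ []       h = refl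
  ∑-cong-∈ (x ∷ xs) h = cong₂ _+_ (h (here refl)) (∑-cong-∈ xs (h ∘ there))

  ∑-cong : ∀ (xs : List A) {f g} → (∀ x → f x ≡ g x) → ∑ xs f ≡ ∑ xs g
  ∑-cong xs h = ∑-cong-∈ xs (λ {x} _ → h x)

  ∑-++ : ∀ (xs ys : List A) f → ∑ (xs ++ ys) f ≡ ∑ xs f + ∑ ys f
  ∑-++ []       ys f = refl
  ∑-++ (x ∷ xs) ys f rewrite ∑-++ xs ys f = sym (+-assoc (f x) (∑ xs f) (∑ ys f))

  ∑-+ : ∀ (xs : List A) f g → ∑ xs (λ x → f x + g x) ≡ ∑ xs f + ∑ xs g
  ∑-+ []       f g = refl
  ∑-+ (x ∷ xs) f g rewrite ∑-+ xs f g = lem (f x) (g x) (∑ xs f) (∑ xs g)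
    where
    lem : ∀ a b c d → a + b + (c + d) ≡ a + c + (b + d)
    lem = solve-∀

  ∑-*ˡ : ∀ (xs : List A) c f → ∑ xs (λ x → c * f x) ≡ c * ∑ xs f
  ∑-*ˡ []       c f = sym (*-zeroʳ c)
  ∑-*ˡ (x ∷ xs) c f rewrite ∑-*ˡ xs c f = sym (*-distribˡ-+ c (f x) (∑ xs f))

  ∑-*ʳ : ∀ (xs : List A) c f → ∑ xs (λ x → f x * c) ≡ ∑ xs f * c
  ∑-*ʳ []       c f = refl
  ∑-*ʳ (x ∷ xs) c f rewrite ∑-*ʳ xs c f = sym (*-distribʳ-+ c (f x) (∑ xs f))

  ∑-const : ∀ (xs : List A) c → ∑ xs (λ _ → c) ≡ length xs * c
  ∑-const []       c = refl
  ∑-const (x ∷ xs) c = cong (c +_) (∑-const xs c)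

  ∑-zero : ∀ (xs : List A) → ∑ xs (λ _ → 0) ≡ 0
  ∑-zero xs = trans (∑-const xs 0) (*-zeroʳ (length xs))

  ∑-one : ∀ (xs : List A) → ∑ xs (λ _ → 1) ≡ length xs
  ∑-one xs = trans (∑-const xs 1) (*-identityʳ (length xs))

  term≤∑ : ∀ {xs : List A} {x} f → x ∈ xs → f x ≤ ∑ xs f
  term≤∑ f (here refl) = m≤m+n _ _
  term≤∑ f (there i)   = ≤-trans (term≤∑ f i) (m≤n+m _ _)

  ∑-≤const : ∀ (xs : List A) {f} c → (∀ {x} → x ∈ xs → f x ≤ c) → ∑ xs f ≤ length xs * c
  ∑-≤const xs c h = ≤-trans (∑-mono-∈ xs h) (≤-reflexive (∑-const xs c))

  ∑-pigeonhole : ∀ (xs : List A) f → 0 < ∑ xs f → ∃ λ x → x ∈ xs × ∑ xs f ≤ length xs * f x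
  ∑-pigeonhole (x ∷ xs) f pos with ∑ xs f in eq
  ... | zero rewrite +-identityʳ (f x) = x , here refl , m≤m+n (f x) _
  ... | suc k with ∑-pigeonhole xs f (subst (0 <_) (sym eq) (s≤s z≤n))
  ...   | y , y∈ , le with ≤-total (f x) (f y) | ≤-trans (≤-reflexive (sym eq)) le
  ...     | inj₁ fx≤fy | le′ = y , there y∈ , +-mono-≤ fx≤fy le′
  ...     | inj₂ fy≤fx | le′ = x , here refl , +-monoʳ-≤ (f x) (≤-trans le′ (*-monoʳ-≤ (length xs) fy≤fx))

∑-map : ∀ {A B : Set} (g : A → B) (xs : List A) f → ∑ (map g xs) f ≡ ∑ xs (f ∘ g)
∑-map g []       f = refl
∑-map g (x ∷ xs) f = cong (f (g x) +_) (∑-map g xs f)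

∑-concatMap : ∀ {A B : Set} (g : A → List B) (xs : List A) f →
  ∑ (concatMap g xs) f ≡ ∑ xs (λ x → ∑ (g x) f)
∑-concatMap g []       f = refl
∑-concatMap g (x ∷ xs) f = trans (∑-++ (g x) _ f) (cong (∑ (g x) f +_) (∑-concatMap g xs f))

∑-swap : ∀ {A B : Set} (xs : List A) (ys : List B) (f : A → B → ℕ) →
  ∑ xs (λ x → ∑ ys (f x)) ≡ ∑ ys (λ y → ∑ xs (λ x → f x y))
∑-swap []       ys f = sym (∑-zero ys)
∑-swap (x ∷ xs) ys f rewrite ∑-swap xs ys f = sym (∑-+ ys (f x) _)

subsets : ∀ n → List (Subset n)
subsets zero    = [] ∷ []
subsets (suc n) = map (false ∷_) (subsets n) ++ map (true ∷_) (subsets n)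

∑ˢ : ∀ {n} → (Subset n → ℕ) → ℕ
∑ˢ {n} = ∑ (subsets n)

∑ˢ-suc : ∀ {n} (f : Subset (suc n) → ℕ) → ∑ˢ f ≡ ∑ˢ (λ e → f (false ∷ e)) + ∑ˢ (λ e → f (true ∷ e))
∑ˢ-suc {n} f = trans (∑-++ (map (false ∷_) (subsets n)) _ f)
  (cong₂ _+_ (∑-map (false ∷_) (subsets n) f) (∑-map (true ∷_) (subsets n) f))

∈-subsets : ∀ {n} (e : Subset n) → e ∈ subsets n
∈-subsets []          = here refl
∈-subsets (false ∷ e) = ∈ₚ.∈-++⁺ˡ (∈ₚ.∈-map⁺ (false ∷_) (∈-subsets e))
∈-subsets (true ∷ e)  = ∈ₚ.∈-++⁺ʳ _ (∈ₚ.∈-map⁺ (true ∷_) (∈-subsets e))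

vecs : {A : Set} → List A → ∀ q → List (Vec A q)
vecs xs zero    = [] ∷ []
vecs xs (suc q) = concatMap (λ x → map (x ∷_) (vecs xs q)) xs

∑-vecs-suc : ∀ {A : Set} (xs : List A) q (f : Vec A (suc q) → ℕ) →
  ∑ (vecs xs (suc q)) f ≡ ∑ xs (λ x → ∑ (vecs xs q) (λ v → f (x ∷ v)))
∑-vecs-suc xs q f = trans (∑-concatMap _ xs f) (∑-cong xs (λ x → ∑-map (x ∷_) (vecs xs q) f))

length-vecs : ∀ {A : Set} (xs : List A) q → length (vecs xs q) ≡ length xs ^ q
length-vecs xs zero    = refl
length-vecs xs (suc q) = begin
  length (vecs xs (suc q))              ≡⟨ ∑-one (vecs xs (suc q)) ⟨
  ∑ (vecs xs (suc q)) (λ _ → 1)         ≡⟨ ∑-vecs-suc xs q _ ⟩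
  ∑ xs (λ _ → ∑ (vecs xs q) (λ _ → 1))  ≡⟨ ∑-cong xs (λ _ → trans (∑-one (vecs xs q)) (length-vecs xs q)) ⟩
  ∑ xs (λ _ → length xs ^ q)            ≡⟨ ∑-const xs _ ⟩
  length xs * length xs ^ q             ∎
  where open ≡-Reasoning

∈-vecs : ∀ {A : Set} {xs : List A} → (∀ x → x ∈ xs) → ∀ {q} (v : Vec A q) → v ∈ vecs xs q
∈-vecs all []      = here refl
∈-vecs all (x ∷ v) = ∈ₚ.∈-concatMap⁺ _ (Any.map (λ { refl → ∈ₚ.∈-map⁺ (x ∷_) (∈-vecs all v) }) (all x))

length-allFin : ∀ n → length (allFin n) ≡ n
length-allFin n = 𝕃.length-tabulate id

∑-allFin-suc : ∀ n (f : Fin (suc n) → ℕ) → ∑ (allFin (suc n)) f ≡ f zero + ∑ (allFin n) (f ∘ suc)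
∑-allFin-suc n f = cong (f zero +_) (trans (cong (λ l → ∑ l f) (sym (𝕃.map-tabulate id suc))) (∑-map suc (allFin n) f))

-- Compression of families of sets

-- Membership is Boolean, so that the size of a family is a sum of indicators and double counting is
-- an exchange of sums.
Family : ℕ → Set
Family n = Subset n → Bool

#_ : ∀ {n} → Family n → ℕ
# F = ∑ˢ (λ e → ⟦ F e ⟧)

Uniform : ∀ {n} → ℕ → Family n → Set
Uniform k F = ∀ {e} → F e ≡ true → ∣ e ∣ ≡ k

-- A record rather than a bare function type, so that the two sets can be inferred from a proof.
record Disjoint {n} (a b : Subset n) : Set where
  constructor disjoint
  field apart : ∀ i → lookup a i ≡ true → lookup b i ≡ true → ⊥
open Disjoint public

Disjoint-tail : ∀ {n x y} {a b : Subset n} → Disjoint (x ∷ a) (y ∷ b) → Disjoint a b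
Disjoint-tail d = disjoint (apart d ∘ suc)

Matching : ∀ {n} → Family n → ℕ → Set
Matching {n} F q = Σ (Fin q → Subset n) λ es →
  (∀ i → F (es i) ≡ true) × (∀ {i j} → i ≢ j → Disjoint (es i) (es j))

∑ˢ-suc² : ∀ {n} (f : Subset (suc (suc n)) → ℕ) →
  ∑ˢ f ≡ ∑ˢ (λ e → f (false ∷ false ∷ e) + f (false ∷ true ∷ e) + (f (true ∷ false ∷ e) + f (true ∷ true ∷ e)))
∑ˢ-suc² {n} f = trans (∑ˢ-suc f) (trans (cong₂ _+_ (step false) (step true)) (sym (∑-+ (subsets n) _ _)))
  where
  step : ∀ b → ∑ˢ (λ e → f (b ∷ e)) ≡ ∑ˢ (λ e → f (b ∷ false ∷ e) + f (b ∷ true ∷ e))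
  step b = trans (∑ˢ-suc (λ e → f (b ∷ e))) (sym (∑-+ (subsets n) _ _))

-- Smaller positions are the less favoured ones: a compression at i moves an
-- element from position i to position i + 1.
data Move : ∀ {n} → ℕ → Subset n → Subset n → Set where
  here  : ∀ {n} {e : Subset n} → Move 0 (true ∷ false ∷ e) (false ∷ true ∷ e)
  there : ∀ {n i a} {e e′ : Subset n} → Move i e e′ → Move (suc i) (a ∷ e) (a ∷ e′)

Stable : ∀ {n} → Family n → Set
Stable F = ∀ {i e e′} → Move i e e′ → F e ≡ true → F e′ ≡ true

move : ∀ {n} → ℕ → Subset n → Subset n
move zero    (true ∷ false ∷ e) = false ∷ true ∷ e
move zero    e                  = e
move (suc i) []                 = []
move (suc i) (a ∷ e)            = a ∷ move i e

swap : ∀ {n} → ℕ → Subset n → Subset n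
swap zero    (a ∷ b ∷ e) = b ∷ a ∷ e
swap zero    (a ∷ [])    = a ∷ []
swap zero    []          = []
swap (suc i) []          = []
swap (suc i) (a ∷ e)     = a ∷ swap i e

-- The shift of Erdős, Ko and Rado for the adjacent positions `i` and `i + 1`: a set with "10" there
-- survives only if its "01" partner is a member too, and otherwise the partner replaces it.
-- Adjacent shifts suffice, since `slide` composes them into longer ones.
compress : ∀ {n} → ℕ → Family n → Family n
compress zero    F []                 = F []
compress zero    F (a ∷ [])           = F (a ∷ [])
compress zero    F (false ∷ false ∷ e) = F (false ∷ false ∷ e)
compress zero    F (false ∷ true ∷ e) = F (false ∷ true ∷ e) ∨ F (true ∷ false ∷ e)
compress zero    F (true ∷ false ∷ e) = F (true ∷ false ∷ e) ∧ F (false ∷ true ∷ e)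
compress zero    F (true ∷ true ∷ e)  = F (true ∷ true ∷ e)
compress (suc i) F []                 = F []
compress (suc i) F (a ∷ e)            = compress i (λ e → F (a ∷ e)) e

move-Move : ∀ {n i} {e e′ : Subset n} → Move i e e′ → move i e ≡ e′
move-Move here      = refl
move-Move (there m) = cong (_ ∷_) (move-Move m)

Move-< : ∀ {n i} {e e′ : Subset n} → Move i e e′ → i < n
Move-< here      = s≤s z≤n
Move-< (there m) = s≤s (Move-< m)

Move-∣∣ : ∀ {n i} {e e′ : Subset n} → Move i e e′ → ∣ e′ ∣ ≡ ∣ e ∣
Move-∣∣ here                  = refl
Move-∣∣ (there {a = true} m)  = cong suc (Move-∣∣ m)
Move-∣∣ (there {a = false} m) = Move-∣∣ m

-- The sum of the positions of the elements, counted from 0: prefixing an entry pushes every element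
-- of `e` up by one.
weight : ∀ {n} → Subset n → ℕ
weight []      = 0
weight (a ∷ e) = weight e + ∣ e ∣

Move-weight : ∀ {n i} {e e′ : Subset n} → Move i e e′ → weight e′ ≡ weight e + 1
Move-weight {e = true ∷ false ∷ e} here = lem (weight e) ∣ e ∣
  where
  lem : ∀ w c → w + c + suc c ≡ w + c + c + 1
  lem = solve-∀
Move-weight {e = a ∷ e} (there m) rewrite Move-weight m | Move-∣∣ m = lem (weight e) ∣ e ∣
  where
  lem : ∀ w c → w + 1 + c ≡ w + c + 1
  lem = solve-∀

-- The number of sets that the compression at `i` really displaces; when it is 0 for every `i`, the
-- family is stable.
gap : ∀ {n} → ℕ → Family n → ℕ
gap i F = ∑ˢ (λ e → ⟦ F e ∧ not (F (move i e)) ⟧)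

⟦b∧¬b⟧ : ∀ b → ⟦ b ∧ not b ⟧ ≡ 0
⟦b∧¬b⟧ true  = refl
⟦b∧¬b⟧ false = refl

-- One computation for two purposes: `g` constant and `δ = 0` shows that the size is preserved,
-- `g = weight` and `δ = 1` that the potential of `stabilise` grows by the gap.
∑-compress : ∀ {n} i (F : Family n) δ (g : Subset n → ℕ) → (∀ {e e′} → Move i e e′ → g e′ ≡ g e + δ) →
  ∑ˢ (λ e → ⟦ compress i F e ⟧ * g e) ≡ ∑ˢ (λ e → ⟦ F e ⟧ * g e) + gap i F * δ
∑-compress {zero} zero F δ g h rewrite ⟦b∧¬b⟧ (F []) = sym (+-identityʳ _)
∑-compress {suc zero} zero F δ g h
  rewrite ⟦b∧¬b⟧ (F (true ∷ [])) | ⟦b∧¬b⟧ (F (false ∷ [])) = sym (+-identityʳ _)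
∑-compress {suc (suc n)} zero F δ g h = begin
  ∑ˢ (λ e → ⟦ compress 0 F e ⟧ * g e)
    ≡⟨ ∑ˢ-suc² (λ e → ⟦ compress 0 F e ⟧ * g e) ⟩
  _
    ≡⟨ ∑-cong (subsets n) pointwise ⟩
  ∑ˢ (λ e → quad e + ⟦ F (true ∷ false ∷ e) ∧ not (F (false ∷ true ∷ e)) ⟧ * δ)
    ≡⟨ ∑-+ (subsets n) quad _ ⟩
  ∑ˢ quad + ∑ˢ (λ e → ⟦ F (true ∷ false ∷ e) ∧ not (F (false ∷ true ∷ e)) ⟧ * δ)
    ≡⟨ cong₂ _+_ (sym (∑ˢ-suc² (λ e → ⟦ F e ⟧ * g e))) (trans (∑-*ʳ (subsets n) δ _) (cong (_* δ) gap-eq)) ⟩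
  ∑ˢ (λ e → ⟦ F e ⟧ * g e) + gap 0 F * δ ∎
  where
  open ≡-Reasoning
  quad : Subset n → ℕ
  quad e = ⟦ F (false ∷ false ∷ e) ⟧ * g (false ∷ false ∷ e) + ⟦ F (false ∷ true ∷ e) ⟧ * g (false ∷ true ∷ e)
    + (⟦ F (true ∷ false ∷ e) ⟧ * g (true ∷ false ∷ e) + ⟦ F (true ∷ true ∷ e) ⟧ * g (true ∷ true ∷ e))
  boolean : ∀ a b x y z w δ → y ≡ z + δ →
    x + ⟦ a ∨ b ⟧ * y + (⟦ b ∧ a ⟧ * z + w) ≡ x + ⟦ a ⟧ * y + (⟦ b ⟧ * z + w) + ⟦ b ∧ not a ⟧ * δ
  boolean true  true  x y z w δ refl = lem x z w δ
    where
    lem : ∀ x z w δ → x + 1 * (z + δ) + (1 * z + w) ≡ x + 1 * (z + δ) + (1 * z + w) + 0 * δ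
    lem = solve-∀
  boolean true  false x y z w δ refl = lem x z w δ
    where
    lem : ∀ x z w δ → x + 1 * (z + δ) + (0 * z + w) ≡ x + 1 * (z + δ) + (0 * z + w) + 0 * δ
    lem = solve-∀
  boolean false true  x y z w δ refl = lem x z w δ
    where
    lem : ∀ x z w δ → x + 1 * (z + δ) + (0 * z + w) ≡ x + 0 * (z + δ) + (1 * z + w) + 1 * δ
    lem = solve-∀
  boolean false false x y z w δ refl = lem x z w δ
    where
    lem : ∀ x z w δ → x + 0 * (z + δ) + (0 * z + w) ≡ x + 0 * (z + δ) + (0 * z + w) + 0 * δ
    lem = solve-∀
  pointwise : ∀ e → _ ≡ quad e + ⟦ F (true ∷ false ∷ e) ∧ not (F (false ∷ true ∷ e)) ⟧ * δ
  pointwise e = boolean (F (false ∷ true ∷ e)) (F (true ∷ false ∷ e))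
    (⟦ F (false ∷ false ∷ e) ⟧ * g (false ∷ false ∷ e)) (g (false ∷ true ∷ e)) (g (true ∷ false ∷ e))
    (⟦ F (true ∷ true ∷ e) ⟧ * g (true ∷ true ∷ e)) δ (h here)
  gap-eq : ∑ˢ (λ e → ⟦ F (true ∷ false ∷ e) ∧ not (F (false ∷ true ∷ e)) ⟧) ≡ gap 0 F
  gap-eq = sym (trans (∑ˢ-suc² (λ e → ⟦ F e ∧ not (F (move 0 e)) ⟧)) (∑-cong (subsets n) λ e → four (F (false ∷ false ∷ e)) (F (false ∷ true ∷ e)) _ (F (true ∷ true ∷ e))))
    where
    four : ∀ a b x d → ⟦ a ∧ not a ⟧ + ⟦ b ∧ not b ⟧ + (x + ⟦ d ∧ not d ⟧) ≡ x
    four a b x d rewrite ⟦b∧¬b⟧ a | ⟦b∧¬b⟧ b | ⟦b∧¬b⟧ d = +-identityʳ x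
∑-compress {zero} (suc i) F δ g h rewrite ⟦b∧¬b⟧ (F []) = sym (+-identityʳ _)
∑-compress {suc n} (suc i) F δ g h = begin
  ∑ˢ (λ e → ⟦ compress (suc i) F e ⟧ * g e)
    ≡⟨ ∑ˢ-suc (λ e → ⟦ compress (suc i) F e ⟧ * g e) ⟩
  ∑ˢ (λ e → ⟦ compress i (F ∘ (false ∷_)) e ⟧ * g (false ∷ e)) + ∑ˢ (λ e → ⟦ compress i (F ∘ (true ∷_)) e ⟧ * g (true ∷ e))
    ≡⟨ cong₂ _+_ (∑-compress i (F ∘ (false ∷_)) δ (g ∘ (false ∷_)) (h ∘ there)) (∑-compress i (F ∘ (true ∷_)) δ (g ∘ (true ∷_)) (h ∘ there)) ⟩
  _ ≡⟨ lem (∑ˢ (λ e → ⟦ F (false ∷ e) ⟧ * g (false ∷ e))) _ (gap i (F ∘ (false ∷_))) (gap i (F ∘ (true ∷_))) δ ⟩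
  _ ≡⟨ cong₂ (λ a b → a + b * δ) (sym (∑ˢ-suc (λ e → ⟦ F e ⟧ * g e))) (sym (∑ˢ-suc (λ e → ⟦ F e ∧ not (F (move (suc i) e)) ⟧))) ⟩
  ∑ˢ (λ e → ⟦ F e ⟧ * g e) + gap (suc i) F * δ ∎
  where
  open ≡-Reasoning
  lem : ∀ a b x y δ → a + x * δ + (b + y * δ) ≡ a + b + (x + y) * δ
  lem = solve-∀

#-compress : ∀ {n} i (F : Family n) → # compress i F ≡ # F
#-compress {n} i F = begin
  # compress i F                      ≡⟨ ∑-cong (subsets n) (λ e → sym (*-identityʳ _)) ⟩
  ∑ˢ (λ e → ⟦ compress i F e ⟧ * 1)   ≡⟨ ∑-compress i F 0 (λ _ → 1) (λ _ → refl) ⟩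
  ∑ˢ (λ e → ⟦ F e ⟧ * 1) + gap i F * 0 ≡⟨ cong₂ _+_ (∑-cong (subsets n) (λ e → *-identityʳ _)) (*-zeroʳ (gap i F)) ⟩
  # F + 0                             ≡⟨ +-identityʳ _ ⟩
  # F                                 ∎
  where open ≡-Reasoning

-- The set a is one that compression moved into the family, so a has "01" at the
-- compressed pair; then b, being disjoint from a, has "00" or "10" there.
compress-disjoint : ∀ {n} i (F F′ : Family n) {a b} → compress i F a ≡ true → F a ≡ false →
  compress i F′ b ≡ true → Disjoint a b → F (swap i a) ≡ true × F′ (swap i b) ≡ true
compress-disjoint zero F F′ {[]} p q r d = true≢false p q
compress-disjoint zero F F′ {a ∷ []} p q r d = true≢false p q
compress-disjoint zero F F′ {false ∷ false ∷ a} p q r d = true≢false p q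
compress-disjoint zero F F′ {true ∷ true ∷ a} p q r d = true≢false p q
compress-disjoint zero F F′ {true ∷ false ∷ a} p q r d = true≢false (proj₁ (∧-true p)) q
compress-disjoint zero F F′ {false ∷ true ∷ a} {b₀ ∷ true ∷ b} p q r d = ⊥-elim (apart d (suc zero) refl refl)
compress-disjoint zero F F′ {false ∷ true ∷ a} {false ∷ false ∷ b} p q r d rewrite q = p , r
compress-disjoint zero F F′ {false ∷ true ∷ a} {true ∷ false ∷ b} p q r d rewrite q = p , proj₂ (∧-true r)
compress-disjoint (suc i) F F′ {[]} p q r d = true≢false p q
-- The heads `x` and `y` may differ, and then the two sets continue in different links of one
-- family; this is why the lemma speaks of two families.
compress-disjoint (suc i) F F′ {x ∷ a} {y ∷ b} p q r d =
  compress-disjoint i (F ∘ (x ∷_)) (F′ ∘ (y ∷_)) p q r (Disjoint-tail d)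

compress-swap : ∀ {n} i (F : Family n) {a} → compress i F a ≡ true → F a ≡ false → F (swap i a) ≡ true
compress-swap i F {a} p q = proj₁ (compress-disjoint i F (λ _ → true) {a} {∅} p q (always i ∅) (disjoint λ j _ x →
  true≢false x (𝕍.lookup-replicate j false)))
  where
  always : ∀ {n} i (b : Subset n) → compress i (λ _ → true) b ≡ true
  always zero []                  = refl
  always zero (a ∷ [])            = refl
  always zero (false ∷ false ∷ b) = refl
  always zero (false ∷ true ∷ b)  = refl
  always zero (true ∷ false ∷ b)  = refl
  always zero (true ∷ true ∷ b)   = refl
  always (suc i) []               = refl
  always (suc i) (x ∷ b)          = always i b

swap-disjoint : ∀ {n} i {a b : Subset n} → Disjoint a b → Disjoint (swap i a) (swap i b)
swap-disjoint zero    {[]} {[]} d = d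
swap-disjoint zero    {x ∷ []} {y ∷ []} d = d
swap-disjoint zero    {x ∷ x′ ∷ a} {y ∷ y′ ∷ b} d = disjoint λ
  { zero          → apart d (suc zero)
  ; (suc zero)    → apart d zero
  ; (suc (suc j)) → apart d (suc (suc j)) }
swap-disjoint (suc i) {[]} {[]} d = d
swap-disjoint (suc i) {x ∷ a} {y ∷ b} d = disjoint λ
  { zero    → apart d zero
  ; (suc j) → apart (swap-disjoint i (Disjoint-tail d)) j }

∣swap∣ : ∀ {n} i (a : Subset n) → ∣ swap i a ∣ ≡ ∣ a ∣
∣swap∣ zero    []                  = refl
∣swap∣ zero    (x ∷ [])            = refl
∣swap∣ zero    (true ∷ true ∷ a)   = refl
∣swap∣ zero    (true ∷ false ∷ a)  = refl
∣swap∣ zero    (false ∷ true ∷ a)  = refl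
∣swap∣ zero    (false ∷ false ∷ a) = refl
∣swap∣ (suc i) []                  = refl
∣swap∣ (suc i) (true ∷ a)          = cong suc (∣swap∣ i a)
∣swap∣ (suc i) (false ∷ a)         = ∣swap∣ i a

-- Either no edge of the matching is new, and it lies in `F` already, or some edge is. In that case
-- exchanging the two positions in all edges at once keeps them disjoint and, by
-- `compress-disjoint`, brings all of them into `F`.
Matching-compress : ∀ {n q} i (F : Family n) → Matching (compress i F) q → Matching F q
Matching-compress {q = q} i F (es , all , dis) with 𝔽.all? (λ j → F (es j) 𝔹.≟ true)
... | yes p = es , p , dis
... | no ¬p with 𝔽.¬∀⟶∃¬ q _ (λ j → F (es j) 𝔹.≟ true) ¬p
...   | j₀ , ¬Fj₀ = swap i ∘ es , good , λ ne → swap-disjoint i (dis ne)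
  where
  j₀-new : F (es j₀) ≡ false
  j₀-new = 𝔹.¬-not ¬Fj₀
  good : ∀ j → F (swap i (es j)) ≡ true
  good j with j₀ 𝔽.≟ j
  ... | yes refl = compress-swap i F (all j) j₀-new
  ... | no ne    = proj₂ (compress-disjoint i F F (all j₀) j₀-new (all j) (dis ne))

Uniform-compress : ∀ {n k} i (F : Family n) → Uniform k F → Uniform k (compress i F)
Uniform-compress i F u {e} p with F e in eq
... | true  = u eq
... | false = trans (sym (∣swap∣ i e)) (u (compress-swap i F p eq))

-- A compression with nonzero gap raises the total weight `Φ`, which never exceeds the weight `W` of
-- all subsets together; the fuel bounds the distance from `Φ` to `W`.
stabilise : ∀ {n} k (F : Family n) → Uniform k F → Σ (Family n) λ F′ →
  Stable F′ × Uniform k F′ × # F′ ≡ # F × (∀ {q} → Matching F′ q → Matching F q)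
stabilise {n} k F u = loop W F u (m≤n+m W (Φ F))
  where
  W : ℕ
  W = ∑ (subsets n) weight
  Φ : Family n → ℕ
  Φ F = ∑ˢ (λ e → ⟦ F e ⟧ * weight e)
  Φ-compress : ∀ i F → Φ (compress i F) ≡ Φ F + gap i F
  Φ-compress i F = trans (∑-compress i F 1 weight Move-weight) (cong (Φ F +_) (*-identityʳ _))
  Φ≤ : ∀ F → Φ F ≤ W
  Φ≤ F = ∑-mono (subsets n) (λ e → ≤-trans (*-monoˡ-≤ (weight e) (⟦⟧≤1 (F e))) (≤-reflexive (*-identityˡ _)))
  loop : ∀ fuel F → Uniform k F → W ≤ Φ F + fuel → Σ (Family n) λ F′ →
    Stable F′ × Uniform k F′ × # F′ ≡ # F × (∀ {q} → Matching F′ q → Matching F q)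
  loop fuel F u h with ∑ (upTo n) (λ i → gap i F) in eq
  loop fuel F u h | zero = F , stable , u , refl , id
    where
    stable : Stable F
    stable {i} {e} {e′} m Fe with F e′ in Fe′
    ... | true  = refl
    ... | false = ⊥-elim (1+n≰n (≤-trans one (≤-trans (term≤∑ (λ e → ⟦ F e ∧ not (F (move i e)) ⟧) (∈-subsets e))
            (≤-trans (term≤∑ (λ i → gap i F) (∈ₚ.∈-upTo⁺ (Move-< m))) (≤-reflexive eq)))))
      where
      one : 1 ≤ ⟦ F e ∧ not (F (move i e)) ⟧
      one rewrite Fe | move-Move m | Fe′ = ≤-refl
  loop fuel F u h | suc _ with ∑-pigeonhole (upTo n) (λ i → gap i F) (subst (0 <_) (sym eq) (s≤s z≤n))
  ... | i , _ , le with gap i F in gap-eq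
  ...   | zero = ⊥-elim (1+n≰n (≤-trans (s≤s z≤n) (subst₂ _≤_ eq (*-zeroʳ (length (upTo n))) le)))
  ...   | suc x with fuel
  ...     | zero = ⊥-elim (1+n≰n (≤-trans (s≤s h) (≤-trans (≤-trans (≤-reflexive (lem (Φ F)))
               (+-monoʳ-≤ (Φ F) (≤-trans (s≤s z≤n) (≤-reflexive (sym gap-eq)))))
               (≤-trans (≤-reflexive (sym (Φ-compress i F))) (Φ≤ (compress i F))))))
    where
    lem : ∀ a → suc (a + 0) ≡ a + 1
    lem = solve-∀
  ...     | suc fuel with loop fuel (compress i F) (Uniform-compress i F u)
               (≤-trans h (≤-trans (≤-reflexive (lem (Φ F) fuel)) (+-monoˡ-≤ fuel (≤-trans
                 (+-monoʳ-≤ (Φ F) (≤-trans (s≤s z≤n) (≤-reflexive (sym gap-eq)))) (≤-reflexive (sym (Φ-compress i F)))))))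
    where
    lem : ∀ a f → a + suc f ≡ a + 1 + f
    lem = solve-∀
  ...       | F′ , st , u′ , eq′ , mat = F′ , st , u′ , trans eq′ (#-compress i F) , Matching-compress i F ∘ mat

-- Choosing distinct elements, and the shadow of a stable family

Unique-lookup : ∀ {A : Set} {xs : List A} → Unique xs → ∀ i j → lookupᴸ xs i ≡ lookupᴸ xs j → i ≡ j
Unique-lookup (_ ∷ _)  zero    zero    _ = refl
Unique-lookup (x∉ ∷ _) zero    (suc j) e = ⊥-elim (All.lookup x∉ (∈ₚ.∈-lookup j) e)
Unique-lookup (x∉ ∷ _) (suc i) zero    e = ⊥-elim (All.lookup x∉ (∈ₚ.∈-lookup i) (sym e))
Unique-lookup (_ ∷ u)  (suc i) (suc j) e = cong suc (Unique-lookup u i j e)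

choose : ∀ {A : Set} {q} (xs : List A) → Unique xs → q ≤ length xs →
  Σ (Fin q → A) λ f → (∀ i → f i ∈ xs) × Injective _≡_ _≡_ f
choose xs u le = (λ i → lookupᴸ xs (inject≤ i le)) , (λ i → ∈ₚ.∈-lookup (inject≤ i le)) ,
  λ {i} {j} eq → 𝔽.inject≤-injective le le i j (Unique-lookup u _ _ eq)

elements : ∀ {n} → Subset n → List (Fin n)
elements []          = []
elements (true ∷ e)  = zero ∷ map suc (elements e)
elements (false ∷ e) = map suc (elements e)

length-elements : ∀ {n} (e : Subset n) → length (elements e) ≡ ∣ e ∣
length-elements []          = refl
length-elements (true ∷ e)  = cong suc (trans (𝕃.length-map suc (elements e)) (length-elements e))
length-elements (false ∷ e) = trans (𝕃.length-map suc (elements e)) (length-elements e)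

elements-Unique : ∀ {n} (e : Subset n) → Unique (elements e)
elements-Unique []          = []
elements-Unique (true ∷ e)  = Allₚ.map⁺ (All.universal (λ _ ()) (elements e)) ∷ Uₚ.map⁺ 𝔽.suc-injective (elements-Unique e)
elements-Unique (false ∷ e) = Uₚ.map⁺ 𝔽.suc-injective (elements-Unique e)

∈-elements⁺ : ∀ {n} (e : Subset n) {i} → lookup e i ≡ true → i ∈ elements e
∈-elements⁺ (true ∷ e)  {zero}  p = here refl
∈-elements⁺ (true ∷ e)  {suc i} p = there (∈ₚ.∈-map⁺ suc (∈-elements⁺ e p))
∈-elements⁺ (false ∷ e) {suc i} p = ∈ₚ.∈-map⁺ suc (∈-elements⁺ e p)

∈-elements⁻ : ∀ {n} (e : Subset n) {i} → i ∈ elements e → lookup e i ≡ true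
∈-elements⁻ (true ∷ e) (here refl) = refl
∈-elements⁻ (true ∷ e) (there i∈) with ∈ₚ.∈-map⁻ suc i∈
... | j , j∈ , refl = ∈-elements⁻ e j∈
∈-elements⁻ (false ∷ e) i∈ with ∈ₚ.∈-map⁻ suc i∈
... | j , j∈ , refl = ∈-elements⁻ e j∈

lookup-insert : ∀ {n} (g : Subset n) x {i} → lookup (g [ x ]≔ true) i ≡ true → i ≡ x ⊎ lookup g i ≡ true
lookup-insert g x {i} p with i 𝔽.≟ x
... | yes i≡x = inj₁ i≡x
... | no i≢x  = inj₂ (trans (sym (𝕍.lookup∘update′ i≢x g true)) p)

⋃ : ∀ {n} q → (Fin q → Subset n) → Subset n
⋃ zero    G = ∅
⋃ (suc q) G = G zero ∪ ⋃ q (G ∘ suc)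

∣∪∣≤ : ∀ {n} (p q : Subset n) → ∣ p ∪ q ∣ ≤ ∣ p ∣ + ∣ q ∣
∣∪∣≤ []          []          = z≤n
∣∪∣≤ (false ∷ p) (false ∷ q) = ∣∪∣≤ p q
∣∪∣≤ (false ∷ p) (true ∷ q)  = ≤-trans (s≤s (∣∪∣≤ p q)) (≤-reflexive (sym (+-suc ∣ p ∣ ∣ q ∣)))
∣∪∣≤ (true ∷ p)  (false ∷ q) = s≤s (∣∪∣≤ p q)
∣∪∣≤ (true ∷ p)  (true ∷ q)  = s≤s (≤-trans (∣∪∣≤ p q) (+-monoʳ-≤ ∣ p ∣ (n≤1+n ∣ q ∣)))

∣⋃∣≤ : ∀ {n k} q (G : Fin q → Subset n) → (∀ i → ∣ G i ∣ ≡ k) → ∣ ⋃ q G ∣ ≤ q * k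
∣⋃∣≤ {n} zero G h = ≤-reflexive (𝕊.∣⊥∣≡0 n)
∣⋃∣≤ (suc q) G h = ≤-trans (∣∪∣≤ (G zero) _) (+-mono-≤ (≤-reflexive (h zero)) (∣⋃∣≤ q (G ∘ suc) (h ∘ suc)))

lookup-⋃ : ∀ {n} q (G : Fin q → Subset n) j {x} → lookup (G j) x ≡ true → lookup (⋃ q G) x ≡ true
lookup-⋃ (suc q) G zero {x} p rewrite 𝕍.lookup-zipWith _∨_ x (G zero) (⋃ q (G ∘ suc)) | p = refl
lookup-⋃ (suc q) G (suc j) {x} p
  rewrite 𝕍.lookup-zipWith _∨_ x (G zero) (⋃ q (G ∘ suc)) | lookup-⋃ q (G ∘ suc) j p = 𝔹.∨-zeroʳ _

Stable-∷ : ∀ {n} {F : Family (suc n)} a → Stable F → Stable (F ∘ (a ∷_))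
Stable-∷ a st = st ∘ there

-- The head element travels to the free position `x` by adjacent moves. If the next position is
-- occupied, the element there travels to `x` first and the head then steps into its place.
slide : ∀ {n} (F : Family (suc n)) → Stable F → ∀ g x → lookup g x ≡ false →
  F (true ∷ g) ≡ true → F (false ∷ (g [ x ]≔ true)) ≡ true
slide F st (false ∷ g) zero    _ p = st here p
slide F st (true ∷ g)  (suc x) q p = st here (slide (F ∘ (true ∷_)) (Stable-∷ true st) g x q p)
slide F st (false ∷ g) (suc x) q p = slide (F ∘ (false ∷_)) (Stable-∷ false st) g x q (st here p)

#-suc : ∀ {n} (F : Family (suc n)) → # F ≡ # (F ∘ (false ∷_)) + # (F ∘ (true ∷_))
#-suc F = ∑ˢ-suc (λ e → ⟦ F e ⟧)

-- Double counting of the pairs of a member of `F` and one of its elements: removing the element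
-- gives a member of `E`, which has at most `n ∸ ∣ e ∣` extensions. The weighted form needs no
-- uniformity, so that it can be split at the head; removals of the head itself give `# F₁ ≤ # E₀`.
shadow-count : ∀ {n} (F E : Family n) →
  (∀ e i → F e ≡ true → lookup e i ≡ true → E (e [ i ]≔ false) ≡ true) →
  ∑ˢ (λ e → ⟦ F e ⟧ * ∣ e ∣) ≤ ∑ˢ (λ e → ⟦ E e ⟧ * (n ∸ ∣ e ∣))
shadow-count {zero} F E h = ≤-trans (≤-reflexive (cong (_+ 0) (*-zeroʳ ⟦ F [] ⟧))) z≤n
shadow-count {suc n} F E h = begin
  ∑ˢ (λ e → ⟦ F e ⟧ * ∣ e ∣)
    ≡⟨ ∑ˢ-suc (λ e → ⟦ F e ⟧ * ∣ e ∣) ⟩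
  ∑ˢ (λ e → ⟦ F₀ e ⟧ * ∣ e ∣) + ∑ˢ (λ e → ⟦ F₁ e ⟧ * suc ∣ e ∣)
    ≡⟨ cong (∑ˢ (λ e → ⟦ F₀ e ⟧ * ∣ e ∣) +_) (trans (∑-cong (subsets n) (λ e → *-suc ⟦ F₁ e ⟧ ∣ e ∣)) (∑-+ (subsets n) _ _)) ⟩
  ∑ˢ (λ e → ⟦ F₀ e ⟧ * ∣ e ∣) + (# F₁ + ∑ˢ (λ e → ⟦ F₁ e ⟧ * ∣ e ∣))
    ≤⟨ +-mono-≤ (shadow-count F₀ E₀ (λ e i → h (false ∷ e) (suc i)))
         (+-mono-≤ (∑-mono (subsets n) (λ e → ⟦⟧-mono (λ p → h (true ∷ e) zero p refl)))
           (shadow-count F₁ E₁ (λ e i → h (true ∷ e) (suc i)))) ⟩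
  ∑ˢ (λ e → ⟦ E₀ e ⟧ * (n ∸ ∣ e ∣)) + (# E₀ + ∑ˢ (λ e → ⟦ E₁ e ⟧ * (n ∸ ∣ e ∣)))
    ≡⟨ lem _ (# E₀) _ ⟩
  (# E₀ + ∑ˢ (λ e → ⟦ E₀ e ⟧ * (n ∸ ∣ e ∣))) + ∑ˢ (λ e → ⟦ E₁ e ⟧ * (n ∸ ∣ e ∣))
    ≡⟨ cong (_+ ∑ˢ (λ e → ⟦ E₁ e ⟧ * (n ∸ ∣ e ∣))) (trans (sym (∑-+ (subsets n) _ _)) (∑-cong (subsets n) step)) ⟩
  ∑ˢ (λ e → ⟦ E₀ e ⟧ * (suc n ∸ ∣ e ∣)) + ∑ˢ (λ e → ⟦ E₁ e ⟧ * (n ∸ ∣ e ∣))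
    ≡⟨ ∑ˢ-suc (λ e → ⟦ E e ⟧ * (suc n ∸ ∣ e ∣)) ⟨
  ∑ˢ (λ e → ⟦ E e ⟧ * (suc n ∸ ∣ e ∣)) ∎
  where
  open ≤-Reasoning
  F₀ F₁ E₀ E₁ : Family n
  F₀ = F ∘ (false ∷_)
  F₁ = F ∘ (true ∷_)
  E₀ = E ∘ (false ∷_)
  E₁ = E ∘ (true ∷_)
  lem : ∀ a b c → a + (b + c) ≡ b + a + c
  lem = solve-∀
  step : ∀ e → ⟦ E₀ e ⟧ + ⟦ E₀ e ⟧ * (n ∸ ∣ e ∣) ≡ ⟦ E₀ e ⟧ * (suc n ∸ ∣ e ∣)
  step e = trans (sym (*-suc ⟦ E₀ e ⟧ _)) (cong (⟦ E₀ e ⟧ *_) (sym (+-∸-assoc 1 (𝕊.∣p∣≤n e))))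

#-weighted : ∀ {n k} (F : Family n) (g : Subset n → ℕ) → (∀ {e} → F e ≡ true → g e ≡ k) →
  ∑ˢ (λ e → ⟦ F e ⟧ * g e) ≡ # F * k
#-weighted {n} {k} F g h = trans (∑-cong (subsets n) pointwise) (∑-*ʳ (subsets n) k (λ e → ⟦ F e ⟧))
  where
  pointwise : ∀ e → ⟦ F e ⟧ * g e ≡ ⟦ F e ⟧ * k
  pointwise e with F e in eq
  ... | true  = cong (1 *_) (h eq)
  ... | false = refl

#-empty : ∀ {n} (F : Family n) → (∀ e → F e ≡ true → ⊥) → # F ≡ 0
#-empty {n} F h = trans (∑-cong (subsets n) pointwise) (∑-zero (subsets n))
  where
  pointwise : ∀ e → ⟦ F e ⟧ ≡ 0
  pointwise e with F e in eq
  ... | true  = ⊥-elim (h e eq)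
  ... | false = refl

∣∣≡0 : ∀ {n} (e : Subset n) → ∣ e ∣ ≡ 0 → ∀ i → lookup e i ≡ true → ⊥
∣∣≡0 (true ∷ e)  () zero    p
∣∣≡0 (false ∷ e) h  (suc i) p = ∣∣≡0 e h i p

-- Each set of a matching in the link of the head can be completed to a member
-- of F by an unused element, the head itself serving the first one.
link-matching : ∀ {n k s} (F : Family (suc n)) → Stable F → Uniform k (F ∘ (true ∷_)) →
  suc s * k + s ≤ n → Matching (F ∘ (true ∷_)) (suc s) → Matching F (suc s)
link-matching {n} {k} {s} F st u room (G , all , dis) = es , es∈F , es-disjoint
  where
  free : Subset n
  free = Data.Fin.Subset.∁ (⋃ (suc s) G)
  s≤free : s ≤ length (elements free)
  s≤free = ≤-trans (m+n≤o⇒m≤o∸n s (≤-trans (≤-reflexive (+-comm s (suc s * k))) room)) (≤-trans (∸-monoʳ-≤ n (∣⋃∣≤ (suc s) G (λ i → u (all i))))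
    (≤-reflexive (trans (sym (𝕊.∣∁p∣≡n∸∣p∣ (⋃ (suc s) G))) (sym (length-elements free)))))
  chosen : Σ (Fin s → Fin n) λ f → (∀ i → f i ∈ elements free) × Injective _≡_ _≡_ f
  chosen = choose (elements free) (elements-Unique free) s≤free
  x : Fin s → Fin n
  x = proj₁ chosen
  fresh : ∀ i j → lookup (G j) (x i) ≡ true → ⊥
  fresh i j p with ∈-elements⁻ free (proj₁ (proj₂ chosen) i)
  ... | q rewrite 𝕍.lookup-map (x i) not (⋃ (suc s) G) | lookup-⋃ (suc s) G j p = true≢false refl (sym q)
  es : Fin (suc s) → Subset (suc n)
  es zero    = true ∷ G zero
  es (suc i) = false ∷ (G (suc i) [ x i ]≔ true)
  es∈F : ∀ i → F (es i) ≡ true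
  es∈F zero    = all zero
  es∈F (suc i) = slide F st (G (suc i)) (x i) (𝔹.¬-not (fresh i (suc i))) (all (suc i))
  zero-disjoint : ∀ j i → lookup (G zero) i ≡ true → lookup (G (suc j) [ x j ]≔ true) i ≡ true → ⊥
  zero-disjoint j i p q with lookup-insert (G (suc j)) (x j) q
  ... | inj₁ refl = fresh j zero p
  ... | inj₂ r    = apart (dis (λ ())) i p r
  es-disjoint : ∀ {i j} → i ≢ j → Disjoint (es i) (es j)
  es-disjoint {zero}  {zero}  ne = ⊥-elim (ne refl)
  es-disjoint {zero}  {suc j} ne = disjoint λ { zero _ () ; (suc i) → zero-disjoint j i }
  es-disjoint {suc i} {zero}  ne = disjoint λ { zero () _ ; (suc l) p q → zero-disjoint i l q p }
  es-disjoint {suc i} {suc j} ne = disjoint λ { zero () _ ; (suc l) p q → both l p q }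
    where
    both : ∀ l → lookup (G (suc i) [ x i ]≔ true) l ≡ true → lookup (G (suc j) [ x j ]≔ true) l ≡ true → ⊥
    both l p q with lookup-insert (G (suc i)) (x i) p | lookup-insert (G (suc j)) (x j) q
    ... | inj₁ l≡x | inj₁ l≡y = ne (cong suc (proj₂ (proj₂ chosen) (trans (sym l≡x) l≡y)))
    ... | inj₁ refl | inj₂ r  = fresh i (suc j) r
    ... | inj₂ r | inj₁ refl  = fresh j (suc i) r
    ... | inj₂ r | inj₂ r′    = apart (dis ne) l r r′

-- Frankl's inequality: with matching number at most s, a family is at most s times as large as its
-- shadow. If n < k (s + 1), this is incidence counting, since a shadow set has at most k s
-- extensions. Otherwise both the sets avoiding the head and the link of the head inherit the
-- hypotheses, the link by `link-matching`. `E` may be any family containing the shadow, so that it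
-- splits along with `F`.
shadow-bound : ∀ {n} k s (F E : Family n) → Stable F → Uniform k F → (∀ {e} → E e ≡ true → suc ∣ e ∣ ≡ k) →
  (∀ e i → F e ≡ true → lookup e i ≡ true → E (e [ i ]≔ false) ≡ true) →
  ¬ Matching F (suc s) → # F ≤ s * # E
shadow-bound zero s F E st u uE h ¬m = ≤-trans (≤-reflexive (#-empty F λ e p →
  ¬m ((λ _ → e) , (λ _ → p) , λ _ → disjoint λ i q _ → ∣∣≡0 e (u p) i q))) z≤n
shadow-bound {n} (suc k) s F E st u uE h ¬m with n <? suc k * suc s
... | yes small = *-cancelˡ-≤ (suc k) (begin
  suc k * # F                           ≡⟨ *-comm (suc k) (# F) ⟩
  # F * suc k                           ≡⟨ #-weighted F ∣_∣ u ⟨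
  ∑ˢ (λ e → ⟦ F e ⟧ * ∣ e ∣)            ≤⟨ shadow-count F E h ⟩
  ∑ˢ (λ e → ⟦ E e ⟧ * (n ∸ ∣ e ∣))      ≡⟨ #-weighted E (λ e → n ∸ ∣ e ∣) (λ p → cong (n ∸_) (suc-injective (uE p))) ⟩
  # E * (n ∸ k)                         ≤⟨ *-monoʳ-≤ (# E) (m≤n+o⇒m∸n≤o n k (≤-pred (≤-trans small (≤-reflexive (lem k s))))) ⟩
  # E * (suc k * s)                     ≡⟨ lem₂ (# E) k s ⟩
  suc k * (s * # E)                     ∎)
  where
  open ≤-Reasoning
  lem : ∀ k s → suc k * suc s ≡ suc (k + suc k * s)
  lem = solve-∀
  lem₂ : ∀ e k s → e * (suc k * s) ≡ suc k * (s * e)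
  lem₂ = solve-∀
shadow-bound {zero} (suc k) s F E st u uE h ¬m | no large = ⊥-elim (large (s≤s z≤n))
shadow-bound {suc n} (suc k) s F E st u uE h ¬m | no large = begin
  # F                                                ≡⟨ #-suc F ⟩
  # (F ∘ (false ∷_)) + # (F ∘ (true ∷_))             ≤⟨ +-mono-≤
    (shadow-bound (suc k) s _ _ (Stable-∷ {F = F} false st) u uE (λ e i → h (false ∷ e) (suc i)) (¬m ∘ extend))
    (shadow-bound k s _ _ (Stable-∷ {F = F} true st) (suc-injective ∘ u) (suc-injective ∘ uE) (λ e i → h (true ∷ e) (suc i))
      (¬m ∘ link-matching F st (suc-injective ∘ u) room)) ⟩
  s * # (E ∘ (false ∷_)) + s * # (E ∘ (true ∷_))     ≡⟨ *-distribˡ-+ s (# (E ∘ (false ∷_))) _ ⟨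
  s * (# (E ∘ (false ∷_)) + # (E ∘ (true ∷_)))       ≡⟨ cong (s *_) (#-suc E) ⟨
  s * # E                                            ∎
  where
  open ≤-Reasoning
  extend : Matching (F ∘ (false ∷_)) (suc s) → Matching F (suc s)
  extend (G , all , dis) = (λ i → false ∷ G i) , all , λ ne → disjoint λ { zero () _ ; (suc i) → apart (dis ne) i }
  lem : ∀ k s → suc k * suc s ≡ suc (suc s * k + s)
  lem = solve-∀
  room : suc s * k + s ≤ n
  room = ≤-pred (≤-trans (≤-reflexive (sym (lem k s))) (≮⇒≥ large))

-- Averaging over packings

_⊆ᵇ_ : ∀ {n} → Subset n → Subset n → Bool
[]      ⊆ᵇ []      = true
(b ∷ B) ⊆ᵇ (a ∷ A) = (not b ∨ a) ∧ (B ⊆ᵇ A)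

_∖_ : ∀ {n} → Subset n → Subset n → Subset n
[]      ∖ []      = []
(a ∷ A) ∖ (b ∷ B) = (a ∧ not b) ∷ (A ∖ B)

subfamily : ∀ {n} → ℕ → Subset n → Family n
subfamily l A B = (B ⊆ᵇ A) ∧ (∣ B ∣ ≡ᵇ l)

nC0 : ∀ n → n C 0 ≡ 1
nC0 zero    = refl
nC0 (suc n) = refl

#-subfamily : ∀ {n} l (A : Subset n) → # subfamily l A ≡ ∣ A ∣ C l
#-subfamily zero    []          = refl
#-subfamily (suc l) []          = sym (k>n⇒nCk≡0 {0} {suc l} (s≤s z≤n))
#-subfamily {suc n} l (false ∷ A) = trans (#-suc (subfamily l (false ∷ A)))
  (trans (cong₂ _+_ (#-subfamily l A) (∑-zero (subsets n))) (+-identityʳ _))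
#-subfamily zero    (true ∷ A)  = trans (#-suc (subfamily zero (true ∷ A)))
  (trans (cong₂ _+_ (trans (#-subfamily zero A) (nC0 ∣ A ∣)) (#-empty (λ B → subfamily zero (true ∷ A) (true ∷ B)) (λ B p → true≢false (proj₂ (∧-true {B ⊆ᵇ A} p)) refl)))
    (sym (nC0 (suc ∣ A ∣))))
#-subfamily (suc l) (true ∷ A)  = trans (#-suc (subfamily (suc l) (true ∷ A)))
  (trans (cong₂ _+_ (#-subfamily (suc l) A) (#-subfamily l A))
    (trans (+-comm (∣ A ∣ C suc l) (∣ A ∣ C l)) (nCk+nC[k+1]≡[n+1]C[k+1] ∣ A ∣ l)))

⊆ᵇ-swap : ∀ {n} (A B B′ : Subset n) → (B ⊆ᵇ A) ∧ (B′ ⊆ᵇ (A ∖ B)) ≡ (B′ ⊆ᵇ A) ∧ (B ⊆ᵇ (A ∖ B′))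
⊆ᵇ-swap [] [] [] = refl
⊆ᵇ-swap (a ∷ A) (b ∷ B) (b′ ∷ B′) = begin
  ((not b ∨ a) ∧ x) ∧ ((not b′ ∨ (a ∧ not b)) ∧ y)     ≡⟨ shuffle (not b ∨ a) x _ y ⟩
  ((not b ∨ a) ∧ (not b′ ∨ (a ∧ not b))) ∧ (x ∧ y)     ≡⟨ cong₂ _∧_ (heads a b b′) (⊆ᵇ-swap A B B′) ⟩
  ((not b′ ∨ a) ∧ (not b ∨ (a ∧ not b′))) ∧ (z ∧ w)    ≡⟨ shuffle (not b′ ∨ a) z _ w ⟨
  ((not b′ ∨ a) ∧ z) ∧ ((not b ∨ (a ∧ not b′)) ∧ w)    ∎
  where
  open ≡-Reasoning
  x = B ⊆ᵇ A
  y = B′ ⊆ᵇ (A ∖ B)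
  z = B′ ⊆ᵇ A
  w = B ⊆ᵇ (A ∖ B′)
  shuffle : ∀ p q r s → (p ∧ q) ∧ (r ∧ s) ≡ (p ∧ r) ∧ (q ∧ s)
  shuffle true  true  r     s = refl
  shuffle true  false true  s = refl
  shuffle true  false false s = refl
  shuffle false q     r     s = refl
  heads : ∀ a b b′ → (not b ∨ a) ∧ (not b′ ∨ (a ∧ not b)) ≡ (not b′ ∨ a) ∧ (not b ∨ (a ∧ not b′))
  heads true  true  true  = refl
  heads true  true  false = refl
  heads true  false true  = refl
  heads true  false false = refl
  heads false true  true  = refl
  heads false true  false = refl
  heads false false true  = refl
  heads false false false = refl

⊆ᵇ-∣∖∣ : ∀ {n} (A B : Subset n) → B ⊆ᵇ A ≡ true → ∣ A ∣ ≡ ∣ B ∣ + ∣ A ∖ B ∣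
⊆ᵇ-∣∖∣ []          []          p = refl
⊆ᵇ-∣∖∣ (true ∷ A)  (true ∷ B)  p = cong suc (⊆ᵇ-∣∖∣ A B p)
⊆ᵇ-∣∖∣ (true ∷ A)  (false ∷ B) p = trans (cong suc (⊆ᵇ-∣∖∣ A B p)) (sym (+-suc ∣ B ∣ _))
⊆ᵇ-∣∖∣ (false ∷ A) (false ∷ B) p = ⊆ᵇ-∣∖∣ A B p

⊆ᵇ-∖ : ∀ {n} (A B B′ : Subset n) → B′ ⊆ᵇ (A ∖ B) ≡ true → B′ ⊆ᵇ A ≡ true × Disjoint B B′
⊆ᵇ-∖ [] [] [] p = refl , disjoint λ ()
⊆ᵇ-∖ (a ∷ A) (b ∷ B) (b′ ∷ B′) p with ∧-true {not b′ ∨ (a ∧ not b)} p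
... | q , r with ⊆ᵇ-∖ A B B′ r
...   | r₁ , d = cong₂ _∧_ (left a b b′ q) r₁ , disjoint λ { zero u v → clash a b b′ q u v ; (suc i) → apart d i }
  where
  left : ∀ a b b′ → not b′ ∨ (a ∧ not b) ≡ true → not b′ ∨ a ≡ true
  left a    b b′    q with b′
  left a    b b′    q | false = refl
  left true b b′    q | true  = refl
  clash : ∀ a b b′ → not b′ ∨ (a ∧ not b) ≡ true → b ≡ true → b′ ≡ true → ⊥
  clash true  true true () refl refl
  clash false true true () refl refl

≡ᵇ-sound : ∀ {a b} → (a ≡ᵇ b) ≡ true → a ≡ b
≡ᵇ-sound {a} {b} p = ≡ᵇ⇒≡ a b (subst T (sym p) tt)

≡ᵇ-complete : ∀ {a b} → a ≡ b → (a ≡ᵇ b) ≡ true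
≡ᵇ-complete {zero}  refl = refl
≡ᵇ-complete {suc a} refl = ≡ᵇ-complete {a} refl

⊆ᵇ-full : ∀ {m} (B : Subset m) → B ⊆ᵇ Data.Fin.Subset.⊤ ≡ true
⊆ᵇ-full []          = refl
⊆ᵇ-full (true ∷ B)  = ⊆ᵇ-full B
⊆ᵇ-full (false ∷ B) = ⊆ᵇ-full B

#-level : ∀ n k → # (λ (e : Subset n) → ∣ e ∣ ≡ᵇ k) ≡ n C k
#-level n k = trans (∑-cong (subsets n) λ e → cong (λ b → ⟦ b ∧ (∣ e ∣ ≡ᵇ k) ⟧) (sym (⊆ᵇ-full e)))
  (trans (#-subfamily k (Data.Fin.Subset.⊤ {n})) (cong (_C k) (𝕊.∣⊤∣≡n n)))

-- Ordered packings: each set is chosen from what the previous ones leave, so that their number is a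
-- product of binomial coefficients.
packings : ∀ {n} → ℕ → ℕ → Subset n → List (List (Subset n))
packings l zero    A = [] ∷ []
packings l (suc t) A = concatMap
  (λ B → if subfamily l A B then map (B ∷_) (packings l t (A ∖ B)) else []) (subsets _)

∑-packings : ∀ {n} l t (A : Subset n) φ → ∑ (packings l (suc t) A) φ ≡
  ∑ˢ (λ B → ⟦ subfamily l A B ⟧ * ∑ (packings l t (A ∖ B)) (λ Bs → φ (B ∷ Bs)))
∑-packings {n} l t A φ = trans (∑-concatMap extend (subsets n) φ) (∑-cong (subsets n) pointwise)
  where
  extend : Subset n → List (List (Subset n))
  extend B = if subfamily l A B then map (B ∷_) (packings l t (A ∖ B)) else []
  pointwise : ∀ B → ∑ (extend B) φ ≡
    ⟦ subfamily l A B ⟧ * ∑ (packings l t (A ∖ B)) (λ Bs → φ (B ∷ Bs))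
  pointwise B with subfamily l A B
  ... | true  = trans (∑-map (B ∷_) (packings l t (A ∖ B)) φ) (sym (*-identityˡ _))
  ... | false = refl

record Packing {n} (t : ℕ) (A : Subset n) (Bs : List (Subset n)) : Set where
  field
    size     : length Bs ≡ t
    inside-A : ∀ {B} → B ∈ Bs → B ⊆ᵇ A ≡ true
    pairwise : AllPairs Disjoint Bs

∈-packings : ∀ {n} l t (A : Subset n) {Bs} → Bs ∈ packings l t A → Packing t A Bs
∈-packings l zero A (here refl) = record { size = refl ; inside-A = λ () ; pairwise = [] }
∈-packings {n} l (suc t) A i∈ with find (∈ₚ.∈-concatMap⁻ _ {xs = subsets n} i∈)
... | B , _ , Bs∈ with subfamily l A B in eq
...   | true with ∈ₚ.∈-map⁻ (B ∷_) Bs∈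
...     | Bs , Bs∈′ , refl = record
  { size     = cong suc P.size
  ; inside-A = contained
  ; pairwise = All.tabulate (λ B′∈ → proj₂ (⊆ᵇ-∖ A B _ (P.inside-A B′∈))) ∷ P.pairwise }
  where
  module P = Packing (∈-packings l t (A ∖ B) Bs∈′)
  contained : ∀ {B′} → B′ ∈ B ∷ Bs → B′ ⊆ᵇ A ≡ true
  contained      (here refl) = proj₁ (∧-true {B ⊆ᵇ A} eq)
  contained {B′} (there B′∈) = proj₁ (⊆ᵇ-∖ A B B′ (P.inside-A B′∈))

-- The number of ordered packings by `t` sets of size `l` when exactly `x` elements remain
-- uncovered.
ways : ℕ → ℕ → ℕ → ℕ
ways l zero    x = 1
ways l (suc t) x = ((suc t * l + x) C l) * ways l t x

subfamily-∖ : ∀ {n} l y (A B : Subset n) → ∣ A ∣ ≡ l + y → subfamily l A B ≡ true → ∣ A ∖ B ∣ ≡ y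
subfamily-∖ l y A B h p with ∧-true {B ⊆ᵇ A} p
... | sub , size = +-cancelˡ-≡ l _ _ (trans (cong (_+ ∣ A ∖ B ∣) (sym (≡ᵇ-sound size))) (trans (sym (⊆ᵇ-∣∖∣ A B sub)) h))

guarded : ∀ b {x y} → (b ≡ true → x ≡ y) → ⟦ b ⟧ * x ≡ ⟦ b ⟧ * y
guarded true  h = cong (1 *_) (h refl)
guarded false h = refl

#-packings : ∀ {n} l t x (A : Subset n) → ∣ A ∣ ≡ t * l + x → length (packings l t A) ≡ ways l t x
#-packings l zero    x A h = refl
#-packings {n} l (suc t) x A h = begin
  length (packings l (suc t) A)
    ≡⟨ ∑-one (packings l (suc t) A) ⟨
  ∑ (packings l (suc t) A) (λ _ → 1)
    ≡⟨ ∑-packings l t A (λ _ → 1) ⟩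
  ∑ˢ (λ B → ⟦ subfamily l A B ⟧ * ∑ (packings l t (A ∖ B)) (λ _ → 1))
    ≡⟨ ∑-cong (subsets n) (λ B → guarded (subfamily l A B) (λ p → trans (∑-one (packings l t (A ∖ B)))
         (#-packings l t x (A ∖ B) (subfamily-∖ l (t * l + x) A B h′ p)))) ⟩
  ∑ˢ (λ B → ⟦ subfamily l A B ⟧ * ways l t x)
    ≡⟨ ∑-*ʳ (subsets n) (ways l t x) (λ B → ⟦ subfamily l A B ⟧) ⟩
  # subfamily l A * ways l t x
    ≡⟨ cong (_* ways l t x) (trans (#-subfamily l A) (cong (_C l) h)) ⟩
  ways l (suc t) x ∎
  where
  open ≡-Reasoning
  h′ : ∣ A ∣ ≡ l + (t * l + x)
  h′ = trans h (+-assoc l (t * l) x)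

-- The members of a uniformly random t-packing of l-sets are uniformly distributed.
packings-average : ∀ {n} l t x (A : Subset n) f → ∣ A ∣ ≡ suc t * l + x →
  ∑ (packings l (suc t) A) (λ Bs → ∑ Bs f) ≡ suc t * ways l t x * ∑ˢ (λ B → ⟦ subfamily l A B ⟧ * f B)
packings-average {n} l zero x A f h = trans (∑-packings l zero A (λ Bs → ∑ Bs f))
  (trans (∑-cong (subsets n) (λ B → cong (⟦ subfamily l A B ⟧ *_) (lem (f B)))) (sym (*-identityˡ _)))
  where
  lem : ∀ a → a + 0 + 0 ≡ a
  lem = solve-∀
packings-average {n} l (suc t) x A f h = begin
  ∑ (packings l (suc (suc t)) A) (λ Bs → ∑ Bs f)
    ≡⟨ ∑-packings l (suc t) A (λ Bs → ∑ Bs f) ⟩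
  ∑ˢ (λ B → ⟦ subfamily l A B ⟧ * ∑ (packings l (suc t) (A ∖ B)) (λ Bs → f B + ∑ Bs f))
    ≡⟨ ∑-cong (subsets n) (λ B → trans (guarded (subfamily l A B) (inner B)) (lem₁ ⟦ subfamily l A B ⟧ (f B) W (suc t * V) _)) ⟩
  ∑ˢ (λ B → W * (⟦ subfamily l A B ⟧ * f B) + suc t * V * (⟦ subfamily l A B ⟧ * ∑ˢ (λ B′ → ⟦ subfamily l (A ∖ B) B′ ⟧ * f B′)))
    ≡⟨ trans (∑-+ (subsets n) _ _) (cong₂ _+_ (∑-*ˡ (subsets n) W _) (∑-*ˡ (subsets n) (suc t * V) _)) ⟩
  W * S + suc t * V * ∑ˢ (λ B → ⟦ subfamily l A B ⟧ * ∑ˢ (λ B′ → ⟦ subfamily l (A ∖ B) B′ ⟧ * f B′))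
    ≡⟨ cong (λ z → W * S + suc t * V * z) exchange ⟩
  W * S + suc t * V * (c * S)
    ≡⟨ lem₂ W S (suc t) V c (c * V) refl ⟩
  suc (suc t) * W * S ∎
  where
  open ≡-Reasoning
  W V c S : ℕ
  W = ways l (suc t) x
  V = ways l t x
  c = (suc t * l + x) C l
  S = ∑ˢ (λ B → ⟦ subfamily l A B ⟧ * f B)
  h′ : ∣ A ∣ ≡ l + (suc t * l + x)
  h′ = trans h (+-assoc l (suc t * l) x)
  lem₁ : ∀ i f W V s → i * (f * W + V * s) ≡ W * (i * f) + V * (i * s)
  lem₁ = solve-∀
  lem₂ : ∀ W S T V c W′ → W′ ≡ c * V → W′ * S + T * V * (c * S) ≡ suc T * W′ * S
  lem₂ W S T V c _ refl = lem S T V c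
    where
    lem : ∀ S T V c → c * V * S + T * V * (c * S) ≡ suc T * (c * V) * S
    lem = solve-∀
  inner : ∀ B → subfamily l A B ≡ true → ∑ (packings l (suc t) (A ∖ B)) (λ Bs → f B + ∑ Bs f) ≡
    f B * W + suc t * V * ∑ˢ (λ B′ → ⟦ subfamily l (A ∖ B) B′ ⟧ * f B′)
  inner B p = trans (∑-+ (packings l (suc t) (A ∖ B)) _ _) (cong₂ _+_
    (trans (∑-const (packings l (suc t) (A ∖ B)) (f B))
      (trans (*-comm _ (f B)) (cong (f B *_) (#-packings l (suc t) x (A ∖ B) size))))
    (packings-average l t x (A ∖ B) f size))
    where
    size : ∣ A ∖ B ∣ ≡ suc t * l + x
    size = subfamily-∖ l (suc t * l + x) A B h′ p
  boolean : ∀ p q r s u v → p ∧ q ≡ r ∧ s → ⟦ p ∧ u ⟧ * ⟦ q ∧ v ⟧ ≡ ⟦ r ∧ v ⟧ * ⟦ s ∧ u ⟧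
  boolean p q r s u v e = trans (sym (⟦∧⟧ (p ∧ u) (q ∧ v))) (trans (cong ⟦_⟧ (trans (mix p u q v) (trans (cong (_∧ (u ∧ v)) e) (sym (trans (mix r v s u) (cong ((r ∧ s) ∧_) (𝔹.∧-comm v u)))))))
    (⟦∧⟧ (r ∧ v) (s ∧ u)))
    where
    mix : ∀ p q r s → (p ∧ q) ∧ (r ∧ s) ≡ (p ∧ r) ∧ (q ∧ s)
    mix true  true  r     s = refl
    mix true  false true  s = refl
    mix true  false false s = refl
    mix false q     r     s = refl
  symmetric : ∀ B B′ → ⟦ subfamily l A B ⟧ * ⟦ subfamily l (A ∖ B) B′ ⟧ ≡ ⟦ subfamily l A B′ ⟧ * ⟦ subfamily l (A ∖ B′) B ⟧
  symmetric B B′ = boolean (B ⊆ᵇ A) (B′ ⊆ᵇ (A ∖ B)) (B′ ⊆ᵇ A) (B ⊆ᵇ (A ∖ B′)) _ _ (⊆ᵇ-swap A B B′)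
  -- The first two choices of a packing are interchangeable by `⊆ᵇ-swap`. After swapping the sums,
  -- every `B′` is weighted by the number `c` of sets of size `l` that avoid it.
  exchange : ∑ˢ (λ B → ⟦ subfamily l A B ⟧ * ∑ˢ (λ B′ → ⟦ subfamily l (A ∖ B) B′ ⟧ * f B′)) ≡ c * S
  exchange = begin
    ∑ˢ (λ B → ⟦ subfamily l A B ⟧ * ∑ˢ (λ B′ → ⟦ subfamily l (A ∖ B) B′ ⟧ * f B′))
      ≡⟨ ∑-cong (subsets n) (λ B → trans (sym (∑-*ˡ (subsets n) ⟦ subfamily l A B ⟧ _)) (∑-cong (subsets n) λ B′ →
           trans (sym (*-assoc ⟦ subfamily l A B ⟧ _ (f B′))) (trans (cong (_* f B′) (symmetric B B′)) (assoc ⟦ subfamily l A B′ ⟧ _ (f B′))))) ⟩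
    ∑ˢ (λ B → ∑ˢ (λ B′ → ⟦ subfamily l A B′ ⟧ * f B′ * ⟦ subfamily l (A ∖ B′) B ⟧))
      ≡⟨ ∑-swap (subsets n) (subsets n) _ ⟩
    ∑ˢ (λ B′ → ∑ˢ (λ B → ⟦ subfamily l A B′ ⟧ * f B′ * ⟦ subfamily l (A ∖ B′) B ⟧))
      ≡⟨ ∑-cong (subsets n) (λ B′ → trans (∑-*ˡ (subsets n) (⟦ subfamily l A B′ ⟧ * f B′) _) (trans (*-assoc ⟦ subfamily l A B′ ⟧ (f B′) _)
           (guarded (subfamily l A B′) (λ p → cong (f B′ *_) (trans (#-subfamily l (A ∖ B′))
             (cong (_C l) (subfamily-∖ l (suc t * l + x) A B′ h′ p))))))) ⟩
    ∑ˢ (λ B′ → ⟦ subfamily l A B′ ⟧ * (f B′ * c))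
      ≡⟨ ∑-cong (subsets n) (λ B′ → trans (sym (*-assoc ⟦ subfamily l A B′ ⟧ (f B′) c)) (*-comm _ c)) ⟩
    ∑ˢ (λ B′ → c * (⟦ subfamily l A B′ ⟧ * f B′))
      ≡⟨ ∑-*ˡ (subsets n) c _ ⟩
    c * S ∎
    where
    assoc : ∀ a b c → a * b * c ≡ a * c * b
    assoc = solve-∀

Disjoint-sym : ∀ {n} {a b : Subset n} → Disjoint a b → Disjoint b a
Disjoint-sym d = disjoint λ i p q → apart d i q p

extract : ∀ {n} (p : Family n) (Bs : List (Subset n)) → AllPairs Disjoint Bs →
  (∀ {B} → B ∈ Bs → p B ≡ false) ⊎
  Σ (Subset n) λ B → Σ (List (Subset n)) λ Bs′ → p B ≡ true × B ∈ Bs × (∀ {x} → x ∈ Bs′ → x ∈ Bs) ×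
    (∀ f → ∑ Bs f ≡ f B + ∑ Bs′ f) × AllPairs Disjoint Bs′ × All (Disjoint B) Bs′
extract p [] _ = inj₁ λ ()
extract p (B ∷ Bs) (d ∷ ds) with p B in eq
... | true = inj₂ (B , Bs , eq , here refl , there , (λ f → refl) , ds , d)
... | false with extract p Bs ds
...   | inj₁ none = inj₁ λ { (here refl) → eq ; (there i) → none i }
...   | inj₂ (B′ , Bs′ , pB′ , B′∈ , sub , sum , ds′ , d′) = inj₂ (B′ , B ∷ Bs′ , pB′ , there B′∈ ,
          (λ { (here e) → here e ; (there i) → there (sub i) }) ,
          (λ f → trans (cong (f B +_) (sum f)) (lem (f B) (f B′) (∑ Bs′ f))) ,
          All.tabulate (λ i → All.lookup d (sub i)) ∷ ds′ , Disjoint-sym (All.lookup d B′∈) ∷ d′)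
  where
  lem : ∀ a b c → a + (b + c) ≡ b + (a + c)
  lem = solve-∀

RainbowMatching : ∀ {n q} → (Fin q → Family n) → Set
RainbowMatching {n} {q} F = Σ (Fin q → Subset n) λ es →
  (∀ i → F i (es i) ≡ true) × (∀ {i j} → i ≢ j → Disjoint (es i) (es j))

-- Greedy choice in the order of the indices: if it gets stuck at `i`, all members of `F i` in the
-- packing were used for smaller indices, so there are at most `i` of them.
rainbow : ∀ {n} q (F : Fin q → Family n) Bs → AllPairs Disjoint Bs →
  (Σ (RainbowMatching F) λ m → ∀ i → proj₁ m i ∈ Bs) ⊎ (Σ (Fin q) λ i → ∑ Bs (λ B → ⟦ F i B ⟧) ≤ toℕ i)
rainbow zero F Bs ds = inj₁ (((λ ()) , (λ ()) , λ {}) , λ ())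
rainbow (suc q) F Bs ds with extract (F zero) Bs ds
... | inj₁ none = inj₂ (zero , ≤-reflexive (trans (∑-cong-∈ Bs (λ i → cong ⟦_⟧ (none i))) (∑-zero Bs)))
... | inj₂ (B , Bs′ , FB , B∈ , sub , sum , ds′ , d) with rainbow q (F ∘ suc) Bs′ ds′
...   | inj₂ (i , le) = inj₂ (suc i , ≤-trans (≤-reflexive (sum _)) (+-mono-≤ (⟦⟧≤1 (F (suc i) B)) le))
...   | inj₁ ((es , all , dis) , es∈) = inj₁ ((es′ , all′ , dis′) , es′∈)
  where
  es′ : Fin (suc q) → Subset _
  es′ zero    = B
  es′ (suc i) = es i
  all′ : ∀ i → F i (es′ i) ≡ true
  all′ zero    = FB
  all′ (suc i) = all i
  es′∈ : ∀ i → es′ i ∈ Bs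
  es′∈ zero    = B∈
  es′∈ (suc i) = sub (es∈ i)
  dis′ : ∀ {i j} → i ≢ j → Disjoint (es′ i) (es′ j)
  dis′ {zero}  {zero}  ne = ⊥-elim (ne refl)
  dis′ {zero}  {suc j} ne = All.lookup d (es∈ j)
  dis′ {suc i} {zero}  ne = Disjoint-sym (All.lookup d (es∈ i))
  dis′ {suc i} {suc j} ne = dis (ne ∘ cong suc)

∑-initial : ∀ q (i : Fin q) a t (d : Fin q → ℕ) → (∀ j → toℕ j ≤ toℕ i → d j ≤ a) → (∀ j → d j ≤ t) →
  ∑ (allFin q) d ≤ suc (toℕ i) * a + (q ∸ suc (toℕ i)) * t
∑-initial (suc q) zero a t d h h′ = begin
  ∑ (allFin (suc q)) d                    ≡⟨ ∑-allFin-suc q d ⟩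
  d zero + ∑ (allFin q) (d ∘ suc)         ≤⟨ +-mono-≤ (h zero z≤n) (∑-≤const (allFin q) t (λ {j} _ → h′ (suc j))) ⟩
  a + length (allFin q) * t               ≡⟨ cong₂ (λ x y → x + y * t) (sym (+-identityʳ a)) (length-allFin q) ⟩
  1 * a + q * t                           ∎
  where open ≤-Reasoning
∑-initial (suc q) (suc i) a t d h h′ = begin
  ∑ (allFin (suc q)) d                                     ≡⟨ ∑-allFin-suc q d ⟩
  d zero + ∑ (allFin q) (d ∘ suc)                          ≤⟨ +-mono-≤ (h zero z≤n) (∑-initial q i a t (d ∘ suc) (λ j le → h (suc j) (s≤s le)) (h′ ∘ suc)) ⟩
  a + (suc (toℕ i) * a + (q ∸ suc (toℕ i)) * t)            ≡⟨ +-assoc a _ _ ⟨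
  suc (toℕ (suc i)) * a + (suc q ∸ suc (toℕ (suc i))) * t  ∎
  where open ≤-Reasoning

-- Frankl's inequality for nested families without a rainbow matching, in which the smallest family
-- counts s more times. It is proved inside each packing of 2s + 1 disjoint sets, where it only
-- concerns the numbers `d i` of packed sets in `F i`, and then averaged over all packings; `room`
-- says that such packings exist.
module Cross {m} (s l : ℕ) (F : Fin (suc s) → Family m) (uniform : ∀ i → Uniform l (F i))
  (nested : ∀ {i j} → toℕ i ≤ toℕ j → ∀ {B} → F i B ≡ true → F j B ≡ true)
  (no-rainbow : ¬ RainbowMatching F) (room : suc (s + s) * l ≤ m) where

  weighted : Subset m → ℕ
  weighted B = ∑ (allFin (suc s)) (λ i → ⟦ F i B ⟧) + s * ⟦ F zero B ⟧

  packing-bound : ∀ {A} Bs → Packing (suc (s + s)) A Bs → ∑ Bs weighted ≤ s * suc (s + s)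
  packing-bound Bs P with rainbow (suc s) F Bs (Packing.pairwise P)
  ... | inj₁ (m , _) = ⊥-elim (no-rainbow m)
  ... | inj₂ (i , d≤i) = begin
    ∑ Bs weighted
      ≡⟨ ∑-+ Bs _ _ ⟩
    ∑ Bs (λ B → ∑ (allFin (suc s)) (λ i → ⟦ F i B ⟧)) + ∑ Bs (λ B → s * ⟦ F zero B ⟧)
      ≡⟨ cong₂ _+_ (∑-swap Bs (allFin (suc s)) _) (∑-*ˡ Bs s _) ⟩
    ∑ (allFin (suc s)) d + s * d zero
      ≤⟨ +-mono-≤ (∑-initial (suc s) i (toℕ i) t d (λ j le → ≤-trans (d-mono le) d≤i) d≤t) (*-monoʳ-≤ s (≤-trans (d-mono z≤n) d≤i)) ⟩
    suc (toℕ i) * toℕ i + (s ∸ toℕ i) * t + s * toℕ i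
      ≤⟨ arithmetic (toℕ i) s (≤-pred (𝔽.toℕ<n i)) ⟩
    s * t ∎
    where
    open ≤-Reasoning
    t : ℕ
    t = suc (s + s)
    d : Fin (suc s) → ℕ
    d i = ∑ Bs (λ B → ⟦ F i B ⟧)
    d-mono : ∀ {i j} → toℕ i ≤ toℕ j → d i ≤ d j
    d-mono le = ∑-mono Bs (λ B → ⟦⟧-mono (nested le))
    d≤t : ∀ j → d j ≤ t
    d≤t j = ≤-trans (∑-≤const Bs 1 (λ {B} _ → ⟦⟧≤1 (F j B))) (≤-reflexive (trans (*-identityʳ _) (Packing.size P)))
    -- With t packed sets, cancelling a factor i leaves i + 1 + s ≤ t. The case i = s dictates
    -- packings of 2s + 1 sets and thereby the range of Frankl's theorem.
    arithmetic : ∀ i s → i ≤ s → suc i * i + (s ∸ i) * suc (s + s) + s * i ≤ s * suc (s + s)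
    arithmetic i s i≤s with u , refl ← m≤n⇒∃[o]m+o≡n i≤s rewrite m+n∸m≡n i u = begin
      suc i * i + u * suc (i + u + (i + u)) + (i + u) * i           ≤⟨ m≤m+n _ (u * i) ⟩
      suc i * i + u * suc (i + u + (i + u)) + (i + u) * i + u * i   ≡⟨ lem i u ⟩
      (i + u) * suc (i + u + (i + u))                               ∎
      where
      lem : ∀ i u → suc i * i + u * suc (i + u + (i + u)) + (i + u) * i + u * i ≡ (i + u) * suc (i + u + (i + u))
      lem = solve-∀

  C-positive : ∀ {n k} → k ≤ n → 0 < n C k
  C-positive {n} {zero} _ = ≤-reflexive (sym (nC0 n))
  C-positive {suc n} {suc k} (s≤s le) = ≤-trans (C-positive le) (≤-trans (m≤m+n _ _) (≤-reflexive (nCk+nC[k+1]≡[n+1]C[k+1] n k)))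

  ways-positive : ∀ t x → 0 < ways l t x
  ways-positive zero    x = s≤s z≤n
  ways-positive (suc t) x = *-mono-≤ (C-positive {suc t * l + x} {l} (≤-trans (m≤m+n l (t * l)) (m≤m+n _ x))) (ways-positive t x)

  cross-bound : ∑ (allFin (suc s)) (λ i → # F i) + s * # F zero ≤ s * (m C l)
  cross-bound with x , size ← m≤n⇒∃[o]m+o≡n room = subst (_≤ s * (m C l)) total (*-cancelˡ-≤ (suc t * V) {{>-nonZero V>0}} (begin
    suc t * V * S                                               ≡⟨ packings-average l t x full weighted ∣full∣ ⟨
    ∑ (packings l (suc t) full) (λ Bs → ∑ Bs weighted)          ≤⟨ ∑-≤const (packings l (suc t) full) (s * suc t) (λ {Bs} i∈ → packing-bound Bs (∈-packings l (suc t) full i∈)) ⟩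
    length (packings l (suc t) full) * (s * suc t)              ≡⟨ cong (_* (s * suc t)) (trans (#-packings l (suc t) x full ∣full∣) (cong (λ z → (z C l) * V) size)) ⟩
    (m C l) * V * (s * suc t)                                   ≡⟨ lem (m C l) V s (suc t) ⟩
    suc t * V * (s * (m C l))                                   ∎))
    where
    open ≤-Reasoning
    t V : ℕ
    t = s + s
    V = ways l t x
    V>0 : 0 < suc t * V
    V>0 = *-mono-≤ {1} {suc t} (s≤s z≤n) (ways-positive t x)
    full : Subset m
    full = Data.Fin.Subset.⊤
    ∣full∣ : ∣ full ∣ ≡ suc t * l + x
    ∣full∣ = trans (𝕊.∣⊤∣≡n m) (sym size)
    S : ℕ
    S = ∑ˢ (λ B → ⟦ subfamily l full B ⟧ * weighted B)
    lem : ∀ c V s t → c * V * (s * t) ≡ t * V * (s * c)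
    lem = solve-∀
    absorb : ∀ i B → ⟦ subfamily l full B ⟧ * ⟦ F i B ⟧ ≡ ⟦ F i B ⟧
    absorb i B with F i B in eq
    ... | false = *-zeroʳ ⟦ subfamily l full B ⟧
    ... | true rewrite ⊆ᵇ-full B | ≡ᵇ-complete (uniform i eq) = refl
    total : S ≡ ∑ (allFin (suc s)) (λ i → # F i) + s * # F zero
    total = trans (∑-cong (subsets m) pointwise) (trans (∑-+ (subsets m) _ _)
      (cong₂ _+_ (∑-swap (subsets m) (allFin (suc s)) _) (∑-*ˡ (subsets m) s _)))
      where
      distrib : ∀ a b s c → a * (b + s * c) ≡ a * b + s * (a * c)
      distrib = solve-∀
      pointwise : ∀ B → ⟦ subfamily l full B ⟧ * weighted B ≡ weighted B
      pointwise B = trans (distrib ⟦ subfamily l full B ⟧ (∑ (allFin (suc s)) (λ i → ⟦ F i B ⟧)) s ⟦ F zero B ⟧) (cong₂ _+_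
        (trans (sym (∑-*ˡ (allFin (suc s)) ⟦ subfamily l full B ⟧ _)) (∑-cong (allFin (suc s)) (λ i → absorb i B)))
        (cong (s *_) (absorb zero B)))

-- Frankl's theorem

∣++∣ : ∀ {m d} (A : Subset m) (Q : Subset d) → ∣ A ++ᵛ Q ∣ ≡ ∣ A ∣ + ∣ Q ∣
∣++∣ []          Q = refl
∣++∣ (true ∷ A)  Q = cong suc (∣++∣ A Q)
∣++∣ (false ∷ A) Q = ∣++∣ A Q

Move-++ˡ : ∀ {m d i} {A A′ : Subset m} {Q : Subset d} → Move i A A′ → Move i (A ++ᵛ Q) (A′ ++ᵛ Q)
Move-++ˡ here      = here
Move-++ˡ (there m) = there (Move-++ˡ m)

Stable-++ʳ : ∀ {m d} {F : Family (m + d)} (A : Subset m) → Stable F → Stable (λ Q → F (A ++ᵛ Q))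
Stable-++ʳ []      st = st
Stable-++ʳ {F = F} (a ∷ A) st = Stable-++ʳ A (Stable-∷ {F = F} a st)

Stable-⁅⁆ : ∀ {d} {G : Family d} → Stable G → ∀ {i j} → toℕ i ≤ toℕ j → G ⁅ i ⁆ ≡ true → G ⁅ j ⁆ ≡ true
Stable-⁅⁆ st {zero}  {zero}        le p = p
Stable-⁅⁆ {G = G} st {zero} {suc zero}    le p = st here p
Stable-⁅⁆ {G = G} st {zero} {suc (suc j)} le p =
  Stable-⁅⁆ {G = G ∘ (false ∷_)} (Stable-∷ {F = G} false st) {zero} {suc j} z≤n (st here p)
Stable-⁅⁆ {G = G} st {suc i} {suc j} (s≤s le) p = Stable-⁅⁆ {G = G ∘ (false ∷_)} (Stable-∷ {F = G} false st) le p

-- By `slide`, an element of a set with empty trace can be moved up to position `m`, the least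
-- favoured of the last s + 1. So the shadow of the empty trace lies in the smallest of the nested
-- one-element traces.
shadow-nested : ∀ {m s} (F : Family (m + suc s)) → Stable F → ∀ (A : Subset m) a →
  F (A ++ᵛ ∅) ≡ true → lookup A a ≡ true → F ((A [ a ]≔ false) ++ᵛ ⁅ zero ⁆) ≡ true
shadow-nested F st (x ∷ A) (suc a) p q = shadow-nested (F ∘ (x ∷_)) (Stable-∷ {F = F} x st) A a p q
shadow-nested {suc m} {s} F st (true ∷ A) zero p _ =
  subst (λ g → F (false ∷ g) ≡ true) (updated A) (slide F st (A ++ᵛ ∅) (m ↑ʳ zero) (empty A) p)
  where
  empty : ∀ {m} (A : Subset m) → lookup (A ++ᵛ ∅ {suc s}) (m ↑ʳ zero) ≡ false
  empty []      = refl
  empty (_ ∷ A) = empty A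
  updated : ∀ {m} (A : Subset m) → (A ++ᵛ ∅ {suc s}) [ m ↑ʳ zero ]≔ true ≡ A ++ᵛ ⁅ zero ⁆
  updated []      = refl
  updated (a ∷ A) = cong (a ∷_) (updated A)

Disjoint-++ : ∀ {m d} {A A′ : Subset m} {Q Q′ : Subset d} → Disjoint A A′ → Disjoint Q Q′ →
  Disjoint (A ++ᵛ Q) (A′ ++ᵛ Q′)
Disjoint-++ {A = []}    {[]}     d d′ = d′
Disjoint-++ {A = a ∷ A} {a′ ∷ A′} d d′ = disjoint λ
  { zero → apart d zero ; (suc i) → apart (Disjoint-++ (Disjoint-tail d) d′) i }

Disjoint-⁅⁆ : ∀ {d} {i j : Fin d} → i ≢ j → Disjoint ⁅ i ⁆ ⁅ j ⁆
Disjoint-⁅⁆ ne = disjoint λ x p q →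
  ne (trans (sym (𝕊.x∈⁅y⁆⇒x≡y _ (𝕍.lookup⇒[]= x _ p))) (𝕊.x∈⁅y⁆⇒x≡y _ (𝕍.lookup⇒[]= x _ q)))

∑ˢ-++ : ∀ m {d} (f : Subset (m + d) → ℕ) → ∑ˢ f ≡ ∑ˢ {m} (λ A → ∑ˢ {d} (λ Q → f (A ++ᵛ Q)))
∑ˢ-++ zero    f = sym (+-identityʳ _)
∑ˢ-++ (suc m) f = trans (∑ˢ-suc f) (trans (cong₂ _+_ (∑ˢ-++ m (λ e → f (false ∷ e))) (∑ˢ-++ m (λ e → f (true ∷ e))))
  (sym (∑ˢ-suc {m} (λ A → ∑ˢ (λ Q → f (A ++ᵛ Q))))))

∑ˢ-empty : ∀ {d} (f : Subset d → ℕ) → ∑ˢ f ≡ f ∅ + ∑ˢ (λ Q → ⟦ 1 ≤ᵇ ∣ Q ∣ ⟧ * f Q)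
∑ˢ-empty {zero}  f = refl
∑ˢ-empty {suc d} f = begin
  ∑ˢ f                                                  ≡⟨ ∑ˢ-suc f ⟩
  ∑ˢ (λ Q → f (false ∷ Q)) + ∑ˢ (λ Q → f (true ∷ Q))    ≡⟨ cong₂ _+_ (∑ˢ-empty (λ Q → f (false ∷ Q))) (∑-cong (subsets d) (λ Q → sym (*-identityˡ _))) ⟩
  f ∅ + x + ∑ˢ (λ Q → 1 * f (true ∷ Q))                 ≡⟨ +-assoc (f ∅) x _ ⟩
  f ∅ + (x + ∑ˢ (λ Q → 1 * f (true ∷ Q)))               ≡⟨ cong (f ∅ +_) (sym (∑ˢ-suc (λ Q → ⟦ 1 ≤ᵇ ∣ Q ∣ ⟧ * f Q))) ⟩
  f ∅ + ∑ˢ (λ Q → ⟦ 1 ≤ᵇ ∣ Q ∣ ⟧ * f Q)                 ∎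
  where
  open ≡-Reasoning
  x = ∑ˢ (λ Q → ⟦ 1 ≤ᵇ ∣ Q ∣ ⟧ * f (false ∷ Q))

∑ˢ-small : ∀ {d} (f : Subset d → ℕ) →
  ∑ˢ f ≡ f ∅ + ∑ (allFin d) (λ i → f ⁅ i ⁆) + ∑ˢ (λ Q → ⟦ 2 ≤ᵇ ∣ Q ∣ ⟧ * f Q)
∑ˢ-small {zero}  f = cong (_+ 0) (sym (+-identityʳ _))
∑ˢ-small {suc d} f = begin
  ∑ˢ f
    ≡⟨ ∑ˢ-suc f ⟩
  ∑ˢ (λ Q → f (false ∷ Q)) + ∑ˢ (λ Q → f (true ∷ Q))
    ≡⟨ cong₂ _+_ (∑ˢ-small (λ Q → f (false ∷ Q))) (∑ˢ-empty (λ Q → f (true ∷ Q))) ⟩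
  f ∅ + y + z + (f ⁅ zero ⁆ + w)
    ≡⟨ lem (f ∅) y z (f ⁅ zero ⁆) w ⟩
  f ∅ + (f ⁅ zero ⁆ + y) + (z + w)
    ≡⟨ cong₂ (λ a b → f ∅ + a + b) (sym (∑-allFin-suc d (λ i → f ⁅ i ⁆))) (sym (∑ˢ-suc (λ Q → ⟦ 2 ≤ᵇ ∣ Q ∣ ⟧ * f Q))) ⟩
  f ∅ + ∑ (allFin (suc d)) (λ i → f ⁅ i ⁆) + ∑ˢ (λ Q → ⟦ 2 ≤ᵇ ∣ Q ∣ ⟧ * f Q) ∎
  where
  open ≡-Reasoning
  y = ∑ (allFin d) (λ i → f ⁅ suc i ⁆)
  z = ∑ˢ (λ Q → ⟦ 2 ≤ᵇ ∣ Q ∣ ⟧ * f (false ∷ Q))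
  w = ∑ˢ (λ Q → ⟦ 1 ≤ᵇ ∣ Q ∣ ⟧ * f (true ∷ Q))
  lem : ∀ a y z b w → a + y + z + (b + w) ≡ a + (b + y) + (z + w)
  lem = solve-∀

-- Frankl's bound.  Splitting the sets according to their trace on the s + 1 most
-- favoured elements, traces of size at least two are bounded trivially, the
-- one-element traces by cross-bound, and the empty trace by its shadow.
module Frankl {m s k} (F : Family (m + suc s)) (stable : Stable F) (uniform : Uniform (suc k) F)
  (room : suc (s + s) * k ≤ m) (no-matching : ¬ Matching F (suc s)) where

  F∅ : Family m
  F∅ A = F (A ++ᵛ ∅)

  Fᵢ : Fin (suc s) → Family m
  Fᵢ i A = F (A ++ᵛ ⁅ i ⁆)

  uniform∅ : Uniform (suc k) F∅
  uniform∅ {A} p = trans (sym (trans (∣++∣ A ∅) (trans (cong (∣ A ∣ +_) (𝕊.∣⊥∣≡0 (suc s))) (+-identityʳ _)))) (uniform p)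

  ∣++⁅⁆∣ : ∀ (A : Subset m) (i : Fin (suc s)) → ∣ A ++ᵛ ⁅ i ⁆ ∣ ≡ suc ∣ A ∣
  ∣++⁅⁆∣ A i = trans (∣++∣ A ⁅ i ⁆) (trans (cong (∣ A ∣ +_) (𝕊.∣⁅x⁆∣≡1 i)) (+-comm ∣ A ∣ 1))

  uniformᵢ : ∀ i {A} → Fᵢ i A ≡ true → suc ∣ A ∣ ≡ suc k
  uniformᵢ i {A} p = trans (sym (∣++⁅⁆∣ A i)) (uniform p)

  nested : ∀ {i j} → toℕ i ≤ toℕ j → ∀ {A} → Fᵢ i A ≡ true → Fᵢ j A ≡ true
  nested le {A} = Stable-⁅⁆ (Stable-++ʳ {F = F} A stable) le

  no-rainbow : ¬ RainbowMatching Fᵢ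
  no-rainbow (es , all , dis) = no-matching ((λ i → es i ++ᵛ ⁅ i ⁆) , all , λ ne → Disjoint-++ (dis ne) (Disjoint-⁅⁆ ne))

  empty-trace : # F∅ ≤ s * # Fᵢ zero
  empty-trace = shadow-bound (suc k) s F∅ (Fᵢ zero) (λ mv → stable (Move-++ˡ mv)) uniform∅ (uniformᵢ zero)
    (shadow-nested F stable) (λ { (es , all , dis) →
      no-matching ((λ i → es i ++ᵛ ∅) , all , λ ne → Disjoint-++ (dis ne) (disjoint λ i p _ → true≢false p (𝕍.lookup-replicate i false))) })

  -- The shadow bound charges the empty trace with `s * # Fᵢ zero`, exactly the surplus term that
  -- `cross-bound` allows.
  small-traces : # F∅ + ∑ (allFin (suc s)) (λ i → # Fᵢ i) ≤ s * (m C k)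
  small-traces = ≤-trans (+-monoˡ-≤ _ empty-trace) (≤-trans (≤-reflexive (+-comm (s * # Fᵢ zero) _))
    (Cross.cross-bound s k Fᵢ (λ i p → suc-injective (uniformᵢ i p)) nested no-rainbow room))

  bound : # F + suc m C suc k ≤ (m + suc s) C suc k
  bound = +-cancelʳ-≤ (s * c) _ _ (begin
    # F + suc m C suc k + s * c
      ≡⟨ cong₂ (λ a b → a + b + s * c) #F (sym (nCk+nC[k+1]≡[n+1]C[k+1] m k)) ⟩
    g ∅ + ∑ (allFin (suc s)) (λ i → g ⁅ i ⁆) + ∑ˢ (λ Q → ⟦ 2 ≤ᵇ ∣ Q ∣ ⟧ * g Q) + (c + m C suc k) + s * c
      ≤⟨ +-monoˡ-≤ (s * c) (+-monoˡ-≤ (c + m C suc k) (+-mono-≤ small-traces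
           (∑-mono (subsets (suc s)) (λ Q → *-monoʳ-≤ ⟦ 2 ≤ᵇ ∣ Q ∣ ⟧ (g≤cap Q))))) ⟩
    s * c + R + (c + m C suc k) + s * c
      ≡⟨ lem (s * c) R c (m C suc k) ⟩
    m C suc k + (c + s * c) + R + s * c
      ≡⟨ cong (_+ s * c) (sym caps) ⟩
    (m + suc s) C suc k + s * c ∎)
    where
    open ≤-Reasoning
    c : ℕ
    c = m C k
    g cap : Subset (suc s) → ℕ
    g Q = ∑ (subsets m) (λ A → ⟦ F (A ++ᵛ Q) ⟧)
    cap Q = ∑ (subsets m) (λ A → ⟦ ∣ A ++ᵛ Q ∣ ≡ᵇ suc k ⟧)
    R : ℕ
    R = ∑ˢ (λ Q → ⟦ 2 ≤ᵇ ∣ Q ∣ ⟧ * cap Q)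
    g≤cap : ∀ Q → g Q ≤ cap Q
    g≤cap Q = ∑-mono (subsets m) (λ A → ⟦⟧-mono (λ p → ≡ᵇ-complete (uniform p)))
    #F : # F ≡ g ∅ + ∑ (allFin (suc s)) (λ i → g ⁅ i ⁆) + ∑ˢ (λ Q → ⟦ 2 ≤ᵇ ∣ Q ∣ ⟧ * g Q)
    #F = trans (∑ˢ-++ m (λ e → ⟦ F e ⟧)) (trans (∑-swap (subsets m) (subsets (suc s)) (λ A Q → ⟦ F (A ++ᵛ Q) ⟧)) (∑ˢ-small g))
    cap∅ : cap ∅ ≡ m C suc k
    cap∅ = trans (∑-cong (subsets m) (λ A → cong (λ z → ⟦ z ≡ᵇ suc k ⟧)
      (trans (∣++∣ A ∅) (trans (cong (∣ A ∣ +_) (𝕊.∣⊥∣≡0 (suc s))) (+-identityʳ _))))) (#-level m (suc k))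
    cap⁅⁆ : ∀ i → cap ⁅ i ⁆ ≡ c
    cap⁅⁆ i = trans (∑-cong (subsets m) (λ A → cong (λ z → ⟦ z ≡ᵇ suc k ⟧) (∣++⁅⁆∣ A i))) (#-level m k)
    caps : (m + suc s) C suc k ≡ m C suc k + (c + s * c) + R
    caps = begin-equality
      (m + suc s) C suc k                              ≡⟨ #-level (m + suc s) (suc k) ⟨
      # (λ (e : Subset (m + suc s)) → ∣ e ∣ ≡ᵇ suc k)  ≡⟨ ∑ˢ-++ m (λ e → ⟦ ∣ e ∣ ≡ᵇ suc k ⟧) ⟩
      ∑ (subsets m) (λ A → ∑ (subsets (suc s)) (λ Q → ⟦ ∣ A ++ᵛ Q ∣ ≡ᵇ suc k ⟧))   ≡⟨ ∑-swap (subsets m) (subsets (suc s)) (λ A Q → ⟦ ∣ A ++ᵛ Q ∣ ≡ᵇ suc k ⟧) ⟩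
      ∑ˢ cap                                           ≡⟨ ∑ˢ-small cap ⟩
      cap ∅ + ∑ (allFin (suc s)) (λ i → cap ⁅ i ⁆) + R ≡⟨ cong₂ (λ a b → a + b + R) cap∅
        (trans (∑-cong (allFin (suc s)) cap⁅⁆) (trans (∑-const (allFin (suc s)) c) (cong (_* c) (length-allFin (suc s))))) ⟩
      m C suc k + suc s * c + R                        ∎
    lem : ∀ sc R c d → sc + R + (c + d) + sc ≡ d + (c + sc) + R + sc
    lem = solve-∀

-- With M = m + s + 1 vertices and edge size r = k + 1, `room` is Frankl's condition M ≥ (2s + 1) r
-- - s, and the bound C(M, r) - C(M - s, r) counts the r-sets meeting a fixed set of s vertices.
frankl : ∀ {m s k} (F : Family (m + suc s)) → Uniform (suc k) F → suc (s + s) * k ≤ m →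
  ¬ Matching F (suc s) → # F + suc m C suc k ≤ (m + suc s) C suc k
frankl {k = k} F u room ¬m with stabilise (suc k) F u
... | F′ , st , u′ , eq , mat = subst (λ z → z + _ ≤ _) eq (Frankl.bound F′ st u′ room (¬m ∘ mat))

-- Boxes in dense sets of vectors

⊆ᵇ-refl : ∀ {n} (A : Subset n) → A ⊆ᵇ A ≡ true
⊆ᵇ-refl []          = refl
⊆ᵇ-refl (true ∷ A)  = ⊆ᵇ-refl A
⊆ᵇ-refl (false ∷ A) = ⊆ᵇ-refl A

⊆ᵇ-lookup : ∀ {n} (B A : Subset n) → B ⊆ᵇ A ≡ true → ∀ i → lookup B i ≡ true → lookup A i ≡ true
⊆ᵇ-lookup (true ∷ B) (true ∷ A) p zero    q = refl
⊆ᵇ-lookup (b ∷ B)    (a ∷ A)    p (suc i) q = ⊆ᵇ-lookup B A (proj₂ (∧-true {not b ∨ a} p)) i q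

∣tabulate∣ : ∀ n (b : Fin n → Bool) → ∣ tabulate b ∣ ≡ ∑ (allFin n) (λ i → ⟦ b i ⟧)
∣tabulate∣ zero    b = refl
∣tabulate∣ (suc n) b = trans (head (b zero) (tabulate (b ∘ suc)))
  (trans (cong (⟦ b zero ⟧ +_) (∣tabulate∣ n (b ∘ suc))) (sym (∑-allFin-suc n (λ i → ⟦ b i ⟧))))
  where
  head : ∀ {n} a (e : Subset n) → ∣ a ∷ e ∣ ≡ ⟦ a ⟧ + ∣ e ∣
  head true  e = refl
  head false e = refl

∑-filter : ∀ {A : Set} {P : A → Set} (P? : ∀ x → Dec (P x)) (xs : List A) →
  ∑ xs (λ x → ⟦ does (P? x) ⟧) ≡ length (filter P? xs)
∑-filter P? [] = refl
∑-filter P? (x ∷ xs) with P? x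
... | yes _ = cong suc (∑-filter P? xs)
... | no _  = ∑-filter P? xs

dec-bound : ∀ {P : Set} (d : Dec P) {x K N} → (P → x ≤ K) → (¬ P → x ≤ N) → x ≤ ⟦ does d ⟧ * K + N
dec-bound (yes p) {N = N} h _ = ≤-trans (h p) (≤-trans (≤-reflexive (sym (*-identityˡ _))) (m≤m+n _ N))
dec-bound (no ¬p)         _ h = h ¬p

InBox : ∀ {A : Set} {M t} → (Fin M → Fin t → A) → Vec A M → Set
InBox {t = t} U v = ∀ i → Σ (Fin t) λ j → lookup v i ≡ U i j

Box : ∀ {A : Set} M → ℕ → (Vec A M → Bool) → Set
Box {A} M t f = Σ (Fin M → Fin t → A) λ U →
  (∀ i → Injective _≡_ _≡_ (U i)) × (∀ v → InBox U v → f v ≡ true)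

-- One coordinate of the induction: among T₀ elements with dense fibres, some set
-- of more than t of them is contained in the fibres of a dense set of tails.
module FirstCoordinate (M d t T₀ : ℕ) (d>0 : 0 < d) (T₀≡ : T₀ ≡ 4 * d * suc t)
  {A : Set} (xs : List A) (u : Unique xs) (n>0 : 0 < length xs) (big : 2 * d * T₀ ≤ length xs)
  (f : Vec A (suc M) → Bool) (dense : length xs ^ suc M ≤ d * ∑ (vecs xs (suc M)) (λ v → ⟦ f v ⟧)) where

  L : ℕ
  L = length (subsets T₀)

  open ≤-Reasoning
  n N : ℕ
  n = length xs
  N = n ^ M
  N>0 : 0 < N
  N>0 = m^n>0 n {{>-nonZero n>0}} M
  g : A → ℕ
  g y = ∑ (vecs xs M) (λ x → ⟦ f (y ∷ x) ⟧)
  g≤N : ∀ y → g y ≤ N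
  g≤N y = ≤-trans (∑-≤const (vecs xs M) 1 (λ {x} _ → ⟦⟧≤1 (f (y ∷ x)))) (≤-reflexive (trans (*-identityʳ _) (length-vecs xs M)))
  heavy? : ∀ y → Dec (N ≤ 2 * d * g y)
  heavy? y = N ≤? 2 * d * g y
  heavies : List A
  heavies = filter heavy? xs
  -- Light fibres have fewer than N / (2d) tails, so together they make up at most half of the
  -- total. The rest forces at least n / (2d) heavy elements.
  pointwise : ∀ y → 2 * d * g y ≤ ⟦ does (heavy? y) ⟧ * (2 * d * N) + N
  pointwise y = dec-bound (heavy? y) (λ _ → *-monoʳ-≤ (2 * d) (g≤N y)) (λ ¬h → <⇒≤ (≰⇒> ¬h))
  many-heavies : T₀ ≤ length heavies
  many-heavies = *-cancelˡ-≤ (2 * d * N) {{>-nonZero (*-mono-≤ {1} {2 * d} (*-mono-≤ {1} {2} (s≤s z≤n) d>0) N>0)}} (+-cancelʳ-≤ (n * N) _ _ (begin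
    2 * d * N * T₀ + n * N
      ≡⟨ cong (_+ n * N) (lem₁ (2 * d) N T₀) ⟩
    2 * d * T₀ * N + n * N
      ≤⟨ +-monoˡ-≤ (n * N) (*-monoˡ-≤ N (big)) ⟩
    n * N + n * N
      ≡⟨ lem₂ n N ⟩
    2 * (n * N)
      ≤⟨ *-monoʳ-≤ 2 dense ⟩
    2 * (d * ∑ (vecs xs (suc M)) (λ v → ⟦ f v ⟧))
      ≡⟨ trans (cong (λ z → 2 * (d * z)) (∑-vecs-suc xs M _)) (trans (sym (*-assoc 2 d _)) (sym (∑-*ˡ xs (2 * d) g))) ⟩
    ∑ xs (λ y → 2 * d * g y)
      ≤⟨ ∑-mono xs pointwise ⟩
    ∑ xs (λ y → ⟦ does (heavy? y) ⟧ * (2 * d * N) + N)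
      ≡⟨ trans (∑-+ xs _ _) (cong₂ _+_ (trans (∑-*ʳ xs (2 * d * N) _) (trans (cong (_* (2 * d * N)) (∑-filter heavy? xs)) (*-comm _ (2 * d * N)))) (∑-const xs N)) ⟩
    2 * d * N * length heavies + n * N ∎))
    where
    lem₁ : ∀ a b c → a * b * c ≡ a * c * b
    lem₁ = solve-∀
    lem₂ : ∀ a b → a * b + a * b ≡ 2 * (a * b)
    lem₂ = solve-∀
  chosen : Σ (Fin T₀ → A) λ Z → (∀ i → Z i ∈ heavies) × Injective _≡_ _≡_ Z
  chosen = choose heavies (Uₚ.filter⁺ heavy? u) many-heavies
  chosen-heavy : ∀ i → N ≤ 2 * d * g (proj₁ chosen i)
  chosen-heavy i = proj₂ (∈ₚ.∈-filter⁻ heavy? {xs = xs} (proj₁ (proj₂ chosen) i))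

  module Fibres (Z : Fin T₀ → A) (Z-injective : Injective _≡_ _≡_ Z) (Z-heavy : ∀ i → N ≤ 2 * d * g (Z i)) where

    mask : Vec A M → Subset T₀
    mask x = tabulate (λ i → f (Z i ∷ x))
    full? : Vec A M → Bool
    full? x = suc t ≤ᵇ ∣ mask x ∣
    H : ℕ
    H = ∑ (vecs xs M) (λ x → ⟦ full? x ⟧)
    mask-size : ∀ x → ∣ mask x ∣ ≤ ⟦ full? x ⟧ * T₀ + suc t
    mask-size x with suc t ≤ᵇ ∣ mask x ∣ in eq
    ... | true  = ≤-trans (𝕊.∣p∣≤n (mask x)) (≤-trans (≤-reflexive (sym (*-identityˡ T₀))) (m≤m+n _ (suc t)))
    ... | false = ≰⇒≥ (λ h → true≢false (≤ᵇ-complete h) eq)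
      where
      ≤ᵇ-complete : ∀ {a b} → a ≤ b → (a ≤ᵇ b) ≡ true
      ≤ᵇ-complete {a} {b} h with a ≤ᵇ b | ≤⇒≤ᵇ h
      ... | true | _ = refl
    -- On average a tail lies in at least T₀ / (2d) = 2 (t + 1) of the chosen fibres, and tails that
    -- are not full contribute at most t + 1 to this average. That explains the factor 4 in `T₀`.
    N≤H : N ≤ 4 * d * H
    N≤H = *-cancelˡ-≤ (2 * d * suc t) {{>-nonZero (*-mono-≤ {1} (*-mono-≤ {1} {2} (s≤s z≤n) d>0) (s≤s z≤n))}} (+-cancelʳ-≤ (2 * d * suc t * N) _ _ (begin
      2 * d * suc t * N + 2 * d * suc t * N
        ≡⟨ trans (lem₁ d (suc t) N) (cong (_* N) (sym T₀≡)) ⟩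
      T₀ * N
        ≡⟨ cong (_* N) (sym (length-allFin T₀)) ⟩
      length (allFin T₀) * N
        ≡⟨ ∑-const (allFin T₀) N ⟨
      ∑ (allFin T₀) (λ _ → N)
        ≤⟨ ∑-mono (allFin T₀) Z-heavy ⟩
      ∑ (allFin T₀) (λ i → 2 * d * g (Z i))
        ≡⟨ trans (∑-*ˡ (allFin T₀) (2 * d) (g ∘ Z)) (cong (2 * d *_) (trans (∑-swap (allFin T₀) (vecs xs M) _)
             (∑-cong (vecs xs M) (λ x → sym (∣tabulate∣ T₀ (λ i → f (Z i ∷ x))))))) ⟩
      2 * d * ∑ (vecs xs M) (λ x → ∣ mask x ∣)
        ≤⟨ *-monoʳ-≤ (2 * d) (≤-trans (∑-mono (vecs xs M) mask-size) (≤-reflexive (trans (∑-+ (vecs xs M) _ _)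
             (cong₂ _+_ (∑-*ʳ (vecs xs M) T₀ _) (trans (∑-const (vecs xs M) (suc t)) (cong (_* suc t) (length-vecs xs M))))))) ⟩
      2 * d * (H * T₀ + N * suc t)
        ≡⟨ trans (cong (λ z → 2 * d * (H * z + N * suc t)) T₀≡) (lem₂ d (suc t) H N) ⟩
      2 * d * suc t * (4 * d * H) + 2 * d * suc t * N ∎))
      where
      lem₁ : ∀ d t N → 2 * d * t * N + 2 * d * t * N ≡ 4 * d * t * N
      lem₁ = solve-∀
      lem₂ : ∀ d t H N → 2 * d * (H * (4 * d * t) + N * t) ≡ 2 * d * t * (4 * d * H) + 2 * d * t * N
      lem₂ = solve-∀
    cnt : Subset T₀ → ℕ
    cnt S = ⟦ suc t ≤ᵇ ∣ S ∣ ⟧ * ∑ (vecs xs M) (λ x → ⟦ S ⊆ᵇ mask x ⟧)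
    H≤cnt : H ≤ ∑ˢ cnt
    H≤cnt = begin
      H
        ≤⟨ ∑-mono (vecs xs M) (λ x → ≤-trans (self x) (term≤∑ (λ S → ⟦ suc t ≤ᵇ ∣ S ∣ ⟧ * ⟦ S ⊆ᵇ mask x ⟧) (∈-subsets (mask x)))) ⟩
      ∑ (vecs xs M) (λ x → ∑ˢ (λ S → ⟦ suc t ≤ᵇ ∣ S ∣ ⟧ * ⟦ S ⊆ᵇ mask x ⟧))
        ≡⟨ ∑-swap (vecs xs M) (subsets T₀) _ ⟩
      ∑ˢ (λ S → ∑ (vecs xs M) (λ x → ⟦ suc t ≤ᵇ ∣ S ∣ ⟧ * ⟦ S ⊆ᵇ mask x ⟧))
        ≡⟨ ∑-cong (subsets T₀) (λ S → ∑-*ˡ (vecs xs M) ⟦ suc t ≤ᵇ ∣ S ∣ ⟧ _) ⟩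
      ∑ˢ cnt ∎
      where
      self : ∀ x → ⟦ full? x ⟧ ≤ ⟦ suc t ≤ᵇ ∣ mask x ∣ ⟧ * ⟦ mask x ⊆ᵇ mask x ⟧
      self x rewrite ⊆ᵇ-refl (mask x) = ≤-reflexive (sym (*-identityʳ _))
    H>0 : 0 < H
    H>0 = n≢0⇒n>0 (λ e → <⇒≱ N>0 (≤-trans N≤H (≤-reflexive (trans (cong (4 * d *_) e) (*-zeroʳ (4 * d))))))
    popular : ∃ λ S → S ∈ subsets T₀ × ∑ˢ cnt ≤ L * cnt S
    popular = ∑-pigeonhole (subsets T₀) cnt (≤-trans H>0 H≤cnt)

    module Common (S : Subset T₀) (S-popular : ∑ˢ cnt ≤ L * cnt S) where

      f′ : Vec A M → Bool
      f′ x = S ⊆ᵇ mask x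
      P : ℕ
      P = ∑ (vecs xs M) (λ x → ⟦ f′ x ⟧)
      S-large : suc t ≤ ∣ S ∣
      S-large = ≤ᵇ⇒≤ (suc t) ∣ S ∣ (subst T (sym (𝔹.¬-not not-small)) tt)
        where
        not-small : (suc t ≤ᵇ ∣ S ∣) ≢ false
        not-small eq = <⇒≱ H>0 (≤-trans H≤cnt (≤-trans S-popular
          (≤-reflexive (trans (cong (λ b → L * (⟦ b ⟧ * P)) eq) (*-zeroʳ L)))))
      cnt≤P : cnt S ≤ P
      cnt≤P = ≤-trans (*-monoˡ-≤ P (⟦⟧≤1 (suc t ≤ᵇ ∣ S ∣))) (≤-reflexive (*-identityˡ P))
      dense′ : N ≤ suc (4 * d * L) * P
      dense′ = begin
        N                      ≤⟨ N≤H ⟩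
        4 * d * H              ≤⟨ *-monoʳ-≤ (4 * d) (≤-trans H≤cnt (≤-trans S-popular (*-monoʳ-≤ L cnt≤P))) ⟩
        4 * d * (L * P)        ≡⟨ *-assoc (4 * d) L P ⟨
        4 * d * L * P          ≤⟨ m≤n+m (4 * d * L * P) P ⟩
        suc (4 * d * L) * P    ∎
      cons : (h : Fin t → Fin T₀) → (∀ i → lookup S (h i) ≡ true) → Injective _≡_ _≡_ h → Box M t f′ → Box (suc M) t f
      cons h h∈ h-inj (U , inj , box) = U′ , inj′ , box′
        where
        U′ : Fin (suc M) → Fin t → A
        U′ zero    j = Z (h j)
        U′ (suc i) j = U i j
        inj′ : ∀ i → Injective _≡_ _≡_ (U′ i)
        inj′ zero    eq = h-inj (Z-injective eq)
        inj′ (suc i) eq = inj i eq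
        box′ : ∀ v → InBox U′ v → f v ≡ true
        box′ (y ∷ v) b = trans (cong (λ z → f (z ∷ v)) (proj₂ (b zero)))
          (trans (sym (𝕍.lookup∘tabulate (λ i → f (Z i ∷ v)) (h (proj₁ (b zero)))))
            (⊆ᵇ-lookup S (mask v) (box v (b ∘ suc)) (h (proj₁ (b zero))) (h∈ (proj₁ (b zero)))))
      extend : Box M t f′ → Box (suc M) t f
      extend = cons (proj₁ picks) (λ i → ∈-elements⁻ S (proj₁ (proj₂ picks) i)) (proj₂ (proj₂ picks))
        where
        picks : Σ (Fin t → Fin T₀) λ h → (∀ i → h i ∈ elements S) × Injective _≡_ _≡_ h
        picks = choose (elements S) (elements-Unique S) (≤-trans (<⇒≤ S-large) (≤-reflexive (sym (length-elements S))))

-- Erdős's theorem on complete multipartite hypergraphs, by induction on the coordinates. The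
-- threshold `n₀` depends on `M`, `D` and `t` only, which allows part sizes to be fixed before the
-- graph. Each coordinate lowers the density from 1 / d to 1 / (4 d L + 1), where L is the number of
-- subsets of the `T₀` chosen elements.
kst : ∀ M D t → Σ ℕ λ n₀ → ∀ {A : Set} (xs : List A) → Unique xs → n₀ ≤ length xs → ∀ f →
  length xs ^ M ≤ suc D * ∑ (vecs xs M) (λ v → ⟦ f v ⟧) → Box M t f
kst zero D t = 0 , λ xs u _ f dense → (λ ()) , (λ ()) , λ { [] _ → nonzero f dense }
  where
  nonzero : ∀ {A : Set} (f : Vec A 0 → Bool) → 1 ≤ suc D * (⟦ f [] ⟧ + 0) → f [] ≡ true
  nonzero f h with f []
  ... | true  = refl
  ... | false = ⊥-elim (1+n≰n (≤-trans h (≤-reflexive (*-zeroʳ (suc D)))))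
kst (suc M) D t = suc (proj₁ IH + 2 * suc D * T₀) , step
  where
  T₀ : ℕ
  T₀ = 4 * suc D * suc t
  IH = kst M (4 * suc D * length (subsets T₀)) t
  step : ∀ {A : Set} (xs : List A) → Unique xs → suc (proj₁ IH + 2 * suc D * T₀) ≤ length xs → ∀ f →
    length xs ^ suc M ≤ suc D * ∑ (vecs xs (suc M)) (λ v → ⟦ f v ⟧) → Box (suc M) t f
  step xs u big f dense = extend (proj₂ IH xs u (≤-trans (m≤m+n _ _) (<⇒≤ big)) f′ dense′)
    where
    open FirstCoordinate M (suc D) t T₀ (s≤s z≤n) refl xs u (≤-trans (s≤s z≤n) big)
      (≤-trans (m≤n+m _ (suc (proj₁ IH))) big) f dense
    open Fibres (proj₁ chosen) (proj₂ (proj₂ chosen)) chosen-heavy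
    open Common (proj₁ popular) (proj₂ (proj₂ popular))

-- Tilings and exchanges

enumerate : ∀ {A : Set} {r} (l : List A) → length l ≡ r → Unique l →
  Σ (Fin r → A) λ f → map f (allFin r) ≡ l × Injective _≡_ _≡_ f
enumerate l refl u = lookupᴸ l , trans (𝕃.map-tabulate id (lookupᴸ l)) (𝕃.tabulate-lookup l) ,
  λ {i} {j} → Unique-lookup u i j

Tile : ℕ → ℕ → ℕ → Set
Tile n r t = Fin r → Fin t → Fin n

TileInjective : ∀ {n r t} → Tile n r t → Set
TileInjective T = ∀ ρ τ ρ′ τ′ → T ρ τ ≡ T ρ′ τ′ → ρ ≡ ρ′ × τ ≡ τ′

Complete : ∀ {n r t} → Family n → Tile n r t → Set
Complete {r = r} {t} E T = ∀ (j : Fin r → Fin t) → E (toSubset (map (λ ρ → T ρ (j ρ)) (allFin r))) ≡ true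

Apart : ∀ {n r t} → Tile n r t → Tile n r t → Set
Apart T T′ = ∀ ρ τ ρ′ τ′ → T ρ τ ≢ T′ ρ′ τ′

record Tiling {n} (E : Family n) (r t : ℕ) : Set where
  field
    tiles     : List (Tile n r t)
    injective : All TileInjective tiles
    complete  : All (Complete E) tiles
    apart-all : AllPairs Apart tiles
open Tiling public

removeAll : ∀ {t} q → Subset t → (Fin q → Fin t) → Subset t
removeAll zero    S u = S
removeAll (suc q) S u = removeAll q S (u ∘ suc) [ u zero ]≔ false

lookup-removeAll : ∀ {t} q (S : Subset t) u {x} → lookup (removeAll q S u) x ≡ true →
  lookup S x ≡ true × (∀ j → x ≢ u j)
lookup-removeAll zero    S u p = p , λ ()
lookup-removeAll (suc q) S u {x} p with x 𝔽.≟ u zero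
... | yes refl = true≢false p (𝕍.lookup∘update x (removeAll q S (u ∘ suc)) false)
... | no ne with lookup-removeAll q S (u ∘ suc) (trans (sym (𝕍.lookup∘update′ ne (removeAll q S (u ∘ suc)) false)) p)
...   | p′ , h = p′ , λ { zero → ne ; (suc j) → h j }

lookup-kept : ∀ {t} q (S : Subset t) u {x} → lookup S x ≡ true → (∀ j → x ≢ u j) → lookup (removeAll q S u) x ≡ true
lookup-kept zero    S u p h = p
lookup-kept (suc q) S u p h = trans (𝕍.lookup∘update′ (h zero) (removeAll q S (u ∘ suc)) false) (lookup-kept q S (u ∘ suc) p (h ∘ suc))

∣delete∣ : ∀ {t} (S : Subset t) x → lookup S x ≡ true → ∣ S ∣ ≡ suc ∣ S [ x ]≔ false ∣
∣delete∣ (true ∷ S)  zero    p = refl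
∣delete∣ (true ∷ S)  (suc x) p = cong suc (∣delete∣ S x p)
∣delete∣ (false ∷ S) (suc x) p = ∣delete∣ S x p

∣removeAll∣ : ∀ {t} q (S : Subset t) u → Injective _≡_ _≡_ u → (∀ j → lookup S (u j) ≡ true) →
  ∣ removeAll q S u ∣ + q ≡ ∣ S ∣
∣removeAll∣ zero    S u inj h = +-identityʳ _
∣removeAll∣ (suc q) S u inj h = trans (+-suc _ q) (trans
  (cong (_+ q) (sym (∣delete∣ (removeAll q S (u ∘ suc)) (u zero)
    (lookup-kept q S (u ∘ suc) (h zero) (λ j e → 𝔽.0≢1+n (inj e))))))
  (∣removeAll∣ q S (u ∘ suc) (𝔽.suc-injective ∘ inj) (h ∘ suc)))

∑-indicator : ∀ n (a : Fin n) → ∑ (allFin n) (λ i → ⟦ does (i 𝔽.≟ a) ⟧) ≡ 1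
∑-indicator (suc n) zero    = trans (∑-allFin-suc n (λ i → ⟦ does (i 𝔽.≟ zero) ⟧)) (cong suc (∑-zero (allFin n)))
∑-indicator (suc n) (suc a) = trans (∑-allFin-suc n (λ i → ⟦ does (i 𝔽.≟ suc a) ⟧)) (∑-indicator n a)

∑-allFin-+ : ∀ m n (f : Fin (m + n) → ℕ) →
  ∑ (allFin (m + n)) f ≡ ∑ (allFin m) (λ i → f (i ↑ˡ n)) + ∑ (allFin n) (λ j → f (m ↑ʳ j))
∑-allFin-+ zero    n f = refl
∑-allFin-+ (suc m) n f = trans (∑-allFin-suc (m + n) f) (trans (cong (f zero +_) (∑-allFin-+ m n (f ∘ suc)))
  (trans (sym (+-assoc (f zero) _ _)) (cong (_+ ∑ (allFin n) (λ j → f (suc m ↑ʳ j))) (sym (∑-allFin-suc m (λ i → f (i ↑ˡ n)))))))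

∑-combine : ∀ m n (f : Fin (m * n) → ℕ) → ∑ (allFin (m * n)) f ≡ ∑ (allFin m) (λ i → ∑ (allFin n) (λ j → f (combine i j)))
∑-combine zero    n f = refl
∑-combine (suc m) n f = trans (∑-allFin-+ n (m * n) f) (trans (cong (∑ (allFin n) (λ i → f (i ↑ˡ m * n)) +_) (∑-combine m n (λ j → f (n ↑ʳ j))))
  (sym (∑-allFin-suc m (λ i → ∑ (allFin n) (λ j → f (combine i j))))))

∑-initial-segment : ∀ n a → ∑ (allFin n) (λ i → ⟦ does (toℕ i <? a) ⟧) ≤ a
∑-initial-segment zero    a       = z≤n
∑-initial-segment (suc n) zero    = ≤-trans (≤-reflexive (∑-allFin-suc n (λ i → ⟦ does (toℕ i <? zero) ⟧))) (∑-initial-segment n zero)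
∑-initial-segment (suc n) (suc a) = ≤-trans (≤-reflexive (∑-allFin-suc n (λ i → ⟦ does (toℕ i <? suc a) ⟧))) (s≤s (∑-initial-segment n a))

-- The vertices are arranged in B columns of h blocks of r × t cells.  A sample
-- consists of one block in every column and one cell in each part of that block;
-- position combine β ρ of the sample is its cell in part ρ of column β.
module Exchange {n r′ B h t t′ : ℕ} (E : Family n)
  (ι : Fin B → Fin h → Fin (suc r′) → Fin t → Fin n)
  (ι-injective : ∀ {β γ ρ τ β′ γ′ ρ′ τ′} → ι β γ ρ τ ≡ ι β′ γ′ ρ′ τ′ → β ≡ β′ × γ ≡ γ′ × ρ ≡ ρ′ × τ ≡ τ′)
  (s₀ : ℕ) where

  r M : ℕ
  r = suc r′
  M = B * r

  column : Fin M → Fin B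
  column i = proj₁ (remQuot r i)

  part : Fin M → Fin r
  part i = proj₂ (remQuot {B} r i)

  position-injective : ∀ {i j} → column i ≡ column j → part i ≡ part j → i ≡ j
  position-injective {i} {j} c p =
    trans (sym (𝔽.combine-remQuot {B} r i)) (trans (cong₂ combine c p) (𝔽.combine-remQuot {B} r j))

  column-combine : ∀ β ρ → column (combine β ρ) ≡ β
  column-combine β ρ = cong proj₁ (𝔽.remQuot-combine β ρ)

  part-combine : ∀ β ρ → part (combine β ρ) ≡ ρ
  part-combine β ρ = cong proj₂ (𝔽.remQuot-combine {B} β ρ)

  Free : Set
  Free = Fin B → Fin h → Fin r → Subset t

  -- The data of one exchange: a block in every column, a pattern of `s₀ + 1` disjoint position
  -- sets, and `t′` free cells at every position such that all selections of one cell per position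
  -- realise the pattern.
  record Swap (free : Free) : Set where
    field
      block     : Fin B → Fin h
      edge      : Fin (suc s₀) → Subset M
      edge-size : ∀ k → ∣ edge k ∣ ≡ r
      edge-disj : ∀ {k k′} → k ≢ k′ → Disjoint (edge k) (edge k′)
      box       : Fin M → Fin t′ → Fin t
      box-inj   : ∀ i → Injective _≡_ _≡_ (box i)
      available : ∀ i j → lookup (free (column i) (block (column i)) (part i)) (box i j) ≡ true
      crossing  : ∀ k (φ : Fin M → Fin t′) →
        E (toSubset (map (λ i → ι (column i) (block (column i)) (part i) (box i (φ i))) (elements (edge k)))) ≡ true

  -- The situation after `q` exchanges; `taken β γ` is the number of exchanges that used the block.
  -- `balance` has the same count for every part `ρ`, so the remainder of a block has parts of equal
  -- size divisible by `t′` whenever `t` is.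
  record State (q : ℕ) : Set where
    field
      free    : Free
      taken   : Fin B → Fin h → ℕ
      balance : ∀ β γ ρ → ∣ free β γ ρ ∣ + taken β γ * t′ ≡ t
      total   : ∀ β → ∑ (allFin h) (taken β) ≡ q
      tiling  : Tiling E r t′
      size    : length (tiles tiling) ≡ q * suc s₀
      covered : All (λ T → ∀ β γ ρ τ ρ′ j → T ρ′ j ≡ ι β γ ρ τ → lookup (free β γ ρ) τ ≡ false) (tiles tiling)

  module Apply {q} (st : State q) (sw : Swap (State.free st)) where
    open State st
    open Swap sw

    order : ∀ k → Σ (Fin r → Fin M) λ f → map f (allFin r) ≡ elements (edge k) × Injective _≡_ _≡_ f
    order k = enumerate (elements (edge k)) (trans (length-elements (edge k)) (edge-size k)) (elements-Unique (edge k))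

    index : ∀ k → Fin r → Fin M
    index k = proj₁ (order k)

    index-∈ : ∀ k ρ → lookup (edge k) (index k ρ) ≡ true
    index-∈ k ρ = ∈-elements⁻ (edge k) (subst (index k ρ ∈_) (proj₁ (proj₂ (order k))) (∈ₚ.∈-map⁺ (index k) (∈ₚ.∈-allFin ρ)))

    cell : Fin M → Fin t′ → Fin n
    cell i j = ι (column i) (block (column i)) (part i) (box i j)

    cell-injective : ∀ {i j i′ j′} → cell i j ≡ cell i′ j′ → i ≡ i′ × j ≡ j′
    cell-injective {i} {j} {i′} {j′} eq with ι-injective eq
    ... | c , _ , p , b with position-injective {i} {i′} c p
    ...   | refl = refl , box-inj i b

    new : Fin (suc s₀) → Tile n r t′
    new k ρ j = cell (index k ρ) j

    new-injective : ∀ k → TileInjective (new k)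
    new-injective k _ _ _ _ eq with cell-injective eq
    ... | i≡i′ , j≡j′ = proj₂ (proj₂ (order k)) i≡i′ , j≡j′

    new-apart : ∀ {k k′} → k ≢ k′ → Apart (new k) (new k′)
    new-apart {k} {k′} ne ρ τ ρ′ τ′ eq = apart (edge-disj ne) (index k ρ) (index-∈ k ρ)
      (subst (λ i → lookup (edge k′) i ≡ true) (sym (proj₁ (cell-injective eq))) (index-∈ k′ ρ′))

    new-complete : ∀ k → Complete E (new k)
    new-complete k j = trans (cong (λ l → E (toSubset l)) same) (crossing k φ)
      where
      φ : Fin M → Fin t′
      -- `crossing` expects a choice at every position of the sample; positions off the edge get the
      -- arbitrary value `j zero`.
      φ i with 𝔽.any? (λ ρ → index k ρ 𝔽.≟ i)
      ... | yes (ρ , _) = j ρ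
      ... | no _        = j zero
      φ-index : ∀ ρ → φ (index k ρ) ≡ j ρ
      φ-index ρ with 𝔽.any? (λ ρ′ → index k ρ′ 𝔽.≟ index k ρ)
      ... | yes (ρ′ , eq) = cong j (proj₂ (proj₂ (order k)) eq)
      ... | no none       = ⊥-elim (none (ρ , refl))
      same : map (λ ρ → new k ρ (j ρ)) (allFin r) ≡ map (λ i → cell i (φ i)) (elements (edge k))
      same = trans (𝕃.map-cong (λ ρ → cong (cell (index k ρ)) (sym (φ-index ρ))) (allFin r))
        (trans (𝕃.map-∘ (allFin r)) (cong (map (λ i → cell i (φ i))) (proj₁ (proj₂ (order k)))))

    -- Cells are removed at all positions of the sampled blocks, also at those outside every edge.
    -- The latter are wasted, but the parts of a block stay equally large.
    free′ : Free
    free′ β γ ρ = if does (γ 𝔽.≟ block β) then removeAll t′ (free β γ ρ) (box (combine β ρ)) else free β γ ρ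

    taken′ : Fin B → Fin h → ℕ
    taken′ β γ = ⟦ does (γ 𝔽.≟ block β) ⟧ + taken β γ

    available-combine : ∀ β ρ j → lookup (free β (block β) ρ) (box (combine β ρ) j) ≡ true
    available-combine β ρ j =
      subst₂ (λ β′ ρ′ → lookup (free β′ (block β′) ρ′) (box (combine β ρ) j) ≡ true) (column-combine β ρ) (part-combine β ρ)
        (available (combine β ρ) j)

    balance′ : ∀ β γ ρ → ∣ free′ β γ ρ ∣ + taken′ β γ * t′ ≡ t
    balance′ β γ ρ with γ 𝔽.≟ block β
    ... | no _     = balance β γ ρ
    ... | yes refl = trans (sym (+-assoc ∣ removeAll t′ (free β γ ρ) (box (combine β ρ)) ∣ t′ (taken β γ * t′)))
      (trans (cong (_+ taken β γ * t′) (∣removeAll∣ t′ (free β γ ρ) (box (combine β ρ)) (box-inj (combine β ρ)) (available-combine β ρ)))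
        (balance β γ ρ))

    total′ : ∀ β → ∑ (allFin h) (taken′ β) ≡ suc q
    total′ β = trans (∑-+ (allFin h) (λ γ → ⟦ does (γ 𝔽.≟ block β) ⟧) (taken β)) (cong₂ _+_ (∑-indicator h (block β)) (total β))

    free′⊆ : ∀ β γ ρ {τ} → lookup (free′ β γ ρ) τ ≡ true → lookup (free β γ ρ) τ ≡ true
    free′⊆ β γ ρ p with does (γ 𝔽.≟ block β)
    ... | true  = proj₁ (lookup-removeAll t′ (free β γ ρ) (box (combine β ρ)) p)
    ... | false = p

    used-up : ∀ {β γ ρ τ} → lookup (free β γ ρ) τ ≡ false → lookup (free′ β γ ρ) τ ≡ false
    used-up {β} {γ} {ρ} p = 𝔹.¬-not (λ q → true≢false (free′⊆ β γ ρ q) p)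

    free′-block : ∀ β ρ → free′ β (block β) ρ ≡ removeAll t′ (free β (block β) ρ) (box (combine β ρ))
    free′-block β ρ = cong (λ b → if b then removeAll t′ (free β (block β) ρ) (box (combine β ρ)) else free β (block β) ρ)
      (dec-true (block β 𝔽.≟ block β) refl)

    new-used : ∀ i j → lookup (free′ (column i) (block (column i)) (part i)) (box i j) ≡ false
    new-used i j = 𝔹.¬-not λ p → proj₂ (lookup-removeAll t′ (free (column i) (block (column i)) (part i))
      (box (combine (column i) (part i))) (trans (cong (λ S → lookup S (box i j)) (sym (free′-block (column i) (part i)))) p)) j
      (cong (λ i′ → box i′ j) (sym (𝔽.combine-remQuot {B} r i)))

    new-covered : ∀ k β γ ρ τ ρ′ j → new k ρ′ j ≡ ι β γ ρ τ → lookup (free′ β γ ρ) τ ≡ false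
    new-covered k _ _ _ _ ρ′ j eq with ι-injective eq
    ... | refl , refl , refl , refl = new-used (index k ρ′) j

    news : List (Tile n r t′)
    news = map new (allFin (suc s₀))

    old-apart : ∀ k → All (Apart (new k)) (tiles tiling)
    old-apart k = All.map (λ cov ρ τ ρ′ τ′ eq → true≢false (available (index k ρ) τ) (cov _ _ _ _ _ _ (sym eq))) covered

    next : State (suc q)
    next = record
      { free    = free′
      ; taken   = taken′
      ; balance = balance′
      ; total   = total′
      ; tiling  = record
        { tiles     = news ++ tiles tiling
        ; injective = Allₚ.++⁺ (Allₚ.map⁺ (All.universal new-injective (allFin (suc s₀)))) (injective tiling)
        ; complete  = Allₚ.++⁺ (Allₚ.map⁺ (All.universal new-complete (allFin (suc s₀)))) (complete tiling)
        ; apart-all = APₚ.++⁺ (APₚ.map⁺ (AllPairs.map new-apart (Uₚ.allFin⁺ (suc s₀)))) (apart-all tiling)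
            (Allₚ.map⁺ (All.universal old-apart (allFin (suc s₀)))) }
      ; size    = trans (𝕃.length-++ news) (cong₂ _+_ (trans (𝕃.length-map new (allFin (suc s₀))) (length-allFin (suc s₀))) size)
      ; covered = Allₚ.++⁺ (Allₚ.map⁺ (All.universal new-covered (allFin (suc s₀)))) (All.map (λ cov β γ ρ τ ρ′ j eq → used-up {β} {γ} {ρ} (cov β γ ρ τ ρ′ j eq)) covered) }

  -- When exchanges stop, what is left of a full block is cut into tiles of part size t′.
  module Finish {q} (st : State q) (w : ℕ) (t≡ : t ≡ w * t′) (full : Fin B → Fin h → Bool)
    (full-complete : ∀ β γ → full β γ ≡ true → Complete E (ι β γ))
    (full-column : ∀ β γ → full β γ ≡ true → toℕ β < s₀) where
    open State st

    slots : Fin B → Fin h → ℕ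
    slots β γ = w ∸ taken β γ

    free-size : ∀ β γ ρ → length (elements (free β γ ρ)) ≡ slots β γ * t′
    free-size β γ ρ = trans (length-elements (free β γ ρ)) (trans (sym (m+n∸n≡m ∣ free β γ ρ ∣ (taken β γ * t′)))
      (trans (cong (_∸ taken β γ * t′) (trans (balance β γ ρ) t≡)) (sym (*-distribʳ-∸ t′ w (taken β γ)))))

    free-order : ∀ β γ ρ → Σ (Fin (slots β γ * t′) → Fin t) λ f →
      map f (allFin (slots β γ * t′)) ≡ elements (free β γ ρ) × Injective _≡_ _≡_ f
    free-order β γ ρ = enumerate (elements (free β γ ρ)) (free-size β γ ρ) (elements-Unique (free β γ ρ))

    chunkIndex : ∀ β γ → Fin (slots β γ) → Fin t′ → Fin (slots β γ * t′)
    chunkIndex β γ c j = combine {slots β γ} {t′} c j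

    chunk : ∀ β γ → Fin (slots β γ) → Tile n r t′
    chunk β γ c ρ j = ι β γ ρ (proj₁ (free-order β γ ρ) (chunkIndex β γ c j))

    chunk-free : ∀ β γ c ρ j → lookup (free β γ ρ) (proj₁ (free-order β γ ρ) (chunkIndex β γ c j)) ≡ true
    chunk-free β γ c ρ j = ∈-elements⁻ (free β γ ρ) (subst (proj₁ (free-order β γ ρ) (chunkIndex β γ c j) ∈_)
      (proj₁ (proj₂ (free-order β γ ρ))) (∈ₚ.∈-map⁺ (proj₁ (free-order β γ ρ)) (∈ₚ.∈-allFin (chunkIndex β γ c j))))

    -- The chunk indices live in `Fin` types that depend on the block, hence the comparison through
    -- `toℕ`.
    chunk-eq : ∀ {β γ c ρ j β′ γ′ c′ ρ′ j′} → chunk β γ c ρ j ≡ chunk β′ γ′ c′ ρ′ j′ →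
      (β ≡ β′ × γ ≡ γ′) × ρ ≡ ρ′ × toℕ c ≡ toℕ c′ × j ≡ j′
    chunk-eq {β} {γ} {c} {ρ} {j} {c′ = c′} {j′ = j′} eq with ι-injective eq
    ... | refl , refl , refl , e with 𝔽.combine-injective c j c′ j′ (proj₂ (proj₂ (free-order β γ ρ)) e)
    ...   | refl , refl = (refl , refl) , refl , refl , refl

    colᵇ : Fin (B * h) → Fin B
    colᵇ b = proj₁ (remQuot h b)

    rowᵇ : Fin (B * h) → Fin h
    rowᵇ b = proj₂ (remQuot {B} h b)

    left : Fin (B * h) → List (Tile n r t′)
    left b = if full (colᵇ b) (rowᵇ b) then map (chunk (colᵇ b) (rowᵇ b)) (allFin (slots (colᵇ b) (rowᵇ b))) else []

    leftovers : List (Tile n r t′)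
    leftovers = concatMap left (allFin (B * h))

    left-All : ∀ {P : Tile n r t′ → Set} b → (full (colᵇ b) (rowᵇ b) ≡ true → ∀ c → P (chunk (colᵇ b) (rowᵇ b) c)) → All P (left b)
    left-All b p with full (colᵇ b) (rowᵇ b)
    ... | true  = Allₚ.map⁺ (All.universal (p refl) (allFin (slots (colᵇ b) (rowᵇ b))))
    ... | false = []

    leftovers-All : ∀ {P : Tile n r t′ → Set} → (∀ β γ → full β γ ≡ true → ∀ c → P (chunk β γ c)) → All P leftovers
    leftovers-All p = Allₚ.concat⁺ (Allₚ.map⁺ (All.universal (λ b → left-All b (p (colᵇ b) (rowᵇ b))) (allFin (B * h))))

    left-apart : ∀ b → AllPairs Apart (left b)
    left-apart b with full (colᵇ b) (rowᵇ b)
    ... | true  = APₚ.map⁺ (AllPairs.map (λ ne _ _ _ _ eq → ne (𝔽.toℕ-injective (proj₁ (proj₂ (proj₂ (chunk-eq eq)))))) (Uₚ.allFin⁺ (slots (colᵇ b) (rowᵇ b))))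
    ... | false = []

    leftovers-apart : AllPairs Apart leftovers
    leftovers-apart = APₚ.concat⁺ (Allₚ.map⁺ (All.universal left-apart (allFin (B * h))))
      (APₚ.map⁺ (AllPairs.map (λ {b} {b′} ne → left-All b (λ _ c → left-All b′ (λ _ c′ ρ τ ρ′ τ′ eq → ne (same-block (proj₁ (chunk-eq eq))))))
        (Uₚ.allFin⁺ (B * h))))
      where
      same-block : ∀ {b b′} → colᵇ b ≡ colᵇ b′ × rowᵇ b ≡ rowᵇ b′ → b ≡ b′
      same-block {b} {b′} (c , p) = trans (sym (𝔽.combine-remQuot {B} h b)) (trans (cong₂ combine c p) (𝔽.combine-remQuot {B} h b′))

    final : Tiling E r t′
    final = record
      { tiles     = tiles tiling ++ leftovers
      ; injective = Allₚ.++⁺ (injective tiling) (leftovers-All (λ β γ _ c ρ τ ρ′ τ′ eq →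
          let (_ , ρ≡ , _ , τ≡) = chunk-eq eq in ρ≡ , τ≡))
      ; complete  = Allₚ.++⁺ (complete tiling) (leftovers-All (λ β γ p c j → full-complete β γ p _))
      ; apart-all = APₚ.++⁺ (apart-all tiling) leftovers-apart
          (All.map (λ cov → leftovers-All (λ β γ _ c ρ τ ρ′ τ′ eq →
            true≢false (chunk-free β γ c ρ′ τ′) (cov _ _ _ _ _ _ eq))) covered) }

    fulls : ℕ
    fulls = ∑ (allFin B) (λ β → ∑ (allFin h) (λ γ → ⟦ full β γ ⟧))

    -- Full blocks occur only in the first `s₀` columns, and an exchange uses one block per column.
    -- So `q` exchanges cost at most `s₀ * q` small tiles, against `q * suc s₀` new ones.
    taken-full : ∑ (allFin B) (λ β → ∑ (allFin h) (λ γ → ⟦ full β γ ⟧ * taken β γ)) ≤ s₀ * q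
    taken-full = begin
      ∑ (allFin B) (λ β → ∑ (allFin h) (λ γ → ⟦ full β γ ⟧ * taken β γ))
        ≤⟨ ∑-mono (allFin B) (λ β → ∑-mono (allFin h) (λ γ → *-monoˡ-≤ (taken β γ) (⟦⟧-mono (λ p → dec-true (toℕ β <? s₀) (full-column β γ p))))) ⟩
      ∑ (allFin B) (λ β → ∑ (allFin h) (λ γ → ⟦ does (toℕ β <? s₀) ⟧ * taken β γ))
        ≡⟨ ∑-cong (allFin B) (λ β → trans (∑-*ˡ (allFin h) ⟦ does (toℕ β <? s₀) ⟧ (taken β)) (cong (⟦ does (toℕ β <? s₀) ⟧ *_) (total β))) ⟩
      ∑ (allFin B) (λ β → ⟦ does (toℕ β <? s₀) ⟧ * q)
        ≡⟨ ∑-*ʳ (allFin B) q _ ⟩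
      ∑ (allFin B) (λ β → ⟦ does (toℕ β <? s₀) ⟧) * q
        ≤⟨ *-monoˡ-≤ q (∑-initial-segment B s₀) ⟩
      s₀ * q ∎
      where open ≤-Reasoning

    left-length : ∀ β γ → length (if full β γ then map (chunk β γ) (allFin (slots β γ)) else []) ≡ ⟦ full β γ ⟧ * slots β γ
    left-length β γ with full β γ
    ... | true  = trans (trans (𝕃.length-map (chunk β γ) (allFin (slots β γ))) (length-allFin (slots β γ))) (sym (+-identityʳ _))
    ... | false = refl

    leftovers-length : length leftovers ≡ ∑ (allFin B) (λ β → ∑ (allFin h) (λ γ → ⟦ full β γ ⟧ * slots β γ))
    leftovers-length = begin
      length leftovers
        ≡⟨ ∑-one leftovers ⟨
      ∑ leftovers (λ _ → 1)
        ≡⟨ ∑-concatMap left (allFin (B * h)) (λ _ → 1) ⟩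
      ∑ (allFin (B * h)) (λ b → ∑ (left b) (λ _ → 1))
        ≡⟨ ∑-cong (allFin (B * h)) (λ b → trans (∑-one (left b)) (left-length (colᵇ b) (rowᵇ b))) ⟩
      ∑ (allFin (B * h)) (λ b → ⟦ full (colᵇ b) (rowᵇ b) ⟧ * slots (colᵇ b) (rowᵇ b))
        ≡⟨ ∑-combine B h _ ⟩
      ∑ (allFin B) (λ β → ∑ (allFin h) (λ γ → ⟦ full (colᵇ (combine β γ)) (rowᵇ (combine β γ)) ⟧ * slots (colᵇ (combine β γ)) (rowᵇ (combine β γ))))
        ≡⟨ ∑-cong (allFin B) (λ β → ∑-cong (allFin h) (λ γ → cong (λ z → ⟦ full (proj₁ z) (proj₂ z) ⟧ * slots (proj₁ z) (proj₂ z)) (𝔽.remQuot-combine β γ))) ⟩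
      ∑ (allFin B) (λ β → ∑ (allFin h) (λ γ → ⟦ full β γ ⟧ * slots β γ)) ∎
      where open ≡-Reasoning

    -- Untouched, the full blocks would be worth `fulls * w` small tiles; each exchange wins at
    -- least one more.
    final-length : fulls * w + q ≤ length (tiles final)
    final-length = +-cancelʳ-≤ (s₀ * q) _ _ (begin
      fulls * w + q + s₀ * q
        ≤⟨ +-monoˡ-≤ (s₀ * q) (+-monoˡ-≤ q fulls*w≤) ⟩
      s₀ * q + length leftovers + q + s₀ * q
        ≡⟨ lem s₀ q (length leftovers) ⟩
      q * suc s₀ + length leftovers + s₀ * q
        ≡⟨ cong (_+ s₀ * q) (trans (cong (_+ length leftovers) (sym size)) (sym (𝕃.length-++ (tiles tiling)))) ⟩
      length (tiles final) + s₀ * q ∎)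
      where
      open ≤-Reasoning
      lem : ∀ s q l → s * q + l + q + s * q ≡ q * suc s + l + s * q
      lem = solve-∀
      pointwise : ∀ β γ → ⟦ full β γ ⟧ * w ≤ ⟦ full β γ ⟧ * taken β γ + ⟦ full β γ ⟧ * slots β γ
      pointwise β γ = ≤-trans (*-monoʳ-≤ ⟦ full β γ ⟧ (m≤n+m∸n w (taken β γ))) (≤-reflexive (*-distribˡ-+ ⟦ full β γ ⟧ (taken β γ) (slots β γ)))
      fulls*w≤ : fulls * w ≤ s₀ * q + length leftovers
      fulls*w≤ = begin
        fulls * w
          ≡⟨ trans (sym (∑-*ʳ (allFin B) w _)) (∑-cong (allFin B) (λ β → sym (∑-*ʳ (allFin h) w _))) ⟩
        ∑ (allFin B) (λ β → ∑ (allFin h) (λ γ → ⟦ full β γ ⟧ * w))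
          ≤⟨ ∑-mono (allFin B) (λ β → ≤-trans (∑-mono (allFin h) (pointwise β)) (≤-reflexive (∑-+ (allFin h) _ _))) ⟩
        ∑ (allFin B) (λ β → ∑ (allFin h) (λ γ → ⟦ full β γ ⟧ * taken β γ) + ∑ (allFin h) (λ γ → ⟦ full β γ ⟧ * slots β γ))
          ≡⟨ ∑-+ (allFin B) _ _ ⟩
        ∑ (allFin B) (λ β → ∑ (allFin h) (λ γ → ⟦ full β γ ⟧ * taken β γ)) + ∑ (allFin B) (λ β → ∑ (allFin h) (λ γ → ⟦ full β γ ⟧ * slots β γ))
          ≤⟨ +-mono-≤ taken-full (≤-reflexive (sym leftovers-length)) ⟩
        s₀ * q + length leftovers ∎

-- Sampling

⟦⟧-≤ : ∀ {b x} → (b ≡ true → 1 ≤ x) → ⟦ b ⟧ ≤ x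
⟦⟧-≤ {true}  h = h refl
⟦⟧-≤ {false} h = z≤n

-- The bound only refutes the absence of a matching, hence the double negation. The equation on `M`
-- avoids transporting families along it.
frankl-exists : ∀ {M} m s k → M ≡ m + suc s → (F : Family M) → Uniform (suc k) F → suc (s + s) * k ≤ m →
  M C suc k < # F + suc m C suc k → ¬ ¬ Matching F (suc s)
frankl-exists m s k refl F u room large ¬m = <⇒≱ large (frankl F u room ¬m)

MatchedBy : ∀ {n q} → Family n → Vec (Subset n) q → Set
MatchedBy F m = (∀ i → F (lookup m i) ≡ true) × (∀ i j → i ≢ j → Disjoint (lookup m i) (lookup m j))

disjoint? : ∀ {n} (a b : Subset n) → Dec (Disjoint a b)
disjoint? a b with 𝔽.all? (λ i → ¬? ((lookup a i 𝔹.≟ true) ×-dec (lookup b i 𝔹.≟ true)))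
... | yes p = yes (disjoint λ i x y → p i (x , y))
... | no ¬p = no λ d → ¬p λ i (x , y) → apart d i x y

matchedBy? : ∀ {n q} (F : Family n) (m : Vec (Subset n) q) → Dec (MatchedBy F m)
matchedBy? F m = 𝔽.all? (λ i → F (lookup m i) 𝔹.≟ true) ×-dec
  𝔽.all? (λ i → 𝔽.all? (λ j → ¬? (i 𝔽.≟ j) →-dec disjoint? (lookup m i) (lookup m j)))

matching-vector : ∀ {n q} (F : Family n) → Matching F q → Σ (Vec (Subset n) q) (MatchedBy F)
matching-vector F (es , all , dis) = tabulate es ,
  (λ i → trans (cong F (𝕍.lookup∘tabulate es i)) (all i)) ,
  λ i j ne → subst₂ Disjoint (sym (𝕍.lookup∘tabulate es i)) (sym (𝕍.lookup∘tabulate es j)) (dis ne)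

∑-vecs-coordinate : ∀ {A : Set} (xs : List A) q (i : Fin q) f →
  ∑ (vecs xs q) (λ v → f (lookup v i)) * length xs ≡ length xs ^ q * ∑ xs f
∑-vecs-coordinate xs (suc q) zero f = begin
  ∑ (vecs xs (suc q)) (λ v → f (lookup v zero)) * length xs
    ≡⟨ cong (_* length xs) (trans (∑-vecs-suc xs q _) (trans (∑-cong xs (λ x → trans (∑-const (vecs xs q) (f x)) (cong (_* f x) (length-vecs xs q))))
         (∑-*ˡ xs (length xs ^ q) f))) ⟩
  length xs ^ q * ∑ xs f * length xs
    ≡⟨ lem (length xs ^ q) (∑ xs f) (length xs) ⟩
  length xs ^ suc q * ∑ xs f ∎
  where
  open ≡-Reasoning
  lem : ∀ a b c → a * b * c ≡ c * a * b
  lem = solve-∀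
∑-vecs-coordinate xs (suc q) (suc i) f = begin
  ∑ (vecs xs (suc q)) (λ v → f (lookup v (suc i))) * length xs
    ≡⟨ cong (_* length xs) (trans (∑-vecs-suc xs q _) (∑-const xs _)) ⟩
  length xs * ∑ (vecs xs q) (λ v → f (lookup v i)) * length xs
    ≡⟨ trans (*-assoc (length xs) _ (length xs)) (cong (length xs *_) (∑-vecs-coordinate xs q i f)) ⟩
  length xs * (length xs ^ q * ∑ xs f)
    ≡⟨ *-assoc (length xs) (length xs ^ q) _ ⟨
  length xs ^ suc q * ∑ xs f ∎
  where open ≡-Reasoning

∑-complement : ∀ {t} (S : Subset t) → ∣ S ∣ + ∑ (allFin t) (λ z → ⟦ not (lookup S z) ⟧) ≡ t
∑-complement []          = refl
∑-complement {suc t} (true ∷ S)  = cong suc (trans (cong (∣ S ∣ +_) (∑-allFin-suc t (λ z → ⟦ not (lookup (true ∷ S) z) ⟧))) (∑-complement S))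
∑-complement {suc t} (false ∷ S) = trans (cong (∣ S ∣ +_) (∑-allFin-suc t (λ z → ⟦ not (lookup (false ∷ S) z) ⟧)))
  (trans (+-suc ∣ S ∣ _) (cong suc (∑-complement S)))

module Sampling {n r′ B h t t′ : ℕ} (E : Family n)
  (ι : Fin B → Fin h → Fin (suc r′) → Fin t → Fin n)
  (ι-injective : ∀ {β γ ρ τ β′ γ′ ρ′ τ′} → ι β γ ρ τ ≡ ι β′ γ′ ρ′ τ′ → β ≡ β′ × γ ≡ γ′ × ρ ≡ ρ′ × τ ≡ τ′)
  (s₀ m₀ : ℕ) (M≡ : B * suc r′ ≡ m₀ + suc s₀) (room : suc (s₀ + s₀) * r′ ≤ m₀)
  (d₀ : Fin t′) (h>0 : 0 < h) (t>0 : 0 < t) where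

  open Exchange {n} {r′} {B} {h} {t} {t′} E ι ι-injective s₀ public

  vertex : Vec (Fin h) B → Vec (Fin t) M → Fin M → Fin n
  vertex γ τ i = ι (column i) (lookup γ (column i)) (part i) (lookup τ i)

  pattern′ : Vec (Fin h) B → Vec (Fin t) M → Family M
  pattern′ γ τ P = (∣ P ∣ ≡ᵇ r) ∧ E (toSubset (map (vertex γ τ) (elements P)))

  γs : List (Vec (Fin h) B)
  γs = vecs (allFin h) B

  τs : List (Vec (Fin t) M)
  τs = vecs (allFin t) M

  length-γs : length γs ≡ h ^ B
  length-γs = trans (length-vecs (allFin h) B) (cong (_^ B) (length-allFin h))

  length-τs : length τs ≡ t ^ M
  length-τs = trans (length-vecs (allFin t) M) (cong (_^ M) (length-allFin t))

  N : ℕ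
  N = h ^ B * t ^ M

  N>0 : 0 < N
  N>0 = *-mono-≤ (m^n>0 h {{>-nonZero h>0}} B) (m^n>0 t {{>-nonZero t>0}} M)

  -- A sample is rich if its pattern exceeds Frankl's bound C(M, r) - C(m₀ + 1, r), so that it has
  -- `s₀ + 1` disjoint edges.
  rich : Vec (Fin h) B → Vec (Fin t) M → Bool
  rich γ τ = does ((M C r) <? # pattern′ γ τ + suc m₀ C r)

  -- All conceivable matchings of positions. Their number does not depend on `n`, so one of them
  -- serves a positive share of the rich samples.
  candidates : List (Vec (Subset M) (suc s₀))
  candidates = vecs (subsets M) (suc s₀)

  K : ℕ
  K = length candidates

  module _ (free : Free) where

    ok : Vec (Fin h) B → Vec (Fin t) M → Bool
    ok γ τ = does (𝔽.all? (λ i → lookup (free (column i) (lookup γ (column i)) (part i)) (lookup τ i) 𝔹.≟ true))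

    good : Vec (Subset M) (suc s₀) → Vec (Fin h) B → Vec (Fin t) M → Bool
    good m γ τ = does (matchedBy? (pattern′ γ τ) m) ∧ ok γ τ

    rich-good : ∀ γ τ → ⟦ rich γ τ ∧ ok γ τ ⟧ ≤ ∑ candidates (λ m → ⟦ good m γ τ ⟧)
    -- The goal is a decidable inequality of numbers and may be proved by contradiction; this is
    -- where the double negation disappears.
    rich-good γ τ = ⟦⟧-≤ λ p → ≮⇒≥ λ none →
      frankl-exists m₀ s₀ r′ M≡ (pattern′ γ τ) (λ q → ≡ᵇ-sound (proj₁ (∧-true q))) room
        (true-dec ((M C r) <? # pattern′ γ τ + suc m₀ C r) (proj₁ (∧-true {rich γ τ} p)))
        (λ mt → <⇒≱ none (witness (proj₂ (∧-true {rich γ τ} p)) (matching-vector (pattern′ γ τ) mt)))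
      where
      witness : ok γ τ ≡ true → Σ (Vec (Subset M) (suc s₀)) (MatchedBy (pattern′ γ τ)) →
        1 ≤ ∑ candidates (λ m → ⟦ good m γ τ ⟧)
      witness o (m , mb) = ≤-trans (≤-reflexive (sym (cong ⟦_⟧ (cong₂ _∧_ (dec-true (matchedBy? (pattern′ γ τ) m) mb) o))))
        (term≤∑ (λ m → ⟦ good m γ τ ⟧) (∈-vecs ∈-subsets m))

    -- Two pigeonholes: first a matching, at the cost of the factor `K`, then the blocks, at no
    -- cost. What remains is a dense set of cell vectors, the form in which `kst` applies.
    select : ∀ D → N ≤ D * ∑ γs (λ γ → ∑ τs (λ τ → ⟦ rich γ τ ∧ ok γ τ ⟧)) →
      Σ (Vec (Subset M) (suc s₀)) λ m → Σ (Vec (Fin h) B) λ γ → t ^ M ≤ D * K * ∑ τs (λ τ → ⟦ good m γ τ ⟧)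
    select D dense = choice (∑-pigeonhole candidates f (positive {D} (≤-trans N>0 N≤f)))
      where
      open ≤-Reasoning
      g : Vec (Subset M) (suc s₀) → Vec (Fin h) B → ℕ
      g m γ = ∑ τs (λ τ → ⟦ good m γ τ ⟧)
      f : Vec (Subset M) (suc s₀) → ℕ
      f m = ∑ γs (g m)
      N≤f : N ≤ D * ∑ candidates f
      N≤f = begin
        N
          ≤⟨ dense ⟩
        D * ∑ γs (λ γ → ∑ τs (λ τ → ⟦ rich γ τ ∧ ok γ τ ⟧))
          ≤⟨ *-monoʳ-≤ D (∑-mono γs (λ γ → ∑-mono τs (λ τ → rich-good γ τ))) ⟩
        D * ∑ γs (λ γ → ∑ τs (λ τ → ∑ candidates (λ m → ⟦ good m γ τ ⟧)))
          ≡⟨ cong (D *_) (trans (∑-cong γs (λ γ → ∑-swap τs candidates _)) (∑-swap γs candidates _)) ⟩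
        D * ∑ candidates f ∎
      positive : ∀ {D x} → 0 < D * x → 0 < x
      positive {D} {zero} p = ⊥-elim (<⇒≱ p (≤-reflexive (*-zeroʳ D)))
      positive {D} {suc x} p = s≤s z≤n
      choice : (∃ λ m → m ∈ candidates × ∑ candidates f ≤ K * f m) → _
      choice (m , _ , f≤) = choice′ (∑-pigeonhole γs (g m) (positive {K} (positive {D} (≤-trans N>0 N≤m))))
        where
        N≤m : N ≤ D * (K * f m)
        N≤m = ≤-trans N≤f (*-monoʳ-≤ D f≤)
        choice′ : (∃ λ γ → γ ∈ γs × f m ≤ length γs * g m γ) → _
        choice′ (γ , _ , g≤) = m , γ , *-cancelˡ-≤ (h ^ B) {{>-nonZero (m^n>0 h {{>-nonZero h>0}} B)}} (begin
          h ^ B * t ^ M                     ≤⟨ N≤m ⟩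
          D * (K * f m)                     ≤⟨ *-monoʳ-≤ D (*-monoʳ-≤ K (≤-trans g≤ (≤-reflexive (cong (_* g m γ) length-γs)))) ⟩
          D * (K * (h ^ B * g m γ))         ≡⟨ lem D K (h ^ B) (g m γ) ⟩
          h ^ B * (D * K * g m γ)           ∎)
          where
          lem : ∀ d k n x → d * (k * (n * x)) ≡ n * (d * k * x)
          lem = solve-∀

    to-swap : ∀ m γ → Box M t′ (good m γ) → Swap free
    to-swap m γ (U , U-inj , box⊆) = record
      { block     = lookup γ
      ; edge      = lookup m
      -- Size and disjointness concern positions only, so they can be read off at any point of the
      -- box; `d₀` provides one.
      ; edge-size = λ k → ≡ᵇ-sound (proj₁ (∧-true (proj₁ (matched (λ _ → d₀)) k)))
      ; edge-disj = λ {k} {k′} ne → proj₂ (matched (λ _ → d₀)) k k′ ne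
      ; box       = U
      ; box-inj   = U-inj
      ; available = λ i j → trans (cong (lookup (free (column i) (lookup γ (column i)) (part i))) (sym (𝕍.lookup∘tabulate (λ i → U i j) i))) (allowed (λ _ → j) i)
      ; crossing  = λ k φ → trans (cong (λ l → E (toSubset l)) (𝕃.map-cong (λ i → cong (ι (column i) (lookup γ (column i)) (part i))
            (sym (𝕍.lookup∘tabulate (λ i → U i (φ i)) i))) (elements (lookup m k))))
          (proj₂ (∧-true {∣ lookup m k ∣ ≡ᵇ r} (proj₁ (matched φ) k))) }
      where
      v : (Fin M → Fin t′) → Vec (Fin t) M
      v φ = tabulate (λ i → U i (φ i))
      in-box : ∀ φ → good m γ (v φ) ≡ true
      in-box φ = box⊆ (v φ) (λ i → φ i , 𝕍.lookup∘tabulate (λ i → U i (φ i)) i)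
      matched : ∀ φ → MatchedBy (pattern′ γ (v φ)) m
      matched φ = true-dec (matchedBy? (pattern′ γ (v φ)) m) (proj₁ (∧-true (in-box φ)))
      allowed : ∀ φ i → lookup (free (column i) (lookup γ (column i)) (part i)) (lookup (v φ) i) ≡ true
      allowed φ = true-dec (𝔽.all? _) (proj₂ (∧-true {does (matchedBy? (pattern′ γ (v φ)) m)} (in-box φ)))

  module _ {q} (st : State q) where
    open State st

    richness : ℕ
    richness = ∑ γs (λ γ → ∑ τs (λ τ → ⟦ rich γ τ ⟧))

    lostAt : Fin M → ℕ
    lostAt i = ∑ γs (λ γ → ∑ τs (λ τ → ⟦ not (lookup (free (column i) (lookup γ (column i)) (part i)) (lookup τ i)) ⟧))

    -- The random cell at a position is already used with probability exactly q t′ / (h t), because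
    -- `balance` and `total` determine the number of used cells in each part of a column.
    lostAt-total : ∀ i → lostAt i * (h * t) ≡ N * (q * t′)
    lostAt-total i = begin
      lostAt i * (h * t)
        ≡⟨ lem (lostAt i) h t ⟩
      lostAt i * t * h
        ≡⟨ cong (_* h) (trans (sym (∑-*ʳ γs t _)) (∑-cong γs inner)) ⟩
      ∑ γs (λ γ → t ^ M * (taken (column i) (lookup γ (column i)) * t′)) * h
        ≡⟨ cong (_* h) (trans (∑-*ˡ γs (t ^ M) _) (cong (t ^ M *_) (∑-*ʳ γs t′ _))) ⟩
      t ^ M * (X * t′) * h
        ≡⟨ lem₂ (t ^ M) X t′ h ⟩
      X * h * (t ^ M * t′)
        ≡⟨ cong (_* (t ^ M * t′)) outer ⟩
      h ^ B * q * (t ^ M * t′)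
        ≡⟨ lem₃ (h ^ B) q (t ^ M) t′ ⟩
      N * (q * t′) ∎
      where
      open ≡-Reasoning
      X : ℕ
      X = ∑ γs (λ γ → taken (column i) (lookup γ (column i)))
      lem : ∀ a b c → a * (b * c) ≡ a * c * b
      lem = solve-∀
      lem₂ : ∀ T X u h → T * (X * u) * h ≡ X * h * (T * u)
      lem₂ = solve-∀
      lem₃ : ∀ H q T u → H * q * (T * u) ≡ H * T * (q * u)
      lem₃ = solve-∀
      gone : ∀ β γ ρ → ∑ (allFin t) (λ z → ⟦ not (lookup (free β γ ρ) z) ⟧) ≡ taken β γ * t′
      gone β γ ρ = +-cancelˡ-≡ ∣ free β γ ρ ∣ _ _ (trans (∑-complement (free β γ ρ)) (sym (balance β γ ρ)))
      inner : ∀ γ → ∑ τs (λ τ → ⟦ not (lookup (free (column i) (lookup γ (column i)) (part i)) (lookup τ i)) ⟧) * t ≡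
        t ^ M * (taken (column i) (lookup γ (column i)) * t′)
      inner γ = subst (λ z → ∑ τs (λ τ → ⟦ not (lookup S (lookup τ i)) ⟧) * z ≡ z ^ M * (taken (column i) (lookup γ (column i)) * t′))
        (length-allFin t) (trans (∑-vecs-coordinate (allFin t) M i (λ z → ⟦ not (lookup S z) ⟧))
          (cong (length (allFin t) ^ M *_) (gone (column i) (lookup γ (column i)) (part i))))
        where S = free (column i) (lookup γ (column i)) (part i)
      outer : X * h ≡ h ^ B * q
      outer = subst (λ z → X * z ≡ z ^ B * q) (length-allFin h)
        (trans (∑-vecs-coordinate (allFin h) B (column i) (taken (column i))) (cong (length (allFin h) ^ B *_) (total (column i))))

    surviving : ℕ
    surviving = ∑ γs (λ γ → ∑ τs (λ τ → ⟦ rich γ τ ∧ ok free γ τ ⟧))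

    richness≤ : richness ≤ surviving + ∑ (allFin M) lostAt
    richness≤ = begin
      richness
        ≤⟨ ∑-mono γs (λ γ → ∑-mono τs (λ τ → pointwise γ τ)) ⟩
      ∑ γs (λ γ → ∑ τs (λ τ → ⟦ rich γ τ ∧ ok free γ τ ⟧ + ∑ (allFin M) (λ i → bad γ τ i)))
        ≡⟨ trans (∑-cong γs (λ γ → trans (∑-+ τs _ _) (cong (∑ τs (λ τ → ⟦ rich γ τ ∧ ok free γ τ ⟧) +_) (∑-swap τs (allFin M) _)))) (∑-+ γs _ _) ⟩
      surviving + ∑ γs (λ γ → ∑ (allFin M) (λ i → ∑ τs (λ τ → bad γ τ i)))
        ≡⟨ cong (surviving +_) (∑-swap γs (allFin M) _) ⟩
      surviving + ∑ (allFin M) lostAt ∎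
      where
      open ≤-Reasoning
      bad : Vec (Fin h) B → Vec (Fin t) M → Fin M → ℕ
      bad γ τ i = ⟦ not (lookup (free (column i) (lookup γ (column i)) (part i)) (lookup τ i)) ⟧
      split : ∀ {P : Fin M → Set} (P? : ∀ i → Dec (P i)) (x : Bool) (b : Fin M → Bool) → (∀ i → ¬ P i → b i ≡ true) →
        ⟦ x ⟧ ≤ ⟦ x ∧ does (𝔽.all? P?) ⟧ + ∑ (allFin M) (λ i → ⟦ b i ⟧)
      split {P} P? x b hb = decided (𝔽.all? P?)
        where
        decided : (d : Dec (∀ i → P i)) → ⟦ x ⟧ ≤ ⟦ x ∧ does d ⟧ + ∑ (allFin M) (λ i → ⟦ b i ⟧)
        decided (yes p) = ≤-trans (≤-reflexive (cong ⟦_⟧ (sym (𝔹.∧-identityʳ x)))) (m≤m+n _ _)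
        decided (no ¬p) with 𝔽.¬∀⟶∃¬ M _ P? ¬p
        ... | i , ¬Pi = ≤-trans (⟦⟧≤1 x) (≤-trans (≤-reflexive (sym (cong ⟦_⟧ (hb i ¬Pi))))
                (≤-trans (term≤∑ (λ i → ⟦ b i ⟧) (∈ₚ.∈-allFin i)) (m≤n+m _ ⟦ x ∧ false ⟧)))
      pointwise : ∀ γ τ → ⟦ rich γ τ ⟧ ≤ ⟦ rich γ τ ∧ ok free γ τ ⟧ + ∑ (allFin M) (bad γ τ)
      pointwise γ τ = split (λ i → lookup (free (column i) (lookup γ (column i)) (part i)) (lookup τ i) 𝔹.≟ true) (rich γ τ)
        (λ i → not (lookup (free (column i) (lookup γ (column i)) (part i)) (lookup τ i))) (λ i ¬p → cong not (𝔹.¬-not ¬p))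

    -- A union bound over the `M` positions: the second hypothesis limits the damaged samples to N /
    -- (2D), half of the guaranteed rich ones.
    survive : ∀ D → N ≤ D * richness → 2 * D * M * t′ * q ≤ h * t → N ≤ 2 * D * surviving
    survive D dense few = +-cancelʳ-≤ N _ _ (begin
      N + N                                             ≤⟨ +-mono-≤ dense dense ⟩
      D * richness + D * richness                       ≡⟨ lem D richness ⟩
      2 * D * richness                                  ≤⟨ *-monoʳ-≤ (2 * D) richness≤ ⟩
      2 * D * (surviving + lost)                        ≡⟨ *-distribˡ-+ (2 * D) surviving lost ⟩
      2 * D * surviving + 2 * D * lost                  ≤⟨ +-monoʳ-≤ (2 * D * surviving) lost≤ ⟩
      2 * D * surviving + N                             ∎)
      where
      open ≤-Reasoning
      lost : ℕ
      lost = ∑ (allFin M) lostAt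
      lem : ∀ d x → d * x + d * x ≡ 2 * d * x
      lem = solve-∀
      lem₂ : ∀ d m n q u → 2 * d * (m * (n * (q * u))) ≡ n * (2 * d * m * u * q)
      lem₂ = solve-∀
      lost≤ : 2 * D * lost ≤ N
      lost≤ = *-cancelʳ-≤ _ _ (h * t) {{>-nonZero (*-mono-≤ h>0 t>0)}} (begin
        2 * D * lost * (h * t)
          ≡⟨ *-assoc (2 * D) lost (h * t) ⟩
        2 * D * (lost * (h * t))
          ≡⟨ cong (2 * D *_) (trans (sym (∑-*ʳ (allFin M) (h * t) lostAt)) (trans (∑-cong (allFin M) lostAt-total)
               (trans (∑-const (allFin M) (N * (q * t′))) (cong (_* (N * (q * t′))) (length-allFin M))))) ⟩
        2 * D * (M * (N * (q * t′)))
          ≡⟨ lem₂ D M N q t′ ⟩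
        N * (2 * D * M * t′ * q)
          ≤⟨ *-monoʳ-≤ N few ⟩
        N * (h * t) ∎)

  initial : State 0
  initial = record
    { free    = λ _ _ _ → Data.Fin.Subset.⊤
    ; taken   = λ _ _ → 0
    ; balance = λ _ _ _ → trans (+-identityʳ _) (𝕊.∣⊤∣≡n t)
    ; total   = λ _ → ∑-zero (allFin h)
    ; tiling  = record { tiles = [] ; injective = [] ; complete = [] ; apart-all = [] }
    ; size    = refl
    ; covered = [] }

  swap-exists : ∀ D {q} (st : State q) → N ≤ D * richness initial → 2 * D * M * t′ * q ≤ h * t →
    proj₁ (kst M (2 * D * K) t′) ≤ t → Swap (State.free st)
  swap-exists D st dense few large = finish (select (State.free st) (2 * D) (survive st D dense few))
    where
    finish : (Σ (Vec (Subset M) (suc s₀)) λ m → Σ (Vec (Fin h) B) λ γ → t ^ M ≤ 2 * D * K * ∑ τs (λ τ → ⟦ good (State.free st) m γ τ ⟧)) → Swap (State.free st)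
    finish (m , γ , le) = to-swap (State.free st) m γ (proj₂ (kst M (2 * D * K) t′) (allFin t) (Uₚ.allFin⁺ t)
      (≤-trans large (≤-reflexive (sym (length-allFin t)))) (good (State.free st) m γ)
      (≤-trans (≤-reflexive (cong (_^ M) (length-allFin t))) (≤-trans le (m≤n+m _ _))))

  -- Richness depends on the edges and the arrangement but not on the state, so the bound at
  -- `initial` serves every exchange.
  states : ∀ D → N ≤ D * richness initial → proj₁ (kst M (2 * D * K) t′) ≤ t →
    ∀ q → 2 * D * M * t′ * q ≤ h * t → State q
  states D dense large zero    few = initial
  states D dense large (suc q) few = Apply.next st (swap-exists D st dense few′ large)
    where
    few′ : 2 * D * M * t′ * q ≤ h * t
    few′ = ≤-trans (*-monoʳ-≤ (2 * D * M * t′) (n≤1+n q)) few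
    st : State q
    st = states D dense large q few′

-- Subsets as lists, and counting vectors with prescribed coordinates

lookup-toSubset⁺ : ∀ {n} {l : List (Fin n)} {x} → x ∈ l → lookup (toSubset l) x ≡ true
lookup-toSubset⁺ {l = v ∷ l} {x} x∈ rewrite 𝕍.lookup-zipWith _∨_ x ⁅ v ⁆ (toSubset l) with x∈
... | here refl rewrite 𝕍.[]=⇒lookup (𝕊.x∈⁅x⁆ v) = refl
... | there x∈′ rewrite lookup-toSubset⁺ {l = l} x∈′ = 𝔹.∨-zeroʳ _

lookup-toSubset⁻ : ∀ {n} (l : List (Fin n)) {x} → lookup (toSubset l) x ≡ true → x ∈ l
lookup-toSubset⁻ []      {x} p = true≢false p (𝕍.lookup-replicate x false)
lookup-toSubset⁻ (v ∷ l) {x} p with lookup ⁅ v ⁆ x in eq | trans (sym (𝕍.lookup-zipWith _∨_ x ⁅ v ⁆ (toSubset l))) p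
... | true  | _ = here (𝕊.x∈⁅y⁆⇒x≡y v (𝕍.lookup⇒[]= x _ eq))
... | false | q = there (lookup-toSubset⁻ l q)

lookup-ext : ∀ {n} {a b : Subset n} → (∀ x → lookup a x ≡ true → lookup b x ≡ true) →
  (∀ x → lookup b x ≡ true → lookup a x ≡ true) → a ≡ b
lookup-ext {a = []}    {[]}    f g = refl
lookup-ext {a = x ∷ a} {y ∷ b} f g = cong₂ _∷_ (head x y (f zero) (g zero)) (lookup-ext (f ∘ suc) (g ∘ suc))
  where
  head : ∀ x y → (x ≡ true → y ≡ true) → (y ≡ true → x ≡ true) → x ≡ y
  head true  y     f g = sym (f refl)
  head false false f g = refl
  head false true  f g = g refl

toSubset-elements : ∀ {n} {e : Subset n} (l : List (Fin n)) → (∀ {x} → x ∈ l → lookup e x ≡ true) →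
  (∀ {x} → lookup e x ≡ true → x ∈ l) → e ≡ toSubset l
toSubset-elements l f g = lookup-ext (λ x p → lookup-toSubset⁺ (g p)) (λ x p → f (lookup-toSubset⁻ l p))

∣insert∣ : ∀ {n} (v : Fin n) s → lookup s v ≡ false → ∣ ⁅ v ⁆ ∪ s ∣ ≡ suc ∣ s ∣
∣insert∣ zero    (false ∷ s) p = cong (λ z → suc ∣ z ∣) (𝕊.∪-identityˡ s)
∣insert∣ (suc v) (true ∷ s)  p = cong suc (∣insert∣ v s p)
∣insert∣ (suc v) (false ∷ s) p = ∣insert∣ v s p

∣toSubset∣ : ∀ {n} {l : List (Fin n)} → Unique l → ∣ toSubset l ∣ ≡ length l
∣toSubset∣ {n} []       = 𝕊.∣⊥∣≡0 n
∣toSubset∣ {l = v ∷ l} (v∉ ∷ u) = trans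
  (∣insert∣ v (toSubset l) (𝔹.¬-not (λ p → All.lookup v∉ (lookup-toSubset⁻ l p) refl))) (cong suc (∣toSubset∣ u))

module Counting {A : Set} (_≟ᴬ_ : (x y : A) → Dec (x ≡ y)) where

  ∑-member : ∀ {l : List A} x → Unique l → ∑ l (λ y → ⟦ does (x ≟ᴬ y) ⟧) ≤ 1
  ∑-member x []       = z≤n
  ∑-member {y ∷ l} x (y∉ ∷ u) with x ≟ᴬ y
  ... | yes refl = s≤s (≤-trans (∑-≤const l 0 (λ z∈ → ≤-reflexive (cong ⟦_⟧ (dec-false (x ≟ᴬ _) (All.lookup y∉ z∈))))) (≤-reflexive (*-zeroʳ (length l))))
  ... | no _     = ∑-member x u

  Unique-length : ∀ {xs ys : List A} → Unique xs → (∀ {x} → x ∈ xs → x ∈ ys) → length xs ≤ length ys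
  Unique-length {xs} {ys} u sub = begin
    length xs                                          ≡⟨ ∑-one xs ⟨
    ∑ xs (λ _ → 1)                                     ≤⟨ ∑-mono-∈ xs (λ {x} x∈ → ≤-trans
      (≤-reflexive (sym (cong ⟦_⟧ (dec-true (x ≟ᴬ x) refl)))) (term≤∑ (λ y → ⟦ does (y ≟ᴬ x) ⟧) (sub x∈))) ⟩
    ∑ xs (λ x → ∑ ys (λ y → ⟦ does (y ≟ᴬ x) ⟧))        ≡⟨ ∑-swap xs ys _ ⟩
    ∑ ys (λ y → ∑ xs (λ x → ⟦ does (y ≟ᴬ x) ⟧))        ≤⟨ ∑-≤const ys 1 (λ {y} _ → ∑-member y u) ⟩
    length ys * 1                                      ≡⟨ *-identityʳ _ ⟩
    length ys                                          ∎
    where open ≤-Reasoning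

_≟ˢ_ : ∀ {n} (a b : Subset n) → Dec (a ≡ b)
_≟ˢ_ = 𝕍.≡-dec 𝔹._≟_

agree : ∀ {q k} → List (Fin q × Fin k) → Vec (Fin k) q → Bool
agree []             v = true
agree ((i , a) ∷ ps) v = does (lookup v i 𝔽.≟ a) ∧ agree ps v

agree-∈ : ∀ {q k} (ps : List (Fin q × Fin k)) v → agree ps v ≡ true → ∀ {i a} → (i , a) ∈ ps → lookup v i ≡ a
agree-∈ ((i , a) ∷ ps) v p (here refl) = true-dec (lookup v i 𝔽.≟ a) (proj₁ (∧-true p))
agree-∈ ((i , a) ∷ ps) v p (there ∈ps) = agree-∈ ps v (proj₂ (∧-true {does (lookup v i 𝔽.≟ a)} p)) ∈ps

agree-update : ∀ {q k} (ps : List (Fin q × Fin k)) v {i} x → All (i ≢_) (map proj₁ ps) → agree ps (v [ i ]≔ x) ≡ agree ps v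
agree-update []             v x []       = refl
agree-update ((j , a) ∷ ps) v x (ne ∷ h) =
  cong₂ (λ y b → does (y 𝔽.≟ a) ∧ b) (𝕍.lookup∘update′ (ne ∘ sym) v x) (agree-update ps v x h)

∑-coordinate : ∀ {q k} (i : Fin q) a (f : Vec (Fin k) q → ℕ) → (∀ v x → f (v [ i ]≔ x) ≡ f v) →
  ∑ (vecs (allFin k) q) (λ v → ⟦ does (lookup v i 𝔽.≟ a) ⟧ * f v) * k ≡ ∑ (vecs (allFin k) q) f
∑-coordinate {suc q} {k} zero a f inv = begin
  ∑ (vecs (allFin k) (suc q)) (λ v → ⟦ does (lookup v zero 𝔽.≟ a) ⟧ * f v) * k
    ≡⟨ cong (_* k) (trans (∑-vecs-suc (allFin k) q _) (∑-cong (allFin k) (λ x → trans (∑-*ˡ (vecs (allFin k) q) ⟦ does (x 𝔽.≟ a) ⟧ _)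
         (cong (⟦ does (x 𝔽.≟ a) ⟧ *_) (∑-cong (vecs (allFin k) q) (λ v → sym (inv (x ∷ v) a))))))) ⟩
  ∑ (allFin k) (λ x → ⟦ does (x 𝔽.≟ a) ⟧ * S) * k
    ≡⟨ cong (_* k) (trans (∑-*ʳ (allFin k) S _) (cong (_* S) (∑-indicator k a))) ⟩
  1 * S * k
    ≡⟨ trans (cong (_* k) (*-identityˡ S)) (trans (*-comm S k) (cong (_* S) (sym (length-allFin k)))) ⟩
  length (allFin k) * S
    ≡⟨ ∑-const (allFin k) S ⟨
  ∑ (allFin k) (λ x → S)
    ≡⟨ ∑-cong (allFin k) (λ x → ∑-cong (vecs (allFin k) q) (λ v → inv (x ∷ v) a)) ⟩
  ∑ (allFin k) (λ x → ∑ (vecs (allFin k) q) (λ v → f (x ∷ v)))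
    ≡⟨ ∑-vecs-suc (allFin k) q f ⟨
  ∑ (vecs (allFin k) (suc q)) f ∎
  where
  open ≡-Reasoning
  S : ℕ
  S = ∑ (vecs (allFin k) q) (λ v → f (a ∷ v))
∑-coordinate {suc q} {k} (suc i) a f inv = begin
  ∑ (vecs (allFin k) (suc q)) (λ v → ⟦ does (lookup v (suc i) 𝔽.≟ a) ⟧ * f v) * k
    ≡⟨ cong (_* k) (∑-vecs-suc (allFin k) q _) ⟩
  ∑ (allFin k) (λ x → ∑ (vecs (allFin k) q) (λ v → ⟦ does (lookup v i 𝔽.≟ a) ⟧ * f (x ∷ v))) * k
    ≡⟨ ∑-*ʳ (allFin k) k _ ⟨
  ∑ (allFin k) (λ x → ∑ (vecs (allFin k) q) (λ v → ⟦ does (lookup v i 𝔽.≟ a) ⟧ * f (x ∷ v)) * k)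
    ≡⟨ ∑-cong (allFin k) (λ x → ∑-coordinate i a (λ v → f (x ∷ v)) (λ v y → inv (x ∷ v) y)) ⟩
  ∑ (allFin k) (λ x → ∑ (vecs (allFin k) q) (λ v → f (x ∷ v)))
    ≡⟨ ∑-vecs-suc (allFin k) q f ⟨
  ∑ (vecs (allFin k) (suc q)) f ∎
  where open ≡-Reasoning

∑-agree : ∀ {q k} (ps : List (Fin q × Fin k)) → Unique (map proj₁ ps) →
  ∑ (vecs (allFin k) q) (λ v → ⟦ agree ps v ⟧) * k ^ length ps ≡ k ^ q
∑-agree {q} {k} [] [] = trans (*-identityʳ _) (trans (∑-one (vecs (allFin k) q)) (trans (length-vecs (allFin k) q) (cong (_^ q) (length-allFin k))))
∑-agree {q} {k} ((i , a) ∷ ps) (i∉ ∷ u) = begin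
  ∑ (vecs (allFin k) q) (λ v → ⟦ agree ((i , a) ∷ ps) v ⟧) * (k * k ^ length ps)
    ≡⟨ *-assoc (∑ (vecs (allFin k) q) (λ v → ⟦ agree ((i , a) ∷ ps) v ⟧)) k (k ^ length ps) ⟨
  ∑ (vecs (allFin k) q) (λ v → ⟦ agree ((i , a) ∷ ps) v ⟧) * k * k ^ length ps
    ≡⟨ cong (λ z → z * k * k ^ length ps) (∑-cong (vecs (allFin k) q) (λ v → ⟦∧⟧ (does (lookup v i 𝔽.≟ a)) (agree ps v))) ⟩
  ∑ (vecs (allFin k) q) (λ v → ⟦ does (lookup v i 𝔽.≟ a) ⟧ * ⟦ agree ps v ⟧) * k * k ^ length ps
    ≡⟨ cong (_* k ^ length ps) (∑-coordinate i a (λ v → ⟦ agree ps v ⟧) (λ v x → cong ⟦_⟧ (agree-update ps v x i∉))) ⟩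
  ∑ (vecs (allFin k) q) (λ v → ⟦ agree ps v ⟧) * k ^ length ps
    ≡⟨ ∑-agree ps u ⟩
  k ^ q ∎
  where open ≡-Reasoning

∑-product : ∀ {A B : Set} (xs : List A) (ys : List B) (f : A → ℕ) (g : B → ℕ) →
  ∑ xs (λ x → ∑ ys (λ y → f x * g y)) ≡ ∑ xs f * ∑ ys g
∑-product xs ys f g = trans (∑-cong xs (λ x → ∑-*ˡ ys (f x) g)) (∑-*ʳ xs (∑ ys g) f)

*-^ : ∀ a b k → (a * b) ^ k ≡ a ^ k * b ^ k
*-^ a b zero    = refl
*-^ a b (suc k) = trans (cong (a * b *_) (*-^ a b k)) (lem a b (a ^ k) (b ^ k))
  where
  lem : ∀ a b x y → a * b * (x * y) ≡ a * x * (b * y)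
  lem = solve-∀

length-concatMap : ∀ {A B : Set} (f : A → List B) c xs → (∀ x → length (f x) ≡ c) → length (concatMap f xs) ≡ length xs * c
length-concatMap f c xs h = begin
  length (concatMap f xs)               ≡⟨ ∑-one (concatMap f xs) ⟨
  ∑ (concatMap f xs) (λ _ → 1)          ≡⟨ ∑-concatMap f xs (λ _ → 1) ⟩
  ∑ xs (λ x → ∑ (f x) (λ _ → 1))        ≡⟨ ∑-cong xs (λ x → trans (∑-one (f x)) (h x)) ⟩
  ∑ xs (λ _ → c)                        ≡⟨ ∑-const xs c ⟩
  length xs * c                         ∎
  where open ≡-Reasoning

length-cartesianProduct : ∀ {A B : Set} (xs : List A) (ys : List B) → length (cartesianProduct xs ys) ≡ length xs * length ys
length-cartesianProduct []       ys = refl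
length-cartesianProduct (x ∷ xs) ys = trans (𝕃.length-++ (map (x ,_) ys))
  (cong₂ _+_ (𝕃.length-map (x ,_) ys) (length-cartesianProduct xs ys))

C-suc : ∀ n k → n C k ≤ suc n C k
C-suc n zero    = ≤-reflexive (trans (nC0 n) (sym (nC0 (suc n))))
C-suc n (suc k) = ≤-trans (m≤n+m (n C suc k) (n C k)) (≤-reflexive (nCk+nC[k+1]≡[n+1]C[k+1] n k))

C-mono : ∀ {m n} k → m ≤ n → m C k ≤ n C k
C-mono {m} k m≤n with d , refl ← m≤n⇒∃[o]m+o≡n m≤n = go d
  where
  go : ∀ d → m C k ≤ (m + d) C k
  go zero    = ≤-reflexive (cong (_C k) (sym (+-identityʳ m)))
  go (suc d) = ≤-trans (go d) (≤-trans (C-suc (m + d) k) (≤-reflexive (cong (_C k) (sym (+-suc m d)))))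

words : ∀ n → ℕ → List (List (Fin n))
words n q = map Data.Vec.toList (vecs (allFin n) q)

length-words : ∀ n q → length (words n q) ≡ n ^ q
length-words n q = trans (𝕃.length-map Data.Vec.toList (vecs (allFin n) q))
  (trans (length-vecs (allFin n) q) (cong (_^ q) (length-allFin n)))

∈-words : ∀ {n q} (l : List (Fin n)) → length l ≡ q → l ∈ words n q
∈-words {n} l refl = subst (_∈ words n (length l)) (𝕍.toList∘fromList l)
  (∈ₚ.∈-map⁺ Data.Vec.toList (∈-vecs ∈ₚ.∈-allFin (Data.Vec.fromList l)))

lookup-delete : ∀ {n} (e : Subset n) v {x} → lookup (e [ v ]≔ false) x ≡ true → lookup e x ≡ true × x ≢ v
lookup-delete e v {x} p with x 𝔽.≟ v
... | yes refl = true≢false p (𝕍.lookup∘update x e false)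
... | no ne    = trans (sym (𝕍.lookup∘update′ ne e false)) p , ne

split-off : ∀ {n q} (e : Subset n) v → lookup e v ≡ true → ∣ e ∣ ≡ suc q → Σ (Subset n) λ e′ → ∣ e′ ∣ ≡ q ×
  (∀ {u} → u ≢ v → lookup e u ≡ true → lookup e′ u ≡ true) × (∀ ws → e′ ≡ toSubset ws → e ≡ toSubset (v ∷ ws))
split-off e v p size = e [ v ]≔ false , suc-injective (trans (sym (∣delete∣ e v p)) size) ,
  (λ ne q → trans (𝕍.lookup∘update′ ne e false) q) ,
  λ ws eq → toSubset-elements (v ∷ ws)
    (λ { (here refl) → p ; (there x∈) → proj₁ (lookup-delete e v (subst (λ s → lookup s _ ≡ true) (sym eq) (lookup-toSubset⁺ x∈))) })
    (λ {x} q → case x eq q)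
  where
  case : ∀ x {ws} → e [ v ]≔ false ≡ toSubset ws → lookup e x ≡ true → x ∈ v ∷ ws
  case x {ws} eq q with x 𝔽.≟ v
  ... | yes x≡v = here x≡v
  ... | no ne   = there (lookup-toSubset⁻ ws (subst (λ s → lookup s x ≡ true) eq (trans (𝕍.lookup∘update′ ne e false) q)))

toSubset-elements′ : ∀ {n} (e : Subset n) → e ≡ toSubset (elements e)
toSubset-elements′ e = toSubset-elements (elements e) (∈-elements⁻ e) (∈-elements⁺ e)

-- Many edges make many samples rich

module Density {n r″ B h t t′ : ℕ} (E : Family n)
  (ι : Fin B → Fin h → Fin (suc (suc r″)) → Fin t → Fin n)
  (ι-injective : ∀ {β γ ρ τ β′ γ′ ρ′ τ′} → ι β γ ρ τ ≡ ι β′ γ′ ρ′ τ′ → β ≡ β′ × γ ≡ γ′ × ρ ≡ ρ′ × τ ≡ τ′)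
  (s₀ m₀ : ℕ) (M≡ : B * suc (suc r″) ≡ m₀ + suc s₀) (room : suc (s₀ + s₀) * suc r″ ≤ m₀)
  (d₀ : Fin t′) (h>0 : 0 < h) (t>0 : 0 < t)
  (L : List (Subset n)) (L-unique : Unique L) (L-uniform : ∀ {e} → e ∈ L → ∣ e ∣ ≡ suc (suc r″))
  (L⊆E : ∀ {e} → e ∈ L → E e ≡ true) where

  open Sampling {n} {suc r″} {B} {h} {t} {t′} E ι ι-injective s₀ m₀ M≡ room d₀ h>0 t>0 public

  Inner Coord : Set
  Inner = Fin h × Fin r × Fin t
  Coord = Fin B × Inner

  at : Coord → Fin n
  at (β , γ , ρ , τ) = ι β γ ρ τ

  at-injective : ∀ {c c′} → at c ≡ at c′ → c ≡ c′
  at-injective eq with ι-injective eq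
  ... | refl , refl , refl , refl = refl

  col : Coord → Fin B
  col = proj₁

  pos : Coord → Fin M
  pos (β , γ , ρ , τ) = combine β ρ

  inners : List Inner
  inners = cartesianProduct (allFin h) (cartesianProduct (allFin r) (allFin t))

  coords : List Coord
  coords = cartesianProduct (allFin B) inners

  ∈-inners : ∀ c → c ∈ inners
  ∈-inners (γ , ρ , τ) = ∈ₚ.∈-cartesianProduct⁺ (∈ₚ.∈-allFin γ) (∈ₚ.∈-cartesianProduct⁺ (∈ₚ.∈-allFin ρ) (∈ₚ.∈-allFin τ))

  ∈-coords : ∀ c → c ∈ coords
  ∈-coords (β , c) = ∈ₚ.∈-cartesianProduct⁺ (∈ₚ.∈-allFin β) (∈-inners c)

  length-inners : length inners ≡ h * (r * t)
  length-inners = trans (length-cartesianProduct (allFin h) _) (cong₂ _*_ (length-allFin h)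
    (trans (length-cartesianProduct (allFin r) (allFin t)) (cong₂ _*_ (length-allFin r) (length-allFin t))))

  length-coords : length coords ≡ B * (h * (r * t))
  length-coords = trans (length-cartesianProduct (allFin B) inners) (cong₂ _*_ (length-allFin B) length-inners)

  coords-Unique : Unique coords
  coords-Unique = Uₚ.cartesianProduct⁺ (Uₚ.allFin⁺ B) (Uₚ.cartesianProduct⁺ (Uₚ.allFin⁺ h) (Uₚ.cartesianProduct⁺ (Uₚ.allFin⁺ r) (Uₚ.allFin⁺ t)))

  placed? : ∀ v → Dec (Any (λ c → at c ≡ v) coords)
  placed? v = Any.any? (λ c → at c 𝔽.≟ v) coords

  outside : List (Fin n)
  outside = filter (λ v → ¬? (placed? v)) (allFin n)

  outside-length : length outside + B * (h * (r * t)) ≤ n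
  outside-length = begin
    length outside + B * (h * (r * t))       ≡⟨ cong (length outside +_) (trans (sym length-coords) (sym (𝕃.length-map at coords))) ⟩
    length outside + length (map at coords)  ≡⟨ 𝕃.length-++ outside ⟨
    length (outside ++ map at coords)        ≤⟨ Counting.Unique-length 𝔽._≟_
      (Uₚ.++⁺ (Uₚ.filter⁺ (λ v → ¬? (placed? v)) (Uₚ.allFin⁺ n)) (Uₚ.map⁺ at-injective coords-Unique) separate) (λ _ → ∈ₚ.∈-allFin _) ⟩
    length (allFin n)                        ≡⟨ length-allFin n ⟩
    n                                        ∎
    where
    open ≤-Reasoning
    separate : ∀ {v} → v ∈ outside × v ∈ map at coords → ⊥
    separate (v∈ , v∈′) with ∈ₚ.∈-map⁻ at v∈′
    ... | c , c∈ , refl = proj₂ (∈ₚ.∈-filter⁻ (λ v → ¬? (placed? v)) {xs = allFin n} v∈) (Any.map (λ { refl → refl }) c∈)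

  -- An edge inside the arrangement with its vertices in distinct columns. All such edges have the
  -- same chance of appearing in a sample.
  record Good (e : Subset n) : Set where
    field
      cs      : List Coord
      number  : length cs ≡ r
      columns : Unique (map col cs)
      carrier : e ≡ toSubset (map at cs)

  -- Overcomplete lists of the r-sets with a vertex outside the arrangement or with two vertices in
  -- one column. The other vertices run over arbitrary words, so repetitions and smaller sets occur,
  -- but the length is immediate.
  outer-bad pair-bad bad-sets : List (Subset n)
  outer-bad = concatMap (λ v → map (λ ws → toSubset (v ∷ ws)) (words n (suc r″))) outside
  pair-bad = concatMap (λ c → concatMap (λ d → map (λ ws → toSubset (at c ∷ at (col c , d) ∷ ws)) (words n r″)) inners) coords
  bad-sets = outer-bad ++ pair-bad

  bad-sets-length : length bad-sets ≡ length outside * n ^ suc r″ + B * (h * (r * t)) * (h * (r * t) * n ^ r″)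
  bad-sets-length = trans (𝕃.length-++ outer-bad) (cong₂ _+_
    (length-concatMap _ (n ^ suc r″) outside (λ v → trans (𝕃.length-map _ (words n (suc r″))) (length-words n (suc r″))))
    (trans (length-concatMap _ (h * (r * t) * n ^ r″) coords (λ c → trans
      (length-concatMap _ (n ^ r″) inners (λ d → trans (𝕃.length-map _ (words n r″)) (length-words n r″)))
      (cong (_* n ^ r″) length-inners))) (cong (_* (h * (r * t) * n ^ r″)) length-coords)))

  collect : ∀ (l : List (Fin n)) → (Σ (List Coord) λ cs → map at cs ≡ l) ⊎ (Σ (Fin n) λ v → v ∈ l × v ∈ outside)
  collect [] = inj₁ ([] , refl)
  collect (v ∷ l) with placed? v
  ... | no ¬p = inj₂ (v , here refl , ∈ₚ.∈-filter⁺ (λ v → ¬? (placed? v)) (∈ₚ.∈-allFin v) ¬p)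
  ... | yes p with collect l
  ...   | inj₂ (u , u∈ , out) = inj₂ (u , there u∈ , out)
  ...   | inj₁ (cs , eq) with find p
  ...     | c , _ , eq′ = inj₁ (c ∷ cs , cong₂ _∷_ eq′ eq)

  same-column : ∀ cs → Unique (map at cs) → Unique (map col cs) ⊎
    (Σ Coord λ c → Σ Coord λ c′ → c ∈ cs × c′ ∈ cs × at c ≢ at c′ × col c ≡ col c′)
  same-column [] _ = inj₁ []
  same-column (c ∷ cs) (c∉ ∷ u) with Any.any? (λ c′ → col c 𝔽.≟ col c′) cs
  ... | yes p with find p
  ...   | c′ , c′∈ , eq = inj₂ (c , c′ , here refl , there c′∈ , All.lookup (Allₚ.map⁻ c∉) c′∈ , eq)
  same-column (c ∷ cs) (c∉ ∷ u) | no ¬p with same-column cs u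
  ... | inj₁ u′ = inj₁ (Allₚ.map⁺ (Allₚ.¬Any⇒All¬ cs ¬p) ∷ u′)
  ... | inj₂ (c₁ , c₂ , c₁∈ , c₂∈ , rest) = inj₂ (c₁ , c₂ , there c₁∈ , there c₂∈ , rest)

  outer-bad⁺ : ∀ e v → ∣ e ∣ ≡ r → lookup e v ≡ true → v ∈ outside → e ∈ bad-sets
  outer-bad⁺ e v size v∈e v∈ with split-off e v v∈e size
  ... | e′ , size′ , _ , eq = ∈ₚ.∈-++⁺ˡ (∈ₚ.∈-concatMap⁺ (λ v → map (λ ws → toSubset (v ∷ ws)) (words n (suc r″))) (Any.map
          (λ { refl → subst (_∈ map (λ ws → toSubset (v ∷ ws)) (words n (suc r″))) (sym (eq (elements e′) (toSubset-elements′ e′)))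
            (∈ₚ.∈-map⁺ (λ ws → toSubset (v ∷ ws)) (∈-words (elements e′) (trans (length-elements e′) size′))) }) v∈))

  pair-bad⁺ : ∀ e c d → ∣ e ∣ ≡ r → lookup e (at c) ≡ true → lookup e (at (col c , d)) ≡ true → at (col c , d) ≢ at c → e ∈ bad-sets
  pair-bad⁺ e c d size c∈e d∈e ne with split-off e (at c) c∈e size
  ... | e′ , size′ , keep , eq with split-off e′ (at (col c , d)) (keep ne d∈e) size′
  ...   | e″ , size″ , _ , eq′ = ∈ₚ.∈-++⁺ʳ outer-bad (∈ₚ.∈-concatMap⁺ g (Any.map (λ { refl →
            ∈ₚ.∈-concatMap⁺ (f c) (Any.map (λ { refl → subst (_∈ f c d)
              (sym (eq (at (col c , d) ∷ elements e″) (eq′ (elements e″) (toSubset-elements′ e″))))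
              (∈ₚ.∈-map⁺ (λ ws → toSubset (at c ∷ at (col c , d) ∷ ws)) (∈-words (elements e″) (trans (length-elements e″) size″))) }) (∈-inners d)) })
            (∈-coords c)))
    where
    f : Coord → Inner → List (Subset n)
    f c d = map (λ ws → toSubset (at c ∷ at (col c , d) ∷ ws)) (words n r″)
    g : Coord → List (Subset n)
    g c = concatMap (f c) inners

  classify : ∀ e → Good e ⊎ (∣ e ∣ ≡ r → e ∈ bad-sets)
  classify e with ∣ e ∣ ≟ r
  ... | no ne = inj₂ (λ eq → ⊥-elim (ne eq))
  ... | yes size with collect (elements e)
  ...   | inj₂ (v , v∈ , out) = inj₂ (λ _ → outer-bad⁺ e v size (∈-elements⁻ e v∈) out)
  ...   | inj₁ (cs , eq) with same-column cs (subst Unique (sym eq) (elements-Unique e))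
  ...     | inj₁ u = inj₁ (record { cs = cs
            ; number = trans (sym (𝕃.length-map at cs)) (trans (cong length eq) (trans (length-elements e) size))
            ; columns = u ; carrier = trans (toSubset-elements′ e) (cong toSubset (sym eq)) })
  ...     | inj₂ (c , (_ , d) , c∈ , c′∈ , ne , refl) = inj₂ (λ _ → pair-bad⁺ e c d size (member c∈) (member c′∈) (ne ∘ sym))
    where
    member : ∀ {c} → c ∈ cs → lookup e (at c) ≡ true
    member c∈ = ∈-elements⁻ e (subst (_ ∈_) eq (∈ₚ.∈-map⁺ at c∈))

  block-pair : Coord → Fin B × Fin h
  block-pair (β , γ , ρ , τ) = β , γ

  cell-pair : Coord → Fin M × Fin t
  cell-pair (β , γ , ρ , τ) = combine β ρ , τ

  blockPairs : List Coord → List (Fin B × Fin h)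
  blockPairs = map block-pair

  cellPairs : List Coord → List (Fin M × Fin t)
  cellPairs = map cell-pair

  hits : List Coord → Vec (Fin h) B → Vec (Fin t) M → Bool
  hits cs γ τ = agree (blockPairs cs) γ ∧ agree (cellPairs cs) τ

  φ : Vec (Fin h) B → Vec (Fin t) M → Subset M → Subset n
  φ γ τ P = toSubset (map (vertex γ τ) (elements P))

  module _ {e} (g : Good e) where
    open Good g

    positions : Unique (map pos cs)
    positions = Uₚ.map⁻ {f = column} (subst Unique (trans (𝕃.map-cong (λ { (β , γ , ρ , τ) → sym (column-combine β ρ) }) cs) (𝕃.map-∘ cs)) columns)

    -- The vertices lie in distinct columns, so the r conditions on blocks and the r conditions on
    -- cells concern distinct coordinates: the probability is 1 / (h t)^r.
    hits-count : ∑ γs (λ γ → ∑ τs (λ τ → ⟦ hits cs γ τ ⟧)) * (h * t) ^ r ≡ N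
    hits-count = begin
      ∑ γs (λ γ → ∑ τs (λ τ → ⟦ hits cs γ τ ⟧)) * (h * t) ^ r
        ≡⟨ cong₂ _*_ (trans (∑-cong γs (λ γ → ∑-cong τs (λ τ → ⟦∧⟧ (agree (blockPairs cs) γ) (agree (cellPairs cs) τ)))) (∑-product γs τs _ _)) (*-^ h t r) ⟩
      X * Y * (h ^ r * t ^ r)
        ≡⟨ lem X Y (h ^ r) (t ^ r) ⟩
      X * h ^ r * (Y * t ^ r)
        ≡⟨ cong₂ _*_ (subst (λ z → X * h ^ z ≡ h ^ B) (trans (𝕃.length-map block-pair cs) number) (∑-agree (blockPairs cs) (subst Unique (𝕃.map-∘ cs) columns)))
            (subst (λ z → Y * t ^ z ≡ t ^ M) (trans (𝕃.length-map cell-pair cs) number) (∑-agree (cellPairs cs) (subst Unique (𝕃.map-∘ cs) positions))) ⟩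
      N ∎
      where
      open ≡-Reasoning
      X Y : ℕ
      X = ∑ γs (λ γ → ⟦ agree (blockPairs cs) γ ⟧)
      Y = ∑ τs (λ τ → ⟦ agree (cellPairs cs) τ ⟧)
      lem : ∀ a b c d → a * b * (c * d) ≡ a * c * (b * d)
      lem = solve-∀

    hits-vertex : ∀ γ τ → hits cs γ τ ≡ true → ∀ {c} → c ∈ cs → vertex γ τ (pos c) ≡ at c
    hits-vertex γ τ p {β , γ′ , ρ , τ′} c∈ = trans
      (cong₂ (λ b k → ι b (lookup γ b) k (lookup τ (combine β ρ))) (column-combine β ρ) (part-combine β ρ))
      (cong₂ (λ x z → ι β x ρ z) (agree-∈ (blockPairs cs) γ (proj₁ (∧-true p)) (∈ₚ.∈-map⁺ block-pair c∈))
        (agree-∈ (cellPairs cs) τ (proj₂ (∧-true {agree (blockPairs cs) γ} p)) (∈ₚ.∈-map⁺ cell-pair c∈)))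

    P : Subset M
    P = toSubset (map pos cs)

    hits-φ : ∀ γ τ → hits cs γ τ ≡ true → e ≡ φ γ τ P
    hits-φ γ τ p = toSubset-elements (map (vertex γ τ) (elements P)) forward backward
      where
      forward : ∀ {x} → x ∈ map (vertex γ τ) (elements P) → lookup e x ≡ true
      forward x∈ with ∈ₚ.∈-map⁻ (vertex γ τ) x∈
      ... | i , i∈ , refl with ∈ₚ.∈-map⁻ pos (lookup-toSubset⁻ (map pos cs) (∈-elements⁻ P i∈))
      ...   | c , c∈ , refl = subst₂ (λ s v → lookup s v ≡ true) (sym carrier) (sym (hits-vertex γ τ p c∈)) (lookup-toSubset⁺ (∈ₚ.∈-map⁺ at c∈))
      backward : ∀ {x} → lookup e x ≡ true → x ∈ map (vertex γ τ) (elements P)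
      backward q with ∈ₚ.∈-map⁻ at (lookup-toSubset⁻ (map at cs) (subst (λ s → lookup s _ ≡ true) carrier q))
      ... | c , c∈ , refl = subst (_∈ map (vertex γ τ) (elements P)) (hits-vertex γ τ p c∈)
              (∈ₚ.∈-map⁺ (vertex γ τ) (∈-elements⁺ P (lookup-toSubset⁺ (∈ₚ.∈-map⁺ pos c∈))))

    hits-pattern : ∀ γ τ → E e ≡ true → hits cs γ τ ≡ true → pattern′ γ τ P ≡ true
    hits-pattern γ τ Ee p = cong₂ _∧_ (≡ᵇ-complete (trans (∣toSubset∣ positions) (trans (𝕃.length-map pos cs) number)))
      (trans (cong E (sym (hits-φ γ τ p))) Ee)

  weight′ : ∀ {e} → Good e ⊎ (∣ e ∣ ≡ r → e ∈ bad-sets) → Vec (Fin h) B → Vec (Fin t) M → ℕ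
  weight′ (inj₁ g) γ τ = ⟦ hits (Good.cs g) γ τ ⟧
  weight′ (inj₂ _) γ τ = 0

  bad′ : ∀ {e} → Good e ⊎ (∣ e ∣ ≡ r → e ∈ bad-sets) → ℕ
  bad′ (inj₁ _) = 0
  bad′ (inj₂ _) = 1

  weight-total : ∀ {e} (k : Good e ⊎ (∣ e ∣ ≡ r → e ∈ bad-sets)) →
    N ≤ ∑ γs (λ γ → ∑ τs (λ τ → weight′ k γ τ)) * (h * t) ^ r + N * bad′ k
  weight-total (inj₁ g) = ≤-trans (≤-reflexive (sym (hits-count g))) (m≤m+n _ _)
  weight-total (inj₂ _) = ≤-trans (≤-reflexive (sym (*-identityʳ N))) (m≤n+m (N * 1) _)

  weight-bound : ∀ γ τ {e} (k : Good e ⊎ (∣ e ∣ ≡ r → e ∈ bad-sets)) → e ∈ L →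
    weight′ k γ τ ≤ ∑ˢ (λ P → ⟦ pattern′ γ τ P ⟧ * ⟦ does (φ γ τ P ≟ˢ e) ⟧)
  weight-bound γ τ (inj₂ _) e∈ = z≤n
  weight-bound γ τ {e} (inj₁ g) e∈ = ⟦⟧-≤ λ p → ≤-trans
    (≤-reflexive (sym (cong₂ (λ a b → ⟦ a ⟧ * ⟦ b ⟧) (hits-pattern g γ τ (L⊆E e∈) p) (dec-true (φ γ τ (P g) ≟ˢ e) (sym (hits-φ g γ τ p))))))
    (term≤∑ (λ P → ⟦ pattern′ γ τ P ⟧ * ⟦ does (φ γ τ P ≟ˢ e) ⟧) (∈-subsets (P g)))

  -- For a fixed sample `φ` maps each position set to a single vertex set, so a member of the
  -- pattern is charged by at most one edge of `L`.
  weights≤pattern : ∀ γ τ → ∑ L (λ e → weight′ (classify e) γ τ) ≤ # pattern′ γ τ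
  weights≤pattern γ τ = begin
    ∑ L (λ e → weight′ (classify e) γ τ)
      ≤⟨ ∑-mono-∈ L (λ {e} e∈ → weight-bound γ τ (classify e) e∈) ⟩
    ∑ L (λ e → ∑ˢ (λ P → ⟦ pattern′ γ τ P ⟧ * ⟦ does (φ γ τ P ≟ˢ e) ⟧))
      ≡⟨ ∑-swap L (subsets M) _ ⟩
    ∑ˢ (λ P → ∑ L (λ e → ⟦ pattern′ γ τ P ⟧ * ⟦ does (φ γ τ P ≟ˢ e) ⟧))
      ≡⟨ ∑-cong (subsets M) (λ P → ∑-*ˡ L ⟦ pattern′ γ τ P ⟧ _) ⟩
    ∑ˢ (λ P → ⟦ pattern′ γ τ P ⟧ * ∑ L (λ e → ⟦ does (φ γ τ P ≟ˢ e) ⟧))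
      ≤⟨ ∑-mono (subsets M) (λ P → ≤-trans (*-monoʳ-≤ ⟦ pattern′ γ τ P ⟧ (Counting.∑-member _≟ˢ_ (φ γ τ P) L-unique)) (≤-reflexive (*-identityʳ _))) ⟩
    # pattern′ γ τ ∎
    where open ≤-Reasoning

  bads : ∑ L (λ e → bad′ (classify e)) ≤ length bad-sets
  bads = begin
    ∑ L (λ e → bad′ (classify e))                           ≤⟨ ∑-mono-∈ L (λ {e} e∈ → one (classify e) e∈) ⟩
    ∑ L (λ e → ∑ bad-sets (λ b → ⟦ does (b ≟ˢ e) ⟧))        ≡⟨ ∑-swap L bad-sets _ ⟩
    ∑ bad-sets (λ b → ∑ L (λ e → ⟦ does (b ≟ˢ e) ⟧))        ≤⟨ ∑-≤const bad-sets 1 (λ {b} _ → Counting.∑-member _≟ˢ_ b L-unique) ⟩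
    length bad-sets * 1                                     ≡⟨ *-identityʳ _ ⟩
    length bad-sets                                         ∎
    where
    open ≤-Reasoning
    one : ∀ {e} (k : Good e ⊎ (∣ e ∣ ≡ r → e ∈ bad-sets)) → e ∈ L → bad′ k ≤ ∑ bad-sets (λ b → ⟦ does (b ≟ˢ e) ⟧)
    one (inj₁ _) _ = z≤n
    one {e} (inj₂ b) e∈ = ≤-trans (≤-reflexive (sym (cong ⟦_⟧ (dec-true (e ≟ˢ e) refl)))) (term≤∑ (λ b → ⟦ does (b ≟ˢ e) ⟧) (b (L-uniform e∈)))

  patterns : ℕ
  patterns = ∑ γs (λ γ → ∑ τs (λ τ → # pattern′ γ τ))

  edges≤patterns : length L * N ≤ (h * t) ^ r * patterns + N * length bad-sets
  edges≤patterns = begin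
    length L * N
      ≡⟨ ∑-const L N ⟨
    ∑ L (λ _ → N)
      ≤⟨ ∑-mono L (λ e → weight-total (classify e)) ⟩
    ∑ L (λ e → ∑ γs (λ γ → ∑ τs (λ τ → weight′ (classify e) γ τ)) * (h * t) ^ r + N * bad′ (classify e))
      ≡⟨ trans (∑-+ L _ _) (cong₂ _+_ (∑-*ʳ L ((h * t) ^ r) _) (∑-*ˡ L N _)) ⟩
    ∑ L (λ e → ∑ γs (λ γ → ∑ τs (λ τ → weight′ (classify e) γ τ))) * (h * t) ^ r + N * ∑ L (λ e → bad′ (classify e))
      ≤⟨ +-mono-≤ (*-monoˡ-≤ ((h * t) ^ r) (≤-trans (≤-reflexive (trans (∑-swap L γs _) (∑-cong γs (λ γ → ∑-swap L τs _))))
           (∑-mono γs (λ γ → ∑-mono τs (λ τ → weights≤pattern γ τ))))) (*-monoʳ-≤ N bads) ⟩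
    patterns * (h * t) ^ r + N * length bad-sets
      ≡⟨ cong (_+ N * length bad-sets) (*-comm patterns ((h * t) ^ r)) ⟩
    (h * t) ^ r * patterns + N * length bad-sets ∎
    where open ≤-Reasoning

  S c₀ X : ℕ
  S = length (subsets M)
  c₀ = suc m₀ C r
  X = (h * t) ^ r

  -- Frankl's bound holds by definition for samples that are not rich; for rich ones the trivial
  -- bound `S`, the number of all position sets, is used.
  pattern-bound : ∀ γ τ → # pattern′ γ τ + c₀ ≤ M C r + ⟦ rich γ τ ⟧ * S
  pattern-bound γ τ = cases ((M C r) <? # pattern′ γ τ + c₀)
    where
    c₀≤ : c₀ ≤ M C r
    c₀≤ = C-mono r (≤-trans (m≤m+n (suc m₀) s₀) (≤-reflexive (trans (sym (+-suc m₀ s₀)) (sym M≡))))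
    cases : (d : Dec (M C r < # pattern′ γ τ + c₀)) → # pattern′ γ τ + c₀ ≤ M C r + ⟦ does d ⟧ * S
    cases (yes _) = ≤-trans (+-mono-≤ (≤-trans (∑-≤const (subsets M) 1 (λ {P} _ → ⟦⟧≤1 (pattern′ γ τ P))) (≤-reflexive (*-comm S 1))) c₀≤)
      (≤-reflexive (+-comm (1 * S) (M C r)))
    cases (no ¬l) = ≤-trans (≮⇒≥ ¬l) (m≤m+n (M C r) 0)

  patterns-bound : patterns + N * c₀ ≤ N * (M C r) + richness initial * S
  patterns-bound = begin
    patterns + N * c₀
      ≡⟨ cong (patterns +_) (sym (constant c₀)) ⟩
    patterns + ∑ γs (λ γ → ∑ τs (λ τ → c₀))
      ≡⟨ sum _ _ ⟩
    ∑ γs (λ γ → ∑ τs (λ τ → # pattern′ γ τ + c₀))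
      ≤⟨ ∑-mono γs (λ γ → ∑-mono τs (λ τ → pattern-bound γ τ)) ⟩
    ∑ γs (λ γ → ∑ τs (λ τ → M C r + ⟦ rich γ τ ⟧ * S))
      ≡⟨ sum _ _ ⟨
    ∑ γs (λ γ → ∑ τs (λ τ → M C r)) + ∑ γs (λ γ → ∑ τs (λ τ → ⟦ rich γ τ ⟧ * S))
      ≡⟨ cong₂ _+_ (constant (M C r)) (trans (∑-cong γs (λ γ → ∑-*ʳ τs S _)) (∑-*ʳ γs S _)) ⟩
    N * (M C r) + richness initial * S ∎
    where
    open ≤-Reasoning
    constant : ∀ c → ∑ γs (λ γ → ∑ τs (λ τ → c)) ≡ N * c
    constant c = trans (∑-cong γs (λ γ → ∑-const τs c)) (trans (∑-const γs (length τs * c))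
      (trans (sym (*-assoc (length γs) (length τs) c)) (cong (_* c) (cong₂ _*_ length-γs length-τs))))
    sum : ∀ (f g : Vec (Fin h) B → Vec (Fin t) M → ℕ) →
      ∑ γs (λ γ → ∑ τs (f γ)) + ∑ γs (λ γ → ∑ τs (g γ)) ≡ ∑ γs (λ γ → ∑ τs (λ τ → f γ τ + g γ τ))
    sum f g = trans (sym (∑-+ γs _ _)) (∑-cong γs (λ γ → sym (∑-+ τs (f γ) (g γ))))

  -- The hypothesis says that an average pattern exceeds Frankl's bound by at least one edge. A
  -- single sample exceeds it by at most `S`, so a share of at least 1 / `S` of the samples is rich.
  dense : X * (M C r) + length bad-sets + X ≤ length L + X * c₀ → N ≤ S * richness initial
  dense hyp = *-cancelˡ-≤ X {{>-nonZero (m^n>0 (h * t) {{>-nonZero (*-mono-≤ h>0 t>0)}} r)}}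
    (+-cancelʳ-≤ (N * (X * (M C r) + length bad-sets)) _ _ (begin
      X * N + N * (X * (M C r) + length bad-sets)
        ≡⟨ lem₁ X N (M C r) (length bad-sets) ⟩
      N * (X * (M C r) + length bad-sets + X)
        ≤⟨ *-monoʳ-≤ N hyp ⟩
      N * (length L + X * c₀)
        ≡⟨ lem₂ N (length L) X c₀ ⟩
      length L * N + X * (N * c₀)
        ≤⟨ +-monoˡ-≤ (X * (N * c₀)) edges≤patterns ⟩
      X * patterns + N * length bad-sets + X * (N * c₀)
        ≡⟨ lem₃ X patterns (N * length bad-sets) (N * c₀) ⟩
      X * (patterns + N * c₀) + N * length bad-sets
        ≤⟨ +-monoˡ-≤ (N * length bad-sets) (*-monoʳ-≤ X patterns-bound) ⟩
      X * (N * (M C r) + richness initial * S) + N * length bad-sets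
        ≡⟨ lem₄ X N (M C r) (richness initial) S (length bad-sets) ⟩
      X * (S * richness initial) + N * (X * (M C r) + length bad-sets) ∎))
    where
    open ≤-Reasoning
    lem₁ : ∀ x n c b → x * n + n * (x * c + b) ≡ n * (x * c + b + x)
    lem₁ = solve-∀
    lem₂ : ∀ n l x c → n * (l + x * c) ≡ l * n + x * (n * c)
    lem₂ = solve-∀
    lem₃ : ∀ x p b c → x * p + b + x * c ≡ x * (p + c) + b
    lem₃ = solve-∀
    lem₄ : ∀ x n c ρ s b → x * (n * c + ρ * s) + n * b ≡ x * (s * ρ) + n * (x * c + b)
    lem₄ = solve-∀

-- Arranging a tiling in columns, and one round of exchanges

AllPairs-lookup : ∀ {A : Set} {R : A → A → Set} → (∀ {x y} → R x y → R y x) → ∀ {xs} → AllPairs R xs →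
  ∀ i j → i ≢ j → R (lookupᴸ xs i) (lookupᴸ xs j)
AllPairs-lookup s (r ∷ rs) zero    zero    ne = ⊥-elim (ne refl)
AllPairs-lookup s (r ∷ rs) zero    (suc j) ne = All.lookup r (∈ₚ.∈-lookup j)
AllPairs-lookup s (r ∷ rs) (suc i) zero    ne = s (All.lookup r (∈ₚ.∈-lookup i))
AllPairs-lookup s (r ∷ rs) (suc i) (suc j) ne = AllPairs-lookup s rs i j (ne ∘ cong suc)

∑-initial-segment-≥ : ∀ n a → a ≤ n → a ≤ ∑ (allFin n) (λ i → ⟦ does (toℕ i <? a) ⟧)
∑-initial-segment-≥ n       zero    _         = z≤n
∑-initial-segment-≥ (suc n) (suc a) (s≤s a≤n) =
  ≤-trans (s≤s (∑-initial-segment-≥ n a a≤n)) (≤-reflexive (sym (∑-allFin-suc n (λ i → ⟦ does (toℕ i <? suc a) ⟧))))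

-- Blocks are numbered column by column, tiles first, so at most `s₀ * h` tiles stay within the
-- first `s₀` columns. The remaining blocks are filled with uncovered vertices: same shape, no edges
-- promised.
module Layout {n r t B h : ℕ} {E : Family n} (Ts : Tiling E r t) (z : ℕ)
  (blocks : B * h ≡ length (tiles Ts) + z) (enough : B * h * (r * t) ≤ n) where

  a : ℕ
  a = length (tiles Ts)

  image : Tile n r t → List (Fin n)
  image T = map (λ p → T (proj₁ p) (proj₂ p)) (cartesianProduct (allFin r) (allFin t))

  vertices : List (Fin n)
  vertices = concatMap image (tiles Ts)

  ∈-image : ∀ T ρ τ → T ρ τ ∈ image T
  ∈-image T ρ τ = ∈ₚ.∈-map⁺ (λ p → T (proj₁ p) (proj₂ p)) (∈ₚ.∈-cartesianProduct⁺ (∈ₚ.∈-allFin ρ) (∈ₚ.∈-allFin τ))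

  ∈-vertices : ∀ i ρ τ → lookupᴸ (tiles Ts) i ρ τ ∈ vertices
  ∈-vertices i ρ τ = ∈ₚ.∈-concatMap⁺ image {xs = tiles Ts} (Any.map
    (λ {T} eq → subst (_∈ image T) (cong (λ T → T ρ τ) (sym eq)) (∈-image T ρ τ)) (∈ₚ.∈-lookup {xs = tiles Ts} i))

  length-vertices : length vertices ≡ a * (r * t)
  length-vertices = length-concatMap image (r * t) (tiles Ts) (λ T → trans (𝕃.length-map _ (cartesianProduct (allFin r) (allFin t)))
    (trans (length-cartesianProduct (allFin r) (allFin t)) (cong₂ _*_ (length-allFin r) (length-allFin t))))

  fresh? : ∀ v → Dec (¬ (v ∈ vertices))
  fresh? v = ¬? (Any.any? (v 𝔽.≟_) vertices)

  rest : List (Fin n)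
  rest = filter fresh? (allFin n)

  rest-length : z * (r * t) ≤ length rest
  rest-length = +-cancelʳ-≤ (a * (r * t)) _ _ (begin
    z * (r * t) + a * (r * t)          ≡⟨ trans (+-comm (z * (r * t)) (a * (r * t))) (trans (sym (*-distribʳ-+ (r * t) a z)) (cong (_* (r * t)) (sym blocks))) ⟩
    B * h * (r * t)                    ≤⟨ enough ⟩
    n                                  ≡⟨ length-allFin n ⟨
    length (allFin n)                  ≤⟨ Counting.Unique-length 𝔽._≟_ (Uₚ.allFin⁺ n) (λ {v} _ → somewhere v) ⟩
    length (rest ++ vertices)          ≡⟨ 𝕃.length-++ rest ⟩
    length rest + length vertices      ≡⟨ cong (length rest +_) length-vertices ⟩
    length rest + a * (r * t)          ∎)
    where
    open ≤-Reasoning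
    somewhere : ∀ v → v ∈ rest ++ vertices
    somewhere v with Any.any? (v 𝔽.≟_) vertices
    ... | yes p = ∈ₚ.∈-++⁺ʳ rest p
    ... | no ¬p = ∈ₚ.∈-++⁺ˡ (∈ₚ.∈-filter⁺ fresh? (∈ₚ.∈-allFin v) ¬p)

  filler : Fin z → Tile n r t
  filler j ρ τ = lookupᴸ rest (inject≤ (combine j (combine ρ τ)) rest-length)

  filler-fresh : ∀ j ρ τ → ¬ (filler j ρ τ ∈ vertices)
  filler-fresh j ρ τ = proj₂ (∈ₚ.∈-filter⁻ fresh? {xs = allFin n} (∈ₚ.∈-lookup (inject≤ (combine j (combine ρ τ)) rest-length)))

  filler-injective : ∀ {j ρ τ j′ ρ′ τ′} → filler j ρ τ ≡ filler j′ ρ′ τ′ → j ≡ j′ × ρ ≡ ρ′ × τ ≡ τ′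
  filler-injective {j} {ρ} {τ} {j′} {ρ′} {τ′} eq
    with 𝔽.combine-injective j (combine ρ τ) j′ (combine ρ′ τ′) (𝔽.inject≤-injective rest-length rest-length _ _
      (Unique-lookup (Uₚ.filter⁺ fresh? (Uₚ.allFin⁺ n)) _ _ eq))
  ... | j≡ , e with 𝔽.combine-injective ρ τ ρ′ τ′ e
  ...   | ρ≡ , τ≡ = j≡ , ρ≡ , τ≡

  blockᵉ : Fin a ⊎ Fin z → Tile n r t
  blockᵉ (inj₁ i) = lookupᴸ (tiles Ts) i
  blockᵉ (inj₂ j) = filler j

  blockᵉ-injective : ∀ k k′ {ρ τ ρ′ τ′} → blockᵉ k ρ τ ≡ blockᵉ k′ ρ′ τ′ → k ≡ k′ × ρ ≡ ρ′ × τ ≡ τ′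
  blockᵉ-injective (inj₁ i) (inj₁ i′) {ρ} {τ} {ρ′} {τ′} eq with i 𝔽.≟ i′
  ... | yes refl = refl , All.lookup (injective Ts) (∈ₚ.∈-lookup i) ρ τ ρ′ τ′ eq
  ... | no ne    = ⊥-elim (AllPairs-lookup (λ ap ρ τ ρ′ τ′ e → ap ρ′ τ′ ρ τ (sym e)) (apart-all Ts) i i′ ne ρ τ ρ′ τ′ eq)
  blockᵉ-injective (inj₁ i) (inj₂ j) {ρ} {τ} {ρ′} {τ′} eq = ⊥-elim (filler-fresh j ρ′ τ′ (subst (_∈ vertices) eq (∈-vertices i ρ τ)))
  blockᵉ-injective (inj₂ j) (inj₁ i) {ρ} {τ} {ρ′} {τ′} eq = ⊥-elim (filler-fresh j ρ τ (subst (_∈ vertices) (sym eq) (∈-vertices i ρ′ τ′)))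
  blockᵉ-injective (inj₂ j) (inj₂ j′) eq with filler-injective eq
  ... | refl , ρ≡ , τ≡ = refl , ρ≡ , τ≡

  number : Fin B → Fin h → Fin (a + z)
  number β γ = Data.Fin.cast blocks (combine β γ)

  ι : Fin B → Fin h → Tile n r t
  ι β γ = blockᵉ (splitAt a (number β γ))

  ι-injective : ∀ {β γ ρ τ β′ γ′ ρ′ τ′} → ι β γ ρ τ ≡ ι β′ γ′ ρ′ τ′ → β ≡ β′ × γ ≡ γ′ × ρ ≡ ρ′ × τ ≡ τ′
  ι-injective {β} {γ} {ρ} {τ} {β′} {γ′} eq with blockᵉ-injective (splitAt a (number β γ)) (splitAt a (number β′ γ′)) eq
  ... | k≡ , ρ≡ , τ≡ with 𝔽.combine-injective β γ β′ γ′ (𝔽.toℕ-injective (trans (sym (𝔽.toℕ-cast blocks (combine β γ)))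
        (trans (cong toℕ (trans (sym (𝔽.join-splitAt a z (number β γ))) (trans (cong (Data.Fin.join a z) k≡) (𝔽.join-splitAt a z (number β′ γ′)))))
          (𝔽.toℕ-cast blocks (combine β′ γ′)))))
  ...   | β≡ , γ≡ = β≡ , γ≡ , ρ≡ , τ≡

  full? : ∀ β γ → Dec (toℕ (combine {B} {h} β γ) < a)
  full? β γ = toℕ (combine β γ) <? a

  full-complete : ∀ β γ → does (full? β γ) ≡ true → Complete E (ι β γ)
  full-complete β γ p = subst (λ k → Complete E (blockᵉ k)) (sym (𝔽.splitAt-< a (number β γ) in-tiles))
    (All.lookup (complete Ts) (∈ₚ.∈-lookup (fromℕ< in-tiles)))
    where
    in-tiles : toℕ (number β γ) < a
    in-tiles = ≤-trans (s≤s (≤-reflexive (𝔽.toℕ-cast blocks (combine β γ)))) (true-dec (full? β γ) p)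

  full-column : ∀ s₀ → a ≤ s₀ * h → ∀ β γ → does (full? β γ) ≡ true → toℕ β < s₀
  full-column s₀ a≤ β γ p = ≰⇒> λ s₀≤β → <⇒≱ (true-dec (full? β γ) p) (begin
    a                       ≤⟨ a≤ ⟩
    s₀ * h                  ≤⟨ *-monoˡ-≤ h s₀≤β ⟩
    toℕ β * h               ≡⟨ *-comm (toℕ β) h ⟩
    h * toℕ β               ≤⟨ m≤m+n _ (toℕ γ) ⟩
    h * toℕ β + toℕ γ       ≡⟨ 𝔽.toℕ-combine β γ ⟨
    toℕ (combine β γ)       ∎)
    where open ≤-Reasoning

  fulls≥ : a ≤ ∑ (allFin B) (λ β → ∑ (allFin h) (λ γ → ⟦ does (full? β γ) ⟧))
  fulls≥ = ≤-trans (∑-initial-segment-≥ (B * h) a (≤-trans (m≤m+n a z) (≤-reflexive (sym blocks))))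
    (≤-reflexive (∑-combine B h (λ b → ⟦ does (toℕ b <? a) ⟧)))

candidates-number : ℕ → ℕ → ℕ
candidates-number M s₀ = length (vecs (subsets M) (suc s₀))

-- The density left for `kst`: `dense` gives a share 1 / S, `survive` halves it and `select` divides
-- it by the number of candidates. Nothing here depends on `n` or on the old part size.
box-size : ℕ → ℕ → ℕ → ℕ
box-size M s₀ t = proj₁ (kst M (2 * length (subsets M) * candidates-number M s₀) t)

-- An old tile is worth `w` small ones, and `q` exchanges add `q`. The longest hypothesis is that of
-- `Density.dense` with the length of `bad-sets` estimated from above.
improve : ∀ {n r″ B h s₀ m₀ w t} (L : List (Subset n)) (E : Family n) → let r = suc (suc r″) ; t′ = suc t ; u = w * t′ ; M = B * r ; X = (h * u) ^ r in
  B * r ≡ m₀ + suc s₀ → suc (s₀ + s₀) * suc r″ ≤ m₀ → 0 < h → 0 < u → box-size M s₀ t′ ≤ u →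
  Unique L → (∀ {e} → e ∈ L → ∣ e ∣ ≡ r) → (∀ {e} → e ∈ L → E e ≡ true) → s₀ ≤ B →
  B * h * (r * u) ≤ n →
  X * (M C r) + ((n ∸ B * h * (r * u)) * n ^ suc r″ + B * (h * (r * u)) * (h * (r * u) * n ^ r″)) + X ≤ length L + X * (suc m₀ C r) →
  (Ts : Tiling E r u) → length (tiles Ts) ≤ s₀ * h →
  ∀ q → 2 * length (subsets M) * M * t′ * q ≤ h * u →
  Σ (Tiling E r t′) λ Ts′ → length (tiles Ts) * w + q ≤ length (tiles Ts′)
improve {n} {r″} {B} {h} {s₀} {m₀} {w} {t} L E M≡ room h>0 u>0 big L-unique L-uniform L⊆E s₀≤B enough dens Ts few q few-q =
  F.final , ≤-trans (+-monoˡ-≤ q (*-monoˡ-≤ w Lay.fulls≥)) F.final-length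
  where
  r u : ℕ
  r = suc (suc r″)
  u = w * suc t
  split : length (tiles Ts) ≤ B * h
  split = ≤-trans few (*-monoˡ-≤ h s₀≤B)
  module Lay = Layout {n} {r} {u} {B} {h} {E} Ts (B * h ∸ length (tiles Ts)) (sym (m+[n∸m]≡n split)) enough
  module D = Density {n} {r″} {B} {h} {u} {suc t} E Lay.ι Lay.ι-injective s₀ m₀ M≡ room zero h>0 u>0 L L-unique L-uniform L⊆E
  outside≤ : length D.outside ≤ n ∸ B * h * (r * u)
  outside≤ = ≤-trans (m+n≤o⇒m≤o∸n (length D.outside) D.outside-length) (≤-reflexive (cong (n ∸_) (sym (*-assoc B h (r * u)))))
  dens′ : D.X * (D.M C r) + length D.bad-sets + D.X ≤ length L + D.X * (suc m₀ C r)
  dens′ = ≤-trans (+-monoˡ-≤ D.X (+-monoʳ-≤ (D.X * (D.M C r)) (≤-trans (≤-reflexive D.bad-sets-length) (+-monoˡ-≤ _ (*-monoˡ-≤ (n ^ suc r″) outside≤))))) dens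
  st : D.State q
  st = D.states D.S (D.dense dens′) big q few-q
  module F = D.Finish st w refl (λ β γ → does (Lay.full? β γ)) Lay.full-complete (Lay.full-column s₀ few)

-- Tight paths in tiles

Unique-++⁻ : ∀ {A : Set} (xs : List A) {ys} → Unique (xs ++ ys) →
  Unique xs × Unique ys × (∀ {x} → x ∈ xs → x ∈ ys → ⊥)
Unique-++⁻ []       u        = [] , u , λ ()
Unique-++⁻ (x ∷ xs) (x∉ ∷ u) with Unique-++⁻ xs u
... | uxs , uys , sep = Allₚ.++⁻ˡ xs x∉ ∷ uxs , uys ,
  λ { (here refl) y∈ → All.lookup (Allₚ.++⁻ʳ xs x∉) y∈ refl ; (there x∈) y∈ → sep x∈ y∈ }

toSubset-swap : ∀ {n} (xs ys : List (Fin n)) → toSubset (xs ++ ys) ≡ toSubset (ys ++ xs)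
toSubset-swap xs ys = toSubset-elements (ys ++ xs) (lookup-toSubset⁺ ∘ flip ys xs) (flip xs ys ∘ lookup-toSubset⁻ (xs ++ ys))
  where
  flip : ∀ {x} as bs → x ∈ as ++ bs → x ∈ bs ++ as
  flip as bs x∈ with ∈ₚ.∈-++⁻ as x∈
  ... | inj₁ p = ∈ₚ.∈-++⁺ʳ bs p
  ... | inj₂ p = ∈ₚ.∈-++⁺ˡ p

take-length : ∀ {A : Set} (xs : List A) {ys k} → length xs ≡ k → take k (xs ++ ys) ≡ xs
take-length []       refl = refl
take-length (x ∷ xs) refl = cong (x ∷_) (take-length xs refl)

windows-∷ : ∀ {n} {P : Subset n → Set} r v vs → (r ≤ suc (length vs) → P (toSubset (take r (v ∷ vs)))) →
  All P (windows r vs) → All P (windows r (v ∷ vs))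
windows-∷ r v vs p ps with r ≤ᵇ suc (length vs) in eq
... | true  = p (≤ᵇ⇒≤ r _ (subst T (sym eq) tt)) ∷ ps
... | false = []

length-windows : ∀ {n} r (vs : List (Fin n)) → length (windows (suc r) vs) ≡ length vs ∸ r
length-windows r []       = sym (0∸n≡0 r)
length-windows r (v ∷ vs) with suc r ≤ᵇ suc (length vs) in eq
... | true  = trans (cong suc (length-windows r vs)) (sym (+-∸-assoc 1 (≤-pred (≤ᵇ⇒≤ (suc r) _ (subst T (sym eq) tt)))))
... | false = sym (m≤n⇒m∸n≡0 {suc (length vs)} {r} (≰⇒> {r} {length vs} (λ h → subst T eq (≤⇒≤ᵇ {suc r} {suc (length vs)} (s≤s h)))))

windows-tail : ∀ {n} {P : Subset n → Set} r v vs → All P (windows (suc r) (v ∷ vs)) → All P (windows (suc r) vs)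
windows-tail r v vs ps with suc r ≤ᵇ suc (length vs) in eq | ps
... | true  | _ ∷ ps′ = ps′
... | false | _ with windows (suc r) vs | length-windows r vs
...   | []    | _ = []
...   | w ∷ _ | e = ⊥-elim (0≢1+n (trans (sym (m≤n⇒m∸n≡0 {length vs} {r} (<⇒≤ (≰⇒> {r} {length vs} (λ h → subst T eq (≤⇒≤ᵇ {suc r} {suc (length vs)} (s≤s h)))))))  (sym e)))

windows-⊆ : ∀ {n} r (vs : List (Fin n)) → All (λ w → ∀ x → lookup w x ≡ true → x ∈ vs) (windows r vs)
windows-⊆ r []       = []
windows-⊆ r (v ∷ vs) = windows-∷ r v vs (λ _ x p → member r (v ∷ vs) (lookup-toSubset⁻ (take r (v ∷ vs)) p))
  (All.map (λ h x p → there (h x p)) (windows-⊆ r vs))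
  where
  member : ∀ {x} r vs → x ∈ take r vs → x ∈ vs
  member (suc r) (v ∷ vs) (here p)  = here p
  member (suc r) (v ∷ vs) (there p) = there (member r vs p)

windows-nonempty : ∀ {n} r (vs : List (Fin n)) → All (λ w → Σ (Fin n) λ x → lookup w x ≡ true) (windows (suc r) vs)
windows-nonempty r []       = []
windows-nonempty r (v ∷ vs) = windows-∷ (suc r) v vs (λ _ → v , lookup-toSubset⁺ {l = v ∷ take r vs} (here refl)) (windows-nonempty r vs)

windows-Unique : ∀ {n} r {vs : List (Fin n)} → Unique vs → Unique (windows (suc r) vs)
windows-Unique r []                = []
windows-Unique r {v ∷ vs} (v∉ ∷ u) with suc r ≤ᵇ suc (length vs)
... | true  = All.map (λ h eq → All.lookup v∉ (h v (subst (λ s → lookup s v ≡ true) eq (lookup-toSubset⁺ {l = take (suc r) (v ∷ vs)} (here refl)))) refl)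
                (windows-⊆ (suc r) vs) ∷ windows-Unique r u
... | false = []

-- Windows of different paths differ because they are nonempty and lie in disjoint vertex sets;
-- hence the positive window length.
concatMap-windows-Unique : ∀ {n} r (ps : List (List (Fin n))) → Unique (concat ps) → Unique (concatMap (windows (suc r)) ps)
concatMap-windows-Unique r []       u = []
concatMap-windows-Unique r (p ∷ ps) u with Unique-++⁻ p u
... | up , ups , sep = Uₚ.++⁺ (windows-Unique r up) (concatMap-windows-Unique r ps ups) λ (w∈ , w∈′) →
  clash w∈ (find (∈ₚ.∈-concatMap⁻ (windows (suc r)) {xs = ps} w∈′))
  where
  clash : ∀ {w} → w ∈ windows (suc r) p → (∃ λ q → q ∈ ps × w ∈ windows (suc r) q) → ⊥
  clash w∈ (q , q∈ , w∈q) with All.lookup (windows-nonempty r p) w∈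
  ... | x , x∈w = sep (All.lookup (windows-⊆ (suc r) p) w∈ x x∈w) (∈ₚ.∈-concat⁺′ (All.lookup (windows-⊆ (suc r) q) w∈q x x∈w) q∈)

-- Deleting the first vertex of a path destroys at most one window.
truncate : ∀ {n} {P : Subset n → Set} r (ps : List (List (Fin n))) k → k ≤ length (concatMap (windows (suc r)) ps) →
  Unique (concat ps) → All P (concatMap (windows (suc r)) ps) →
  Σ (List (List (Fin n))) λ ps′ → length (concatMap (windows (suc r)) ps′) ≡ k × Unique (concat ps′) × All P (concatMap (windows (suc r)) ps′)
truncate r [] k k≤ u all = [] , sym (n≤0⇒n≡0 k≤) , u , all
truncate {n} {P} r (p ∷ ps) k k≤ u all with k ≤? length (concatMap (windows (suc r)) ps)
... | yes k≤′ = truncate r ps k k≤′ (proj₁ (proj₂ (Unique-++⁻ p u))) (Allₚ.++⁻ʳ (windows (suc r) p) all)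
... | no k≰ = shorten p k≤ u (Allₚ.++⁻ˡ (windows (suc r) p) all)
  where
  all-ps : All P (concatMap (windows (suc r)) ps)
  all-ps = Allₚ.++⁻ʳ (windows (suc r) p) all
  W : List (List (Fin n)) → ℕ
  W ps = length (concatMap (windows (suc r)) ps)
  shorten : ∀ p → k ≤ W (p ∷ ps) → Unique (concat (p ∷ ps)) → All P (windows (suc r) p) →
    Σ (List (List (Fin n))) λ ps′ → W ps′ ≡ k × Unique (concat ps′) × All P (concatMap (windows (suc r)) ps′)
  shorten p k≤ u a with W (p ∷ ps) ≟ k
  ... | yes eq = p ∷ ps , eq , u , Allₚ.++⁺ a all-ps
  shorten [] k≤ u a | no _ = ⊥-elim (k≰ k≤)
  shorten (v ∷ vs) k≤ (_ ∷ u) a | no ne = shorten vs (≤-pred (≤-trans (≤∧≢⇒< k≤ (ne ∘ sym)) one-less)) u (windows-tail r v vs a)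
    where
    one-less : W ((v ∷ vs) ∷ ps) ≤ suc (W (vs ∷ ps))
    one-less = begin
      W ((v ∷ vs) ∷ ps)                                         ≡⟨ 𝕃.length-++ (windows (suc r) (v ∷ vs)) ⟩
      length (windows (suc r) (v ∷ vs)) + W ps                  ≤⟨ +-monoˡ-≤ (W ps) (≤-trans (≤-reflexive (length-windows r (v ∷ vs)))
        (≤-trans (m∸n≤suc (length vs) r) (s≤s (≤-reflexive (sym (length-windows r vs)))))) ⟩
      suc (length (windows (suc r) vs)) + W ps                  ≡⟨ cong suc (𝕃.length-++ (windows (suc r) vs)) ⟨
      suc (W (vs ∷ ps))                                         ∎
      where
      open ≤-Reasoning
      m∸n≤suc : ∀ m n → suc m ∸ n ≤ suc (m ∸ n)
      m∸n≤suc m       zero    = ≤-refl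
      m∸n≤suc zero    (suc n) = ≤-trans (≤-reflexive (0∸n≡0 n)) z≤n
      m∸n≤suc (suc m) (suc n) = m∸n≤suc m n

forest-contains : ∀ {r n} (G : Hypergraph (suc r) n) (ps : List (List (Fin n))) k →
  k ≤ length (concatMap (windows (suc r)) ps) → Unique (concat ps) → All (_∈ edges G) (concatMap (windows (suc r)) ps) → ContainsL k G
forest-contains {r} {n} G ps k k≤ u all with truncate r ps k k≤ u all
... | ps′ , size , u′ , all′ = H , ((ps′ , u′ , λ e → mk⇔ id id) , size) , id , id ,
  All.map (λ {e} e∈ → e , e∈ , λ j → mk⇔ (λ j∈ → j , j∈ , refl) (λ { (i , i∈ , refl) → i∈ })) all′
  where
  H : Hypergraph (suc r) n
  H = record { edges = concatMap (windows (suc r)) ps′ ; uniform = All.map (All.lookup (uniform G)) all′ ; simple = concatMap-windows-Unique r ps′ u′ }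

-- The path runs through the rows of the tile, each row visiting the parts in the same order. Any r
-- consecutive vertices therefore meet every part exactly once.
module TilePath {n r t : ℕ} {E : Family n} (T : Tile n r t) (complete : Complete E T) (injective : TileInjective T) where

  pathOf : List (Fin t) → List (Fin n)
  pathOf τs = cartesianProductWith (λ τ ρ → T ρ τ) τs (allFin r)

  row : Fin t → List (Fin r) → List (Fin n)
  row τ = map (λ ρ → T ρ τ)

  path : List (Fin n)
  path = pathOf (allFin t)

  mixed : ∀ ρs ρs′ τ τ′ → ρs ++ ρs′ ≡ allFin r → E (toSubset (row τ ρs′ ++ row τ′ ρs)) ≡ true
  mixed ρs ρs′ τ τ′ eq = trans (cong E (trans (toSubset-swap (row τ ρs′) (row τ′ ρs)) (cong toSubset same))) (complete j)
    where
    sep : ∀ {ρ} → ρ ∈ ρs → ρ ∈ ρs′ → ⊥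
    sep = proj₂ (proj₂ (Unique-++⁻ ρs (subst Unique (sym eq) (Uₚ.allFin⁺ r))))
    j : Fin r → Fin t
    j ρ = if does (Any.any? (ρ 𝔽.≟_) ρs) then τ′ else τ
    left : ∀ {ρ} → ρ ∈ ρs → T ρ τ′ ≡ T ρ (j ρ)
    left {ρ} ρ∈ = cong (λ b → T ρ (if b then τ′ else τ)) (sym (dec-true (Any.any? (ρ 𝔽.≟_) ρs) ρ∈))
    right : ∀ {ρ} → ρ ∈ ρs′ → T ρ τ ≡ T ρ (j ρ)
    right {ρ} ρ∈ = cong (λ b → T ρ (if b then τ′ else τ)) (sym (dec-false (Any.any? (ρ 𝔽.≟_) ρs) (λ ρ∈′ → sep ρ∈′ ρ∈)))
    same : row τ′ ρs ++ row τ ρs′ ≡ map (λ ρ → T ρ (j ρ)) (allFin r)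
    same = trans (cong₂ _++_ (𝕃.map-cong-local (All.tabulate left)) (𝕃.map-cong-local (All.tabulate right)))
      (trans (sym (𝕃.map-++ _ ρs ρs′)) (cong (map (λ ρ → T ρ (j ρ))) eq))

  -- Here `ρs` is the passed portion of row `τ` and `ρs′` the rest. The next window is this rest
  -- completed by the portion `ρs` of the following row, an edge by `mixed`.
  windows∈E : ∀ τ τs ρs ρs′ → ρs ++ ρs′ ≡ allFin r → All (λ e → E e ≡ true) (windows r (row τ ρs′ ++ pathOf τs))
  windows∈E τ []        ρs [] eq = []
  windows∈E τ (τ′ ∷ τs) ρs [] eq = windows∈E τ′ τs [] (allFin r) refl
  windows∈E τ τs ρs (ρ ∷ ρs′) eq = windows-∷ r (T ρ τ) (row τ ρs′ ++ pathOf τs) (first τs)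
    (windows∈E τ τs (ρs ++ ρ ∷ []) ρs′ (trans (𝕃.++-assoc ρs (ρ ∷ []) ρs′) eq))
    where
    size : length ρs + length (ρ ∷ ρs′) ≡ r
    size = trans (sym (𝕃.length-++ ρs)) (trans (cong length eq) (length-allFin r))
    first : ∀ τs → r ≤ suc (length (row τ ρs′ ++ pathOf τs)) → E (toSubset (take r (row τ (ρ ∷ ρs′) ++ pathOf τs))) ≡ true
    -- In the last row the length condition leaves only the window that is the whole row, so `ρs` is
    -- empty.
    first [] le = trans (cong (λ l → E (toSubset l)) (trans (take-length (row τ (ρ ∷ ρs′)) (trans (𝕃.length-map (λ ρ → T ρ τ) (ρ ∷ ρs′)) all-used))
        (trans (sym (𝕃.++-identityʳ (row τ (ρ ∷ ρs′)))) (cong (λ l → row τ (ρ ∷ ρs′) ++ row τ l) (sym ρs≡[]))))) (mixed ρs (ρ ∷ ρs′) τ τ eq)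
      where
      le′ : r ≤ length (ρ ∷ ρs′)
      le′ = ≤-trans le (s≤s (≤-reflexive (trans (cong length (𝕃.++-identityʳ (row τ ρs′))) (𝕃.length-map (λ ρ → T ρ τ) ρs′))))
      nil : length ρs ≡ 0
      nil = n≤0⇒n≡0 (+-cancelʳ-≤ (length (ρ ∷ ρs′)) (length ρs) 0 (≤-trans (≤-reflexive size) le′))
      all-used : length (ρ ∷ ρs′) ≡ r
      all-used = trans (cong (_+ length (ρ ∷ ρs′)) (sym nil)) size
      empty : ∀ (l : List (Fin r)) → length l ≡ 0 → l ≡ []
      empty [] _ = refl
      ρs≡[] : ρs ≡ []
      ρs≡[] = empty ρs nil
    first (τ′ ∷ τs) le = trans (cong (λ l → E (toSubset l)) (trans (cong (take r) regroup)
        (take-length (row τ (ρ ∷ ρs′) ++ row τ′ ρs) (trans (𝕃.length-++ (row τ (ρ ∷ ρs′)))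
          (trans (cong₂ _+_ (𝕃.length-map _ (ρ ∷ ρs′)) (𝕃.length-map _ ρs)) (trans (+-comm (length (ρ ∷ ρs′)) (length ρs)) size))))))
      (mixed ρs (ρ ∷ ρs′) τ τ′ eq)
      where
      regroup : row τ (ρ ∷ ρs′) ++ pathOf (τ′ ∷ τs) ≡ (row τ (ρ ∷ ρs′) ++ row τ′ ρs) ++ (row τ′ (ρ ∷ ρs′) ++ pathOf τs)
      regroup = trans (cong (λ l → row τ (ρ ∷ ρs′) ++ (row τ′ l ++ pathOf τs)) (sym eq))
        (trans (cong (λ l → row τ (ρ ∷ ρs′) ++ (l ++ pathOf τs)) (𝕃.map-++ (λ ρ → T ρ τ′) ρs (ρ ∷ ρs′)))
          (trans (cong (row τ (ρ ∷ ρs′) ++_) (𝕃.++-assoc (row τ′ ρs) (row τ′ (ρ ∷ ρs′)) (pathOf τs)))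
            (sym (𝕃.++-assoc (row τ (ρ ∷ ρs′)) (row τ′ ρs) (row τ′ (ρ ∷ ρs′) ++ pathOf τs)))))

  path-windows : All (λ e → E e ≡ true) (windows r path)
  path-windows with allFin t
  ... | []     = []
  ... | τ ∷ τs = windows∈E τ τs [] (allFin r) refl

  path-Unique : Unique path
  path-Unique = Uₚ.cartesianProductWith⁺ _ (λ eq → proj₂ (injective _ _ _ _ eq) , proj₁ (injective _ _ _ _ eq)) (Uₚ.allFin⁺ t) (Uₚ.allFin⁺ r)

tile-path : ∀ {n r t} → Tile n r t → List (Fin n)
tile-path {r = r} {t} T = cartesianProductWith (λ τ ρ → T ρ τ) (allFin t) (allFin r)

length-cartesianProductWith : ∀ {A B D : Set} (f : A → B → D) xs ys → length (cartesianProductWith f xs ys) ≡ length xs * length ys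
length-cartesianProductWith f []       ys = refl
length-cartesianProductWith f (x ∷ xs) ys = trans (𝕃.length-++ (map (f x) ys)) (cong₂ _+_ (𝕃.length-map (f x) ys) (length-cartesianProductWith f xs ys))

∈-tile-path : ∀ {n r t} (T : Tile n r t) {x} → x ∈ tile-path T → Σ (Fin r) λ ρ → Σ (Fin t) λ τ → x ≡ T ρ τ
∈-tile-path {r = r} {t} T x∈ with ∈ₚ.∈-cartesianProductWith⁻ (λ τ ρ → T ρ τ) (allFin t) (allFin r) x∈
... | τ , ρ , _ , _ , eq = ρ , τ , eq

tiling-contains : ∀ {n r t k} (G : Hypergraph (suc r) n) (E : Family n) → (∀ {e} → E e ≡ true → e ∈ edges G) →
  (Ts : Tiling E (suc r) t) → k ≤ length (tiles Ts) * (t * suc r ∸ r) → ContainsL k G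
tiling-contains {n} {r} {t} {k} G E E⊆ Ts k≤ = forest-contains G (map tile-path (tiles Ts)) k
  (≤-trans k≤ (≤-reflexive (sym count))) paths-Unique
  (Allₚ.concat⁺ (Allₚ.map⁺ (Allₚ.map⁺ (All.zipWith (λ (c , i) → All.map E⊆ (TilePath.path-windows {E = E} _ c i)) (complete Ts , injective Ts)))))
  where
  count : length (concatMap (windows (suc r)) (map tile-path (tiles Ts))) ≡ length (tiles Ts) * (t * suc r ∸ r)
  count = trans (sym (∑-one (concatMap (windows (suc r)) (map tile-path (tiles Ts))))) (trans (∑-concatMap (windows (suc r)) (map tile-path (tiles Ts)) _)
    (trans (∑-map tile-path (tiles Ts) _) (trans (∑-cong (tiles Ts) (λ T → trans (∑-one (windows (suc r) (tile-path T)))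
      (trans (length-windows r (tile-path T)) (cong (_∸ r) (trans (length-cartesianProductWith _ (allFin t) (allFin (suc r)))
        (cong₂ _*_ (length-allFin t) (length-allFin (suc r)))))))) (∑-const (tiles Ts) _))))
  paths-Unique : Unique (concat (map tile-path (tiles Ts)))
  paths-Unique = Uₚ.concat⁺ (Allₚ.map⁺ (All.zipWith (λ (c , i) → TilePath.path-Unique {E = E} _ c i) (complete Ts , injective Ts)))
    (APₚ.map⁺ (AllPairs.map (λ {T} {T′} ap {_} p → separate T T′ ap (∈-tile-path T (proj₁ p)) (∈-tile-path T′ (proj₂ p))) (apart-all Ts)))
    where
    separate : ∀ T T′ → Apart T T′ → ∀ {x : Fin n} → (Σ (Fin (suc r)) λ ρ → Σ (Fin t) λ τ → x ≡ T ρ τ) →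
      (Σ (Fin (suc r)) λ ρ → Σ (Fin t) λ τ → x ≡ T′ ρ τ) → ⊥
    separate T T′ ap (ρ , τ , e) (ρ′ , τ′ , e′) = ap ρ τ ρ′ τ′ (trans (sym e) e′)

-- Lower bound

hits-first : ∀ {n} → ℕ → Subset n → Bool
hits-first zero    e       = false
hits-first (suc s) []      = false
hits-first (suc s) (x ∷ e) = x ∨ hits-first s e

#-miss : ∀ n s k → # (λ (e : Subset n) → not (hits-first s e) ∧ (∣ e ∣ ≡ᵇ k)) ≡ (n ∸ s) C k
#-miss n       zero    k = #-level n k
#-miss zero    (suc s) k = #-level zero k
#-miss (suc n) (suc s) k = trans (#-suc {n} (λ e → not (hits-first (suc s) e) ∧ (∣ e ∣ ≡ᵇ k)))
  (trans (cong₂ _+_ (#-miss n s k) (∑-zero (subsets n))) (+-identityʳ _))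

star : ∀ {n} → ℕ → ℕ → Family n
star s k e = hits-first s e ∧ (∣ e ∣ ≡ᵇ k)

#-star : ∀ n s k → # (star {n} s k) + (n ∸ s) C k ≡ n C k
#-star n s k = trans (cong (# (star {n} s k) +_) (sym (#-miss n s k))) (trans (sym (∑-+ (subsets n) _ _))
  (trans (∑-cong (subsets n) (λ e → split (hits-first s e) (∣ e ∣ ≡ᵇ k))) (#-level n k)))
  where
  split : ∀ a b → ⟦ a ∧ b ⟧ + ⟦ not a ∧ b ⟧ ≡ ⟦ b ⟧
  split true  b = +-identityʳ _
  split false b = refl

subsets-Unique : ∀ n → Unique (subsets n)
subsets-Unique zero    = [] ∷ []
subsets-Unique (suc n) = Uₚ.++⁺ (Uₚ.map⁺ 𝕍.∷-injectiveʳ (subsets-Unique n)) (Uₚ.map⁺ 𝕍.∷-injectiveʳ (subsets-Unique n))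
  λ (x∈ , x∈′) → clash (∈ₚ.∈-map⁻ (false ∷_) x∈) (∈ₚ.∈-map⁻ (true ∷_) x∈′)
  where
  clash : ∀ {x : Subset (suc n)} → (∃ λ a → a ∈ subsets n × x ≡ false ∷ a) → (∃ λ b → b ∈ subsets n × x ≡ true ∷ b) → ⊥
  clash (_ , _ , refl) (_ , _ , ())

starGraph : ∀ r n → ℕ → Hypergraph r n
starGraph r n s = record
  { edges   = filter (λ e → star s r e 𝔹.≟ true) (subsets n)
  ; uniform = All.tabulate (λ e∈ → ≡ᵇ-sound (proj₂ (∧-true {hits-first s _} (proj₂ (∈ₚ.∈-filter⁻ (λ e → star s r e 𝔹.≟ true) {xs = subsets n} e∈)))))
  ; simple  = Uₚ.filter⁺ (λ e → star s r e 𝔹.≟ true) (subsets-Unique n) }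

starGraph-size : ∀ r n s → e[ starGraph r n s ] + (n ∸ s) C r ≡ n C r
starGraph-size r n s = trans (cong (_+ (n ∸ s) C r) (trans (sym (∑-filter (λ e → star s r e 𝔹.≟ true) (subsets n)))
  (∑-cong (subsets n) (λ e → same (star s r e))))) (#-star n s r)
  where
  same : ∀ b → ⟦ does (b 𝔹.≟ true) ⟧ ≡ ⟦ b ⟧
  same true  = refl
  same false = refl

hits-first-witness : ∀ {n} s (e : Subset n) → hits-first s e ≡ true → Σ (Fin n) λ u → toℕ u < s × lookup e u ≡ true
hits-first-witness (suc s) (true ∷ e)  p = zero , s≤s z≤n , refl
hits-first-witness (suc s) (false ∷ e) p with hits-first-witness s e p
... | u , u< , q = suc u , s≤s u< , q

module Windows {n} (v : Fin n) where

  occurs : List (Fin n) → ℕ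
  occurs p = ∑ p (λ x → ⟦ does (v 𝔽.≟ x) ⟧)

  contains : Subset n → ℕ
  contains w = ⟦ lookup w v ⟧

  -- Truncated windows at the end of the path are counted too. Then a window of length d + 1 is its
  -- first vertex plus the window of length d starting at the next vertex, which gives the recursion
  -- in `cover-suc`.
  cover : ℕ → List (Fin n) → ℕ
  cover d []       = 0
  cover d (x ∷ xs) = contains (toSubset (take d (x ∷ xs))) + cover d xs

  contains-∷ : ∀ x l → contains (toSubset (x ∷ l)) ≤ ⟦ does (v 𝔽.≟ x) ⟧ + contains (toSubset l)
  contains-∷ x l = ⟦⟧-≤ λ p → here-or-there (lookup-toSubset⁻ (x ∷ l) p)
    where
    here-or-there : v ∈ x ∷ l → 1 ≤ ⟦ does (v 𝔽.≟ x) ⟧ + contains (toSubset l)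
    here-or-there (here refl) = ≤-trans (≤-reflexive (sym (cong ⟦_⟧ (dec-true (v 𝔽.≟ v) refl)))) (m≤m+n _ _)
    here-or-there (there v∈) = ≤-trans (≤-reflexive (sym (cong ⟦_⟧ (lookup-toSubset⁺ v∈)))) (m≤n+m _ _)

  contains-∅ : contains ∅ ≡ 0
  contains-∅ = cong ⟦_⟧ (𝕍.lookup-replicate v false)

  cover-suc : ∀ d x xs → cover (suc d) (x ∷ xs) ≤ occurs (x ∷ xs) + cover d xs
  cover-suc d x [] = ≤-trans (+-monoˡ-≤ 0 (contains-∷ x (take d [])))
    (≤-reflexive (cong (λ z → ⟦ does (v 𝔽.≟ x) ⟧ + z + 0) (trans (cong (contains ∘ toSubset) (take-[] d)) contains-∅)))
    where
    take-[] : ∀ d → take {A = Fin n} d [] ≡ []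
    take-[] zero    = refl
    take-[] (suc d) = refl
  cover-suc d x (y ∷ ys) = ≤-trans (+-mono-≤ (contains-∷ x (take d (y ∷ ys))) (cover-suc d y ys))
    (≤-reflexive (lem ⟦ does (v 𝔽.≟ x) ⟧ (contains (toSubset (take d (y ∷ ys)))) (occurs (y ∷ ys)) (cover d ys)))
    where
    lem : ∀ a b c d → a + b + (c + d) ≡ a + c + (b + d)
    lem = solve-∀

  cover≤ : ∀ d p → cover d p ≤ d * occurs p
  cover≤ zero p = ≤-reflexive (none p)
    where
    none : ∀ p → cover 0 p ≡ 0
    none []      = refl
    none (x ∷ p) = cong₂ _+_ contains-∅ (none p)
  cover≤ (suc d) []       = z≤n
  cover≤ (suc d) (x ∷ xs) = ≤-trans (cover-suc d x xs) (+-monoʳ-≤ (occurs (x ∷ xs)) (≤-trans (m≤n+m _ _) (cover≤ d (x ∷ xs))))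

  windows≤cover : ∀ r p → ∑ (windows r p) contains ≤ cover r p
  windows≤cover r []       = z≤n
  windows≤cover r (x ∷ xs) with r ≤ᵇ suc (length xs)
  ... | true  = +-monoʳ-≤ (contains (toSubset (take r (x ∷ xs)))) (windows≤cover r xs)
  ... | false = z≤n

  forest-degree : ∀ r ps → Unique (concat ps) → ∑ (concatMap (windows r) ps) contains ≤ r
  forest-degree r ps u = begin
    ∑ (concatMap (windows r) ps) contains       ≡⟨ ∑-concatMap (windows r) ps contains ⟩
    ∑ ps (λ p → ∑ (windows r p) contains)       ≤⟨ ∑-mono ps (λ p → ≤-trans (windows≤cover r p) (cover≤ r p)) ⟩
    ∑ ps (λ p → r * occurs p)                   ≡⟨ ∑-*ˡ ps r occurs ⟩
    r * ∑ ps occurs                             ≡⟨ cong (r *_) (total ps) ⟩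
    r * occurs (concat ps)                      ≤⟨ *-monoʳ-≤ r (Counting.∑-member 𝔽._≟_ v u) ⟩
    r * 1                                       ≡⟨ *-identityʳ r ⟩
    r                                           ∎
    where
    open ≤-Reasoning
    total : ∀ ps → ∑ ps occurs ≡ occurs (concat ps)
    total []       = refl
    total (p ∷ ps) = trans (cong (occurs p +_) (total ps)) (sym (∑-++ p (concat ps) _))

-- Double counting of the edges of the copy against the first `s` vertices: each edge contains one
-- of these, each of these has at most one preimage under the injection, and degrees in the forest
-- are at most r. Hence k ≤ r s.
starGraph-avoids : ∀ r n s k → r * s < k → ¬ ContainsL k (starGraph r n s)
starGraph-avoids r n s k rs<k (H , ((ps , u , edges⇔) , size) , f , f-inj , copy) = <⇒≱ rs<k (begin
  k
    ≡⟨ size ⟨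
  length (edges H)
    ≡⟨ ∑-one (edges H) ⟨
  ∑ (edges H) (λ _ → 1)
    ≤⟨ ∑-mono-∈ (edges H) (λ e∈ → one (All.lookup copy e∈)) ⟩
  ∑ (edges H) (λ e → ∑ (allFin n) (λ w → low w * ∑ (allFin n) (λ v → ⟦ does (w 𝔽.≟ f v) ⟧ * ⟦ lookup e v ⟧)))
    ≡⟨ ∑-swap (edges H) (allFin n) _ ⟩
  ∑ (allFin n) (λ w → ∑ (edges H) (λ e → low w * ∑ (allFin n) (λ v → ⟦ does (w 𝔽.≟ f v) ⟧ * ⟦ lookup e v ⟧)))
    ≡⟨ ∑-cong (allFin n) (λ w → trans (∑-*ˡ (edges H) (low w) _) (cong (low w *_) (trans (∑-swap (edges H) (allFin n) _)
         (∑-cong (allFin n) (λ v → ∑-*ˡ (edges H) ⟦ does (w 𝔽.≟ f v) ⟧ _))))) ⟩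
  ∑ (allFin n) (λ w → low w * ∑ (allFin n) (λ v → ⟦ does (w 𝔽.≟ f v) ⟧ * ∑ (edges H) (λ e → ⟦ lookup e v ⟧)))
    ≤⟨ ∑-mono (allFin n) (λ w → *-monoʳ-≤ (low w) (fibre w)) ⟩
  ∑ (allFin n) (λ w → low w * r)
    ≡⟨ ∑-*ʳ (allFin n) r low ⟩
  ∑ (allFin n) low * r
    ≤⟨ *-monoˡ-≤ r (∑-initial-segment n s) ⟩
  s * r
    ≡⟨ *-comm s r ⟩
  r * s ∎)
  where
  open ≤-Reasoning
  low : Fin n → ℕ
  low w = ⟦ does (toℕ w <? s) ⟧
  degree : ∀ v → ∑ (edges H) (λ e → ⟦ lookup e v ⟧) ≤ r
  degree v = begin
    ∑ (edges H) (λ e → ⟦ lookup e v ⟧)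
      ≤⟨ ∑-mono-∈ (edges H) (λ {e} e∈ → ≤-trans (≤-reflexive (sym (trans (cong (_* ⟦ lookup e v ⟧) (cong ⟦_⟧ (dec-true (e ≟ˢ e) refl))) (*-identityˡ _))))
           (term≤∑ (λ w → ⟦ does (w ≟ˢ e) ⟧ * ⟦ lookup w v ⟧) (Equivalence.to (edges⇔ e) e∈))) ⟩
    ∑ (edges H) (λ e → ∑ W (λ w → ⟦ does (w ≟ˢ e) ⟧ * ⟦ lookup w v ⟧))
      ≡⟨ trans (∑-swap (edges H) W _) (∑-cong W (λ w → ∑-*ʳ (edges H) ⟦ lookup w v ⟧ _)) ⟩
    ∑ W (λ w → ∑ (edges H) (λ e → ⟦ does (w ≟ˢ e) ⟧) * ⟦ lookup w v ⟧)
      ≤⟨ ∑-mono W (λ w → ≤-trans (*-monoˡ-≤ ⟦ lookup w v ⟧ (Counting.∑-member _≟ˢ_ w (simple H))) (≤-reflexive (*-identityˡ _))) ⟩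
    ∑ W (λ w → ⟦ lookup w v ⟧)
      ≤⟨ Windows.forest-degree v r ps u ⟩
    r ∎
    where W = concatMap (windows r) ps
  fibre : ∀ w → ∑ (allFin n) (λ v → ⟦ does (w 𝔽.≟ f v) ⟧ * ∑ (edges H) (λ e → ⟦ lookup e v ⟧)) ≤ r
  fibre w = begin
    ∑ (allFin n) (λ v → ⟦ does (w 𝔽.≟ f v) ⟧ * ∑ (edges H) (λ e → ⟦ lookup e v ⟧))
      ≤⟨ ∑-mono (allFin n) (λ v → *-monoʳ-≤ ⟦ does (w 𝔽.≟ f v) ⟧ (degree v)) ⟩
    ∑ (allFin n) (λ v → ⟦ does (w 𝔽.≟ f v) ⟧ * r)
      ≡⟨ ∑-*ʳ (allFin n) r _ ⟩
    ∑ (allFin n) (λ v → ⟦ does (w 𝔽.≟ f v) ⟧) * r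
      ≡⟨ cong (_* r) (∑-map f (allFin n) (λ x → ⟦ does (w 𝔽.≟ x) ⟧)) ⟨
    ∑ (map f (allFin n)) (λ x → ⟦ does (w 𝔽.≟ x) ⟧) * r
      ≤⟨ *-monoˡ-≤ r (Counting.∑-member 𝔽._≟_ w (Uₚ.map⁺ f-inj (Uₚ.allFin⁺ n))) ⟩
    1 * r
      ≡⟨ *-identityˡ r ⟩
    r ∎
  one : ∀ {e} → (Σ (Subset n) λ e′ → e′ ∈ edges (starGraph r n s) × IsImage f e e′) →
    1 ≤ ∑ (allFin n) (λ w → low w * ∑ (allFin n) (λ v → ⟦ does (w 𝔽.≟ f v) ⟧ * ⟦ lookup e v ⟧))
  one {e} (e′ , e′∈ , image) with hits-first-witness s e′ (proj₁ (∧-true (proj₂ (∈ₚ.∈-filter⁻ (λ e → star s r e 𝔹.≟ true) {xs = subsets n} e′∈))))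
  ... | w , w< , w∈ with Equivalence.to (image w) (𝕍.lookup⇒[]= w e′ w∈)
  ...   | v , v∈ , refl = ≤-trans (*-mono-≤ {1} {low (f v)} (≤-reflexive (sym (cong ⟦_⟧ (dec-true (toℕ (f v) <? s) w<))))
          (≤-trans (*-mono-≤ {1} {⟦ does (f v 𝔽.≟ f v) ⟧} (≤-reflexive (sym (cong ⟦_⟧ (dec-true (f v 𝔽.≟ f v) refl))))
            (≤-reflexive (sym (cong ⟦_⟧ (𝕍.[]=⇒lookup v∈))))) (term≤∑ (λ v′ → ⟦ does (f v 𝔽.≟ f v′) ⟧ * ⟦ lookup e v′ ⟧) (∈ₚ.∈-allFin v))))
          (term≤∑ (λ w → low w * ∑ (allFin n) (λ v → ⟦ does (w 𝔽.≟ f v) ⟧ * ⟦ lookup e v ⟧)) (∈ₚ.∈-allFin (f v)))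

-- Binomial estimates

C-absorb : ∀ n k → (suc n C suc k) * suc k ≡ suc n * (n C k)
C-absorb n zero = trans (*-identityʳ (suc n C 1)) (trans (Data.Nat.Combinatorics.nC1≡n (suc n)) (sym (trans (cong (suc n *_) (nC0 n)) (*-identityʳ (suc n)))))
C-absorb zero (suc k) = trans (cong (_* suc (suc k)) (k>n⇒nCk≡0 {1} {suc (suc k)} (s≤s (s≤s z≤n)))) (sym (cong (1 *_) (k>n⇒nCk≡0 {0} {suc k} (s≤s z≤n))))
C-absorb (suc n) (suc k) = begin
  (suc (suc n) C suc (suc k)) * suc (suc k)
    ≡⟨ cong (_* suc (suc k)) (sym (nCk+nC[k+1]≡[n+1]C[k+1] (suc n) (suc k))) ⟩
  (a + b) * suc (suc k)
    ≡⟨ lem₁ a b (suc k) ⟩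
  a + a * suc k + b * suc (suc k)
    ≡⟨ cong₂ (λ x y → a + x + y) (C-absorb n k) (C-absorb n (suc k)) ⟩
  a + suc n * (n C k) + suc n * (n C suc k)
    ≡⟨ lem₂ a (suc n) (n C k) (n C suc k) ⟩
  a + suc n * (n C k + n C suc k)
    ≡⟨ cong (λ z → a + suc n * z) (nCk+nC[k+1]≡[n+1]C[k+1] n k) ⟩
  suc (suc n) * a ∎
  where
  open ≡-Reasoning
  a b : ℕ
  a = suc n C suc k
  b = suc n C suc (suc k)
  lem₁ : ∀ a b k → (a + b) * suc k ≡ a + a * k + b * suc k
  lem₁ = solve-∀
  lem₂ : ∀ a n x y → a + n * x + n * y ≡ a + n * (x + y)
  lem₂ = solve-∀

C-suc-! : ∀ n k → (suc n C suc k) * suc k ! ≡ suc n * ((n C k) * k !)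
C-suc-! n k = trans (sym (*-assoc (suc n C suc k) (suc k) (k !))) (trans (cong (_* k !) (C-absorb n k)) (*-assoc (suc n) (n C k) (k !)))

C-upper : ∀ n k → (n C k) * k ! ≤ n ^ k
C-upper n       zero    = ≤-reflexive (cong (_* 1) (nC0 n))
C-upper zero    (suc k) = ≤-trans (≤-reflexive (cong (_* suc k !) (k>n⇒nCk≡0 {0} {suc k} (s≤s z≤n)))) z≤n
C-upper (suc n) (suc k) = ≤-trans (≤-reflexive (C-suc-! n k)) (*-monoʳ-≤ (suc n) (≤-trans (C-upper n k) (^-monoˡ-≤ k (n≤1+n n))))

C-lower : ∀ n k → (n ∸ k) ^ k ≤ (n C k) * k !
C-lower n       zero    = ≤-reflexive (sym (cong (_* 1) (nC0 n)))
C-lower zero    (suc k) = z≤n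
C-lower (suc n) (suc k) = ≤-trans (*-mono-≤ (≤-trans (m∸n≤m n k) (n≤1+n n)) (C-lower n k)) (≤-reflexive (sym (C-suc-! n k)))

-- The left side counts the k-sets with at most one element in each of M classes of size D.
C-blowup : ∀ D M k → D ^ k * (M C k) ≤ (D * M) C k
C-blowup D       M       zero    = ≤-reflexive (trans (+-identityʳ _) (trans (nC0 M) (sym (nC0 (D * M)))))
C-blowup zero    M       (suc k) = z≤n
C-blowup (suc d) zero    (suc k) = ≤-trans (≤-reflexive (trans (cong (suc d ^ suc k *_) (k>n⇒nCk≡0 {0} {suc k} (s≤s z≤n))) (*-zeroʳ (suc d ^ suc k)))) z≤n
C-blowup (suc d) (suc M) (suc k) = *-cancelʳ-≤ _ _ (suc k) (begin
  suc d * suc d ^ k * (suc M C suc k) * suc k        ≡⟨ *-assoc (suc d * suc d ^ k) (suc M C suc k) (suc k) ⟩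
  suc d * suc d ^ k * ((suc M C suc k) * suc k)      ≡⟨ cong (suc d * suc d ^ k *_) (C-absorb M k) ⟩
  suc d * suc d ^ k * (suc M * (M C k))              ≡⟨ lem (suc d) (suc d ^ k) (suc M) (M C k) ⟩
  suc d * suc M * (suc d ^ k * (M C k))              ≤⟨ *-monoʳ-≤ (suc d * suc M) (≤-trans (C-blowup (suc d) M k) (C-mono k (+-monoʳ-≤ M (*-monoʳ-≤ d (n≤1+n M))))) ⟩
  suc d * suc M * ((M + d * suc M) C k)              ≡⟨ C-absorb (M + d * suc M) k ⟨
  ((suc d * suc M) C suc k) * suc k                  ∎)
  where
  open ≤-Reasoning
  lem : ∀ a b c d → a * b * (c * d) ≡ a * c * (b * d)
  lem = solve-∀

power-increment : ∀ z δ k → (z + δ) ^ suc k ≤ z ^ suc k + suc k * δ * (z + δ) ^ k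
power-increment z δ zero    = ≤-reflexive (lem z δ)
  where
  lem : ∀ z δ → (z + δ) * 1 ≡ z * 1 + 1 * δ * 1
  lem = solve-∀
power-increment z δ (suc k) = begin
  (z + δ) * W
    ≡⟨ *-distribʳ-+ W z δ ⟩
  z * W + δ * W
    ≤⟨ +-monoˡ-≤ (δ * W) (≤-trans (*-monoʳ-≤ z (power-increment z δ k)) (≤-trans (≤-reflexive (*-distribˡ-+ z (z ^ suc k) _))
         (+-monoʳ-≤ (z * z ^ suc k) (≤-trans (≤-reflexive (lem₁ z (suc k) δ ((z + δ) ^ k))) (*-monoʳ-≤ (suc k * δ) (*-monoˡ-≤ ((z + δ) ^ k) (m≤m+n z δ))))))) ⟩
  z * z ^ suc k + suc k * δ * W + δ * W
    ≡⟨ lem₂ (z * z ^ suc k) (suc k) δ W ⟩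
  z ^ suc (suc k) + suc (suc k) * δ * W ∎
  where
  open ≤-Reasoning
  W : ℕ
  W = (z + δ) ^ suc k
  lem₁ : ∀ z k δ y → z * (k * δ * y) ≡ k * δ * (z * y)
  lem₁ = solve-∀
  lem₂ : ∀ a k δ w → a + k * δ * w + δ * w ≡ a + suc k * δ * w
  lem₂ = solve-∀

-- The mean value estimate for a power; truncated subtraction covers the case x ≤ z.
power-difference : ∀ x z n k → x ≤ n → x ^ suc k ≤ z ^ suc k + suc k * (x ∸ z) * n ^ k
power-difference x z n k x≤n with ≤-total z x
... | inj₂ x≤z = ≤-trans (^-monoˡ-≤ (suc k) x≤z) (m≤m+n _ _)
... | inj₁ z≤x = subst (λ y → y ^ suc k ≤ z ^ suc k + suc k * (x ∸ z) * n ^ k) (m+[n∸m]≡n z≤x)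
  (≤-trans (power-increment z (x ∸ z) k) (+-monoʳ-≤ (z ^ suc k) (*-monoʳ-≤ (suc k * (x ∸ z))
    (^-monoˡ-≤ k (≤-trans (≤-reflexive (m+[n∸m]≡n z≤x)) x≤n)))))

-- Both binomials are compared with powers divided by (k + 1)!. The lower estimate of a binomial by
-- a power replaces `m` by `m ∸ suc k`, and this is the source of the same loss later on.
C-compare : ∀ x D m n k → x ≤ n → x C suc k ≤ D ^ suc k * (m C suc k) + suc k * (x ∸ D * (m ∸ suc k)) * n ^ k
C-compare x D m n k x≤n = *-cancelʳ-≤ _ _ (suc k !) {{k!≢0}} (begin
  (x C suc k) * suc k !
    ≤⟨ C-upper x (suc k) ⟩
  x ^ suc k
    ≤⟨ power-difference x (D * (m ∸ suc k)) n k x≤n ⟩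
  (D * (m ∸ suc k)) ^ suc k + δ
    ≤⟨ +-mono-≤ (≤-trans (≤-reflexive (*-^ D (m ∸ suc k) (suc k))) (*-monoʳ-≤ (D ^ suc k) (C-lower m (suc k))))
         (≤-trans (≤-reflexive (sym (*-identityʳ δ))) (*-monoʳ-≤ δ (>-nonZero⁻¹ (suc k !) {{k!≢0}}))) ⟩
  D ^ suc k * ((m C suc k) * suc k !) + δ * suc k !
    ≡⟨ lem (D ^ suc k) (m C suc k) (suc k !) δ ⟩
  (D ^ suc k * (m C suc k) + δ) * suc k ! ∎)
  where
  open ≤-Reasoning
  δ : ℕ
  δ = suc k * (x ∸ D * (m ∸ suc k)) * n ^ k
  k!≢0 : NonZero (suc k !)
  k!≢0 = Data.Nat.Properties._!≢0 (suc k)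
  lem : ∀ a b c d → a * (b * c) + d * c ≡ (a * b + d) * c
  lem = solve-∀

div-bounds : ∀ m d .{{_ : NonZero d}} → m / d * d ≤ m × m < suc (m / d) * d
div-bounds m d = ÷.m/n*n≤m m d , (begin-strict
  m                      ≡⟨ ÷.m≡m%n+[m/n]*n m d ⟩
  m % d + m / d * d      <⟨ +-monoˡ-< (m / d * d) (÷.m%n<n m d) ⟩
  suc (m / d) * d        ∎)
  where open ≤-Reasoning

-- With x = C(n,r) and y = C(n−s,r), the third hypothesis is an excess of nʳ/e edges over x − y,
-- cleared of denominators and of subtraction.
density-from-excess : ∀ {e n r X MC c₀ x y ℓ Bad Err} → 0 < e → X * MC ≤ x → n ^ r + e * x ≤ e * (ℓ + y) →
  y ≤ X * c₀ + Err → e * (Err + Bad + X) ≤ n ^ r → X * MC + Bad + X ≤ ℓ + X * c₀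
density-from-excess {e} {n} {r} {X} {MC} {c₀} {x} {y} {ℓ} {Bad} {Err} e>0 blow excess y≤ small =
  *-cancelˡ-≤ e {{>-nonZero e>0}} (+-cancelʳ-≤ (e * y) _ _ (begin
    e * (X * MC + Bad + X) + e * y              ≤⟨ +-mono-≤ (*-monoʳ-≤ e (+-monoˡ-≤ X (+-monoˡ-≤ Bad blow))) (*-monoʳ-≤ e y≤) ⟩
    e * (x + Bad + X) + e * (X * c₀ + Err)      ≡⟨ lem₁ e x Bad X (X * c₀) Err ⟩
    e * (Err + Bad + X) + e * x + e * (X * c₀)  ≤⟨ +-monoˡ-≤ (e * (X * c₀)) (≤-trans (+-monoˡ-≤ (e * x) small) excess) ⟩
    e * (ℓ + y) + e * (X * c₀)                  ≡⟨ lem₂ e ℓ y (X * c₀) ⟩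
    e * (ℓ + X * c₀) + e * y                    ∎))
  where
  open ≤-Reasoning
  lem₁ : ∀ e x b X c E → e * (x + b + X) + e * (c + E) ≡ e * (E + b + X) + e * x + e * c
  lem₁ = solve-∀
  lem₂ : ∀ e l y c → e * (l + y) + e * c ≡ e * (l + c) + e * y
  lem₂ = solve-∀

-- The arrangement has B = q b columns of h blocks of r × u cells, so that n is close
-- to D M with D = h u, M = B r, and s₀ = p b + 1 exceeds the density threshold p B / q.
module Constants (r″ p q b e : ℕ) (p>0 : 0 < p) (q>2p : 2 * p < q) (e>0 : 0 < e)
  (b≥ : e * (suc (suc r″) + 5) + 4 ≤ b) where

  r B P s₀ M m₀ : ℕ
  r = suc (suc r″)
  B = q * b
  P = p * b
  s₀ = suc P
  M = B * r
  m₀ = M ∸ suc s₀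

  b≥4 : 4 ≤ b
  b≥4 = ≤-trans (m≤n+m 4 _) b≥

  q>0 : 0 < q
  q>0 = ≤-trans (s≤s z≤n) q>2p

  b≤B : b ≤ B
  b≤B = m≤n*m b q {{>-nonZero q>0}}

  B>0 : 0 < B
  B>0 = ≤-trans (≤-trans (s≤s z≤n) b≥4) b≤B

  -- Here c < 1/2 enters: q ≥ 2p + 1 leaves b columns beyond `2 * P`, and four of them pay for the
  -- rounding in `suc s₀`.
  2s₀≤B : 2 * suc s₀ ≤ B
  2s₀≤B = begin
    2 * suc s₀              ≡⟨ lem P ⟩
    2 * P + 4               ≤⟨ +-monoʳ-≤ (2 * P) b≥4 ⟩
    2 * P + b               ≡⟨ lem₂ p b ⟩
    suc (2 * p) * b         ≤⟨ *-monoˡ-≤ b q>2p ⟩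
    B                       ∎
    where
    open ≤-Reasoning
    lem : ∀ P → 2 * suc (suc P) ≡ 2 * P + 4
    lem = solve-∀
    lem₂ : ∀ p b → 2 * (p * b) + b ≡ suc (2 * p) * b
    lem₂ = solve-∀

  s₀≤B : s₀ ≤ B
  s₀≤B = ≤-trans (≤-trans (n≤1+n s₀) (m≤m+n (suc s₀) _)) 2s₀≤B

  M-large : suc (s₀ + s₀) * suc r″ + suc s₀ ≤ M
  M-large = ≤-trans (≤-trans (m≤m+n _ _) (≤-reflexive (lem s₀ r″))) (*-monoˡ-≤ r 2s₀≤B)
    where
    lem : ∀ s r → suc (s + s) * suc r + suc s + suc (suc (s + r)) ≡ 2 * suc s * suc (suc r)
    lem = solve-∀

  M≡ : M ≡ m₀ + suc s₀
  M≡ = sym (m∸n+n≡m (≤-trans (m≤n+m (suc s₀) (suc (s₀ + s₀) * suc r″)) M-large))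

  room : suc (s₀ + s₀) * suc r″ ≤ m₀
  room = +-cancelʳ-≤ (suc s₀) _ _ (≤-trans M-large (≤-reflexive M≡))

  M≡′ : M ≡ suc m₀ + s₀
  M≡′ = trans M≡ (+-suc m₀ s₀)

  -- Three losses: `Err` from comparing C(n - s, r) with its rescaled sample version, `Bad` from the
  -- sets that samples do not see properly, and `X` for the one extra edge per sample. Each is a
  -- constant multiple of n^r / B, so many columns make them harmless.
  module Errors (n s h u : ℕ) (n≤ : n ≤ h * u * M + M * u) (D*M≤n : h * u * M ≤ n)
    (s-large : p * n ≤ q * (r * suc s)) (big : B * r * (M * u + 1) ≤ n) where

    D X z δ Err Bad : ℕ
    D = h * u
    X = D ^ r
    z = D * (suc m₀ ∸ r)
    δ = (n ∸ s) ∸ z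
    Err = r * δ * n ^ suc r″
    Bad = (n ∸ B * h * (r * u)) * n ^ suc r″ + B * (h * (r * u)) * (h * (r * u) * n ^ r″)

    -- Both s / n and `s₀` / `M` are close to p / (q r). In `r + 2`, the 1 added in `s₀` contributes
    -- one, the truncation in `suc m₀ ∸ r` contributes r, and `big` covers with one more the
    -- uncovered remainder `M * u` and the rounding of s.
    main : B * r * n ≤ B * r * s + (B * r * z + (r + 2) * n)
    main = begin
      B * r * n
        ≤⟨ *-monoʳ-≤ (B * r) n≤ ⟩
      M * (D * M + M * u)
        ≤⟨ *-monoʳ-≤ M (+-monoˡ-≤ (M * u) D*M≤) ⟩
      M * (z + D * (s₀ + r) + M * u)
        ≡⟨ lem₁ M z D (s₀ + r) u ⟩
      M * z + D * M * (s₀ + r) + M * (M * u)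
        ≤⟨ +-monoˡ-≤ (M * (M * u)) (+-monoʳ-≤ (M * z) (*-monoˡ-≤ (s₀ + r) D*M≤n)) ⟩
      M * z + n * (s₀ + r) + M * (M * u)
        ≡⟨ lem₂ (M * z) n p b r (M * (M * u)) ⟩
      M * z + b * (p * n) + n * (1 + r) + M * (M * u)
        ≤⟨ +-monoˡ-≤ (M * (M * u)) (+-monoˡ-≤ (n * (1 + r)) (+-monoʳ-≤ (M * z) (*-monoʳ-≤ b s-large))) ⟩
      M * z + b * (q * (r * suc s)) + n * (1 + r) + M * (M * u)
        ≡⟨ lem₃ (M * z) b q r s n (M * u) ⟩
      M * s + (M * z + (n * (1 + r) + M * (M * u + 1)))
        ≤⟨ +-monoʳ-≤ (M * s) (+-monoʳ-≤ (M * z) (+-monoʳ-≤ (n * (1 + r)) big)) ⟩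
      M * s + (M * z + (n * (1 + r) + n))
        ≡⟨ cong (λ x → M * s + (M * z + x)) (lem₄ n r) ⟩
      B * r * s + (B * r * z + (r + 2) * n) ∎
      where
      open ≤-Reasoning
      D*M≤ : D * M ≤ z + D * (s₀ + r)
      D*M≤ = ≤-trans (*-monoʳ-≤ D (≤-trans (≤-reflexive M≡′) (≤-trans (+-monoˡ-≤ s₀ (m≤n+m∸n (suc m₀) r)) (≤-reflexive (lem₀ r (suc m₀ ∸ r) s₀)))))
        (≤-reflexive (*-distribˡ-+ D (suc m₀ ∸ r) (s₀ + r)))
        where
        lem₀ : ∀ a b c → a + b + c ≡ b + (c + a)
        lem₀ = solve-∀
      lem₁ : ∀ M z D x u → M * (z + D * x + M * u) ≡ M * z + D * M * x + M * (M * u)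
      lem₁ = solve-∀
      lem₂ : ∀ a n p b r c → a + n * (suc (p * b) + r) + c ≡ a + b * (p * n) + n * (1 + r) + c
      lem₂ = solve-∀
      lem₃ : ∀ a b q r s n v → a + b * (q * (r * suc s)) + n * (1 + r) + q * b * r * v ≡
        q * b * r * s + (a + (n * (1 + r) + q * b * r * (v + 1)))
      lem₃ = solve-∀
      lem₄ : ∀ n r → n * (1 + r) + n ≡ (r + 2) * n
      lem₄ = solve-∀

    B*r*δ≤ : B * (r * δ) ≤ (r + 2) * n
    B*r*δ≤ = begin
      B * (r * δ)                                ≡⟨ *-assoc B r δ ⟨
      B * r * (n ∸ s ∸ z)                        ≡⟨ trans (*-distribˡ-∸ (B * r) (n ∸ s) z) (cong (_∸ B * r * z) (*-distribˡ-∸ (B * r) n s)) ⟩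
      B * r * n ∸ B * r * s ∸ B * r * z          ≤⟨ m≤n+o⇒m∸n≤o _ (B * r * z) (m≤n+o⇒m∸n≤o (B * r * n) (B * r * s) main) ⟩
      (r + 2) * n                                ∎
      where open ≤-Reasoning

    B*Err : B * Err ≤ (r + 2) * n ^ r
    B*Err = begin
      B * (r * δ * n ^ suc r″)     ≡⟨ lem B (r * δ) (n ^ suc r″) ⟩
      B * (r * δ) * n ^ suc r″     ≤⟨ *-monoˡ-≤ (n ^ suc r″) B*r*δ≤ ⟩
      (r + 2) * n * n ^ suc r″     ≡⟨ *-assoc (r + 2) n _ ⟩
      (r + 2) * n ^ r              ∎
      where
      open ≤-Reasoning
      lem : ∀ a b c → a * (b * c) ≡ a * b * c
      lem = solve-∀

    B*X : B * X ≤ n ^ r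
    B*X = ≤-trans (≤-reflexive (sym (*-assoc B D (D ^ suc r″)))) (*-mono-≤ B*D≤n (^-monoˡ-≤ (suc r″) D≤n))
      where
      D≤n : D ≤ n
      D≤n = ≤-trans (m≤m*n D M {{>-nonZero (*-mono-≤ {1} {B} B>0 (s≤s z≤n))}}) D*M≤n
      B*D≤n : B * D ≤ n
      B*D≤n = ≤-trans (m≤m*n (B * D) r) (≤-trans (≤-reflexive (lem B D r)) D*M≤n)
        where
        lem : ∀ B D r → B * D * r ≡ D * (B * r)
        lem = solve-∀

    B*Bad : B * Bad ≤ 2 * n ^ r
    B*Bad = begin
      B * Bad
        ≡⟨ *-distribˡ-+ B _ _ ⟩
      B * ((n ∸ B * h * (r * u)) * n ^ suc r″) + B * (A * (H * n ^ r″))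
        ≤⟨ +-mono-≤ first second ⟩
      n ^ r + n ^ r
        ≡⟨ cong (n ^ r +_) (sym (+-identityʳ _)) ⟩
      2 * n ^ r ∎
      where
      open ≤-Reasoning
      H A : ℕ
      H = h * (r * u)
      A = B * H
      D*M≡A : D * M ≡ A
      D*M≡A = lem h u B r
        where
        lem : ∀ h u B r → h * u * (B * r) ≡ B * (h * (r * u))
        lem = solve-∀
      A≤n : A ≤ n
      A≤n = ≤-trans (≤-reflexive (sym D*M≡A)) D*M≤n
      outside≤ : n ∸ B * h * (r * u) ≤ M * u
      outside≤ = m≤n+o⇒m∸n≤o n (B * h * (r * u)) (≤-trans n≤ (+-monoˡ-≤ (M * u) (≤-reflexive (trans D*M≡A (sym (*-assoc B h (r * u)))))))
      B*M*u≤n : B * (M * u) ≤ n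
      B*M*u≤n = ≤-trans (*-mono-≤ (m≤m*n B r) (m≤m+n (M * u) 1)) big
      first : B * ((n ∸ B * h * (r * u)) * n ^ suc r″) ≤ n ^ r
      first = ≤-trans (≤-reflexive (sym (*-assoc B (n ∸ B * h * (r * u)) (n ^ suc r″))))
        (*-monoˡ-≤ (n ^ suc r″) (≤-trans (*-monoʳ-≤ B outside≤) B*M*u≤n))
      second : B * (A * (H * n ^ r″)) ≤ n ^ r
      second = ≤-trans (≤-reflexive (lem B A H (n ^ r″))) (*-mono-≤ A≤n (*-monoˡ-≤ (n ^ r″) A≤n))
        where
        lem : ∀ B A H y → B * (A * (H * y)) ≡ A * (B * H * y)
        lem = solve-∀

    -- The losses cost r + 2, 2 and 1 units of n^r / B; hence the term `e * (r + 5)` in the lower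
    -- bound for `b`.
    small : e * (Err + Bad + X) ≤ n ^ r
    small = *-cancelˡ-≤ B {{>-nonZero B>0}} (begin
      B * (e * (Err + Bad + X))                                ≡⟨ lem B e Err Bad X ⟩
      e * (B * Err + B * Bad + B * X)                          ≤⟨ *-monoʳ-≤ e (+-mono-≤ (+-mono-≤ B*Err B*Bad) B*X) ⟩
      e * ((r + 2) * n ^ r + 2 * n ^ r + n ^ r)                ≡⟨ lem₂ e r (n ^ r) ⟩
      e * (r + 5) * n ^ r                                      ≤⟨ *-monoˡ-≤ (n ^ r) (≤-trans (m≤m+n _ 4) (≤-trans b≥ b≤B)) ⟩
      B * n ^ r                                                ∎)
      where
      open ≤-Reasoning
      lem : ∀ B e x y z → B * (e * (x + y + z)) ≡ e * (B * x + B * y + B * z)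
      lem = solve-∀
      lem₂ : ∀ e r y → e * ((r + 2) * y + 2 * y + y) ≡ e * (r + 5) * y
      lem₂ = solve-∀

    sample-bound : ∀ ℓ → n ^ r + e * (n C r) ≤ e * (ℓ + (n ∸ s) C r) → X * (M C r) + Bad + X ≤ ℓ + X * (suc m₀ C r)
    sample-bound ℓ excess = density-from-excess {e} {n} {r} {X} {M C r} {suc m₀ C r} {n C r} {(n ∸ s) C r} {ℓ} {Bad} {Err} e>0
      (≤-trans (C-blowup D M r) (C-mono r D*M≤n)) excess (C-compare (n ∸ s) D (suc m₀) n (suc r″) (m∸n≤m n s)) small

  -- A share of `P` columns would suffice without rounding, and `s₀` has one more. This extra column
  -- pays for the incomplete block row (h + 1 against h) and for the windows lost at the end of each
  -- path (v + 1 against v), provided that h and v are large compared with `2 * P`.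
  capacity : ∀ n h v a k → k * q ≤ p * n → n ≤ suc h * (B * (r * suc v)) → 2 * P ≤ v → suc (2 * P) ≤ h → s₀ * h ≤ a →
    k ≤ a * (suc v * r ∸ suc r″)
  capacity n h v a k k≤ n≤ v≥ h≥ a≥ = begin
    k                              ≤⟨ k≤′ ⟩
    P * suc h * suc v * r          ≤⟨ *-monoˡ-≤ r (*-cancelˡ-≤ {P * suc h * suc v} {s₀ * h * v} 2 doubled) ⟩
    s₀ * h * v * r                 ≡⟨ *-assoc (s₀ * h) v r ⟩
    s₀ * h * (v * r)               ≤⟨ *-mono-≤ a≥ row ⟩
    a * (suc v * r ∸ suc r″)       ∎
    where
    open ≤-Reasoning
    row : v * r ≤ suc v * r ∸ suc r″
    row = m+n≤o⇒m≤o∸n (v * r) (≤-trans (≤-reflexive (+-comm (v * r) (suc r″))) (+-monoˡ-≤ (v * r) (n≤1+n (suc r″))))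
    k≤′ : k ≤ P * suc h * suc v * r
    k≤′ = *-cancelʳ-≤ _ _ q {{>-nonZero q>0}} (≤-trans k≤ (≤-trans (*-monoʳ-≤ p n≤) (≤-reflexive (lem p (suc h) q b r (suc v)))))
      where
      lem : ∀ p h q b r u → p * (h * (q * b * (r * u))) ≡ p * b * h * u * r * q
      lem = solve-∀
    doubled : 2 * (P * suc h * suc v) ≤ 2 * (s₀ * h * v)
    doubled = begin
      2 * (P * suc h * suc v)                                       ≡⟨ lem₁ P h v ⟩
      2 * (P * h * v) + 2 * P * h + (2 * P * v + 2 * P)             ≤⟨ +-mono-≤ (+-monoʳ-≤ (2 * (P * h * v)) (*-monoˡ-≤ h v≥))
        (≤-trans (+-monoʳ-≤ (2 * P * v) v≥) (≤-trans (≤-reflexive (lem₂ (2 * P) v)) (*-monoˡ-≤ v h≥))) ⟩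
      2 * (P * h * v) + v * h + h * v                               ≡⟨ lem₃ P h v ⟩
      2 * (s₀ * h * v)                                              ∎
      where
      lem₁ : ∀ P h v → 2 * (P * suc h * suc v) ≡ 2 * (P * h * v) + 2 * P * h + (2 * P * v + 2 * P)
      lem₁ = solve-∀
      lem₂ : ∀ x v → x * v + v ≡ suc x * v
      lem₂ = solve-∀
      lem₃ : ∀ P h v → 2 * (P * h * v) + v * h + h * v ≡ 2 * (suc P * h * v)
      lem₃ = solve-∀

-- Upper bound

quotient : ∀ n d → 0 < d → Σ ℕ λ h → h * d ≤ n × n ≤ suc h * d
quotient n (suc d) _ = n / suc d , proj₁ (div-bounds n (suc d)) , <⇒≤ (proj₂ (div-bounds n (suc d)))

membership : ∀ {r n} → Hypergraph r n → Family n
membership G e = does (Any.any? (e ≟ˢ_) (edges G))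

membership⁺ : ∀ {r n} (G : Hypergraph r n) {e} → e ∈ edges G → membership G e ≡ true
membership⁺ G {e} e∈ = dec-true (Any.any? (e ≟ˢ_) (edges G)) e∈

membership⁻ : ∀ {r n} (G : Hypergraph r n) {e} → membership G e ≡ true → e ∈ edges G
membership⁻ G {e} p = true-dec (Any.any? (e ≟ˢ_) (edges G)) p

module UpperBound (r″ p q e : ℕ) (p>0 : 0 < p) (q>2p : 2 * p < q) (e>0 : 0 < e) where

  open Constants r″ p q (e * (suc (suc r″) + 5) + 4) e p>0 q>2p e>0 ≤-refl

  -- A graph that avoids the forests and exceeds the claimed value by n^r / e, with subtraction and
  -- division cleared. `s-large` is all that is kept of s being a rounded quotient.
  record Counterexample (n : ℕ) : Set where
    field
      G       : Hypergraph r n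
      k s     : ℕ
      k-small : k * q ≤ p * n
      s-large : p * n ≤ q * (r * suc s)
      avoids  : ¬ ContainsL k G
      excess  : n ^ r + e * (n C r) ≤ e * (e[ G ] + (n ∸ s) C r)

  M>0 : 0 < M
  M>0 = *-mono-≤ {1} {B} B>0 (s≤s z≤n)

  -- With more than `s₀ * h` tiles the forest would already be present. So the tiles fit into `s₀`
  -- columns, the situation in which an exchange wins.
  few-tiles : ∀ {n} (c : Counterexample n) v h → 2 * P ≤ v → suc (2 * P) ≤ h →
    n ≤ suc h * (M * suc v) → (Ts : Tiling (membership (Counterexample.G c)) r (suc v)) → length (tiles Ts) ≤ s₀ * h
  few-tiles {n} c v h v≥ h≥ n≤ Ts = ≮⇒≥ λ many → avoids (tiling-contains G (membership G) (membership⁻ G) Ts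
    (capacity n h v (length (tiles Ts)) k k-small (≤-trans n≤ (≤-reflexive (cong (suc h *_) (*-assoc B r (suc v))))) v≥ h≥ (<⇒≤ many)))
    where open Counterexample c

  -- About h u / (2 S M t) exchanges are possible, each winning a tile of part size t. This is h u /
  -- (2 S M), or about n / (2 S M²), in total part size; another factor 2 absorbs rounding. The part
  -- size t cancels.
  S J : ℕ
  S = length (subsets M)
  J = 4 * S * M * M

  progress : ∀ j n a a′ w t Q K → j * n ≤ J * (a * (w * t)) → n ≤ M * (2 * S * M * t * Q) + K → 2 * K ≤ n →
    a * w + Q ≤ a′ → suc j * n ≤ J * (a′ * t)
  progress j n a a′ w t Q K old n≤ K≤ new = begin
    n + j * n                            ≤⟨ +-mono-≤ n≤JQt old ⟩
    J * (Q * t) + J * (a * (w * t))      ≡⟨ lem₁ J Q t a w ⟩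
    J * ((a * w + Q) * t)                ≤⟨ *-monoʳ-≤ J (*-monoˡ-≤ t new) ⟩
    J * (a′ * t)                         ∎
    where
    open ≤-Reasoning
    lem₁ : ∀ J Q t a w → J * (Q * t) + J * (a * (w * t)) ≡ J * ((a * w + Q) * t)
    lem₁ = solve-∀
    lem₂ : ∀ S M t Q → 2 * (M * (2 * S * M * t * Q)) ≡ 4 * S * M * M * (Q * t)
    lem₂ = solve-∀
    n≤JQt : n ≤ J * (Q * t)
    n≤JQt = +-cancelʳ-≤ n _ _ (begin
      n + n                                         ≡⟨ cong (n +_) (sym (+-identityʳ n)) ⟩
      2 * n                                         ≤⟨ *-monoʳ-≤ 2 n≤ ⟩
      2 * (M * (2 * S * M * t * Q) + K)             ≡⟨ *-distribˡ-+ 2 (M * (2 * S * M * t * Q)) K ⟩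
      2 * (M * (2 * S * M * t * Q)) + 2 * K         ≤⟨ +-mono-≤ (≤-reflexive (lem₂ S M t Q)) K≤ ⟩
      J * (Q * t) + n                               ∎)

  S>0 : 0 < S
  S>0 = ≤-trans (term≤∑ (λ _ → 1) (∈-subsets {M} ∅)) (≤-reflexive (∑-one (subsets M)))

  -- The three lower bounds on n give enough blocks per column for `capacity`, make the unarranged
  -- vertices negligible in `Errors`, and absorb the rounding of the number of blocks and of
  -- exchanges.
  step : ∀ {n} (c : Counterexample n) j v w′ → 2 * P ≤ v → box-size M s₀ (suc v) ≤ suc w′ * suc v →
    let t = suc v ; u = suc w′ * t in
    suc (suc (2 * P)) * (M * u) ≤ n → B * r * (M * u + 1) ≤ n → 2 * (M * (2 * S * M * t) + M * u) ≤ n →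
    (Ts : Tiling (membership (Counterexample.G c)) r u) → j * n ≤ J * (length (tiles Ts) * u) →
    Σ (Tiling (membership (Counterexample.G c)) r t) λ Ts′ → suc j * n ≤ J * (length (tiles Ts′) * t)
  step {n} c j v w′ v≥ size room₁ room₂ room₃ Ts old =
    with-blocks (quotient n (M * u) (*-mono-≤ {1} {M} M>0 (s≤s z≤n)))
    where
    open Counterexample c
    t u c′ : ℕ
    t = suc v
    u = suc w′ * t
    c′ = 2 * S * M * t
    c′>0 : 0 < c′
    c′>0 = *-mono-≤ {1} {2 * S * M} (*-mono-≤ {1} {2 * S} (*-mono-≤ {1} {2} (s≤s z≤n) S>0) M>0) (s≤s z≤n)
    Goal : Set
    Goal = Σ (Tiling (membership G) r t) λ Ts′ → suc j * n ≤ J * (length (tiles Ts′) * t)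
    with-blocks : (Σ ℕ λ h → h * (M * u) ≤ n × n ≤ suc h * (M * u)) → Goal
    with-blocks (h , h≤ , n≤) = with-exchanges (quotient (h * u) c′ c′>0)
      where
      h≥ : suc (2 * P) ≤ h
      h≥ = ≤-pred (*-cancelʳ-≤ _ _ (M * u) {{>-nonZero (*-mono-≤ {1} {M} M>0 (s≤s z≤n))}} (≤-trans room₁ n≤))
      few : length (tiles Ts) ≤ s₀ * h
      -- The successor of `v + w′ * t` is `u`, the part size of the old tiles.
      few = few-tiles c (v + w′ * t) h (≤-trans v≥ (m≤m+n v _)) h≥ n≤ Ts
      lem₁ : ∀ h M u → suc h * (M * u) ≡ h * u * M + M * u
      lem₁ = solve-∀
      lem₂ : ∀ h M u → h * (M * u) ≡ h * u * M
      lem₂ = solve-∀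
      lem₃ : ∀ B h r u → h * (B * r * u) ≡ B * h * (r * u)
      lem₃ = solve-∀
      module Er = Errors n s h u (≤-trans n≤ (≤-reflexive (lem₁ h M u))) (≤-trans (≤-reflexive (sym (lem₂ h M u))) h≤) s-large room₂
      with-exchanges : (Σ ℕ λ Q → Q * c′ ≤ h * u × h * u ≤ suc Q * c′) → Goal
      with-exchanges (Q , Q≤ , hu≤) = proj₁ better , progress j n (length (tiles Ts)) _ (suc w′) t Q (M * c′ + M * u) old n≤′ room₃ (proj₂ better)
        where
        better : Σ (Tiling (membership G) r t) λ Ts′ → length (tiles Ts) * suc w′ + Q ≤ length (tiles Ts′)
        better = improve {n} {r″} {B} {h} {s₀} {m₀} {suc w′} {v} (edges G) (membership G) M≡ room (≤-trans (s≤s z≤n) h≥) (s≤s z≤n) size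
          (simple G) (All.lookup (uniform G)) (membership⁺ G) s₀≤B (≤-trans (≤-reflexive (sym (lem₃ B h r u))) h≤)
          (Er.sample-bound e[ G ] excess) Ts few Q (≤-trans (≤-reflexive (*-comm c′ Q)) Q≤)
        open ≤-Reasoning
        n≤′ : n ≤ M * (c′ * Q) + (M * c′ + M * u)
        n≤′ = begin
          n                                       ≤⟨ n≤ ⟩
          suc h * (M * u)                         ≡⟨ lem₄ h M u ⟩
          M * (h * u) + M * u                     ≤⟨ +-monoˡ-≤ (M * u) (*-monoʳ-≤ M hu≤) ⟩
          M * (suc Q * c′) + M * u                ≡⟨ lem₅ M Q c′ (M * u) ⟩
          M * (c′ * Q) + (M * c′ + M * u)         ∎
          where
          lem₄ : ∀ h M u → suc h * (M * u) ≡ M * (h * u) + M * u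
          lem₄ = solve-∀
          lem₅ : ∀ M Q c x → M * (suc Q * c) + x ≡ M * (c * Q) + (M * c + x)
          lem₅ = solve-∀

  -- The recursion runs from fine to coarse: a tiling with part size `suc v` and j + 1 gains is
  -- obtained from one with j gains and part size `u`, chosen large enough for `kst`. All sizes and
  -- thresholds are thus known before the graph.
  stage : ∀ j v → 2 * P ≤ v → Σ ℕ λ N → ∀ n → N ≤ n → (c : Counterexample n) →
    Σ (Tiling (membership (Counterexample.G c)) r (suc v)) λ Ts → j * n ≤ J * (length (tiles Ts) * suc v)
  stage zero    v v≥ = 0 , λ n _ c → record { tiles = [] ; injective = [] ; complete = [] ; apart-all = [] } , z≤n
  stage (suc j) v v≥ = N₀ + (N₁ + (N₂ + N₃)) , λ n n≥ c →
    let old = proj₂ coarse n (≤-trans (m≤m+n N₀ _) n≥) c in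
    step c j v w′ v≥ size
      (≤-trans (≤-trans (m≤m+n N₁ _) (m≤n+m (N₁ + (N₂ + N₃)) N₀)) n≥)
      (≤-trans (≤-trans (≤-trans (m≤m+n N₂ N₃) (m≤n+m (N₂ + N₃) N₁)) (m≤n+m (N₁ + (N₂ + N₃)) N₀)) n≥)
      (≤-trans (≤-trans (≤-trans (m≤n+m N₃ N₂) (m≤n+m (N₂ + N₃) N₁)) (m≤n+m (N₁ + (N₂ + N₃)) N₀)) n≥)
      (proj₁ old) (proj₂ old)
    where
    w′ u N₀ N₁ N₂ N₃ : ℕ
    w′ = box-size M s₀ (suc v)
    u = suc w′ * suc v
    size : w′ ≤ u
    size = ≤-trans (n≤1+n w′) (m≤m*n (suc w′) (suc v))
    coarse : Σ ℕ λ N → ∀ n → N ≤ n → (c : Counterexample n) →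
      Σ (Tiling (membership (Counterexample.G c)) r u) λ Ts → j * n ≤ J * (length (tiles Ts) * u)
    coarse = stage j (v + w′ * suc v) (≤-trans v≥ (m≤m+n v _))
    N₀ = proj₁ coarse
    N₁ = suc (suc (2 * P)) * (M * u)
    N₂ = B * r * (M * u + 1)
    N₃ = 2 * (M * (2 * S * M * suc v) + M * u)

  -- After J + 1 stages the tiles would need total part size (J + 1) n / J, although by `few-tiles`
  -- they have at most n. The successor in the threshold makes n positive and the contradiction
  -- strict.
  impossible : Σ ℕ λ N → ∀ n → N ≤ n → ¬ Counterexample n
  impossible = suc (N₀ + N₁) , λ n n≥ c →
    refute n n≥ c (proj₂ last n (≤-trans (≤-trans (m≤m+n N₀ N₁) (n≤1+n _)) n≥) c) (quotient n (M * t) Mt>0)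
    where
    v t N₀ N₁ : ℕ
    v = 2 * P
    t = suc v
    last : Σ ℕ λ N → ∀ n → N ≤ n → (c : Counterexample n) →
      Σ (Tiling (membership (Counterexample.G c)) r t) λ Ts → suc J * n ≤ J * (length (tiles Ts) * t)
    last = stage (suc J) v ≤-refl
    N₀ = proj₁ last
    N₁ = suc (suc (2 * P)) * (M * t)
    Mt>0 : 0 < M * t
    Mt>0 = *-mono-≤ {1} {M} M>0 (s≤s z≤n)
    refute : ∀ n → suc (N₀ + N₁) ≤ n → (c : Counterexample n) →
      (Σ (Tiling (membership (Counterexample.G c)) r t) λ Ts → suc J * n ≤ J * (length (tiles Ts) * t)) →
      (Σ ℕ λ h → h * (M * t) ≤ n × n ≤ suc h * (M * t)) → ⊥
    refute n n≥ c (Ts , full) (h , h≤ , n≤) = 1+n≰n (begin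
      suc (J * n)                    ≤⟨ +-monoˡ-≤ (J * n) (≤-trans (s≤s z≤n) n≥) ⟩
      suc J * n                      ≤⟨ full ⟩
      J * (length (tiles Ts) * t)    ≤⟨ *-monoʳ-≤ J (begin
        length (tiles Ts) * t          ≤⟨ *-monoˡ-≤ t (few-tiles c v h ≤-refl h≥ n≤ Ts) ⟩
        s₀ * h * t                     ≤⟨ *-monoˡ-≤ t (*-monoˡ-≤ h (≤-trans s₀≤B (m≤m*n B r))) ⟩
        M * h * t                      ≡⟨ lem M h t ⟩
        h * (M * t)                    ≤⟨ h≤ ⟩
        n                              ∎) ⟩
      J * n                          ∎)
      where
      open ≤-Reasoning
      lem : ∀ M h t → M * h * t ≡ h * (M * t)
      lem = solve-∀
      h≥ : suc (2 * P) ≤ h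
      h≥ = ≤-pred (*-cancelʳ-≤ _ _ (M * t) {{>-nonZero Mt>0}} (≤-trans (≤-trans (≤-trans (m≤n+m N₁ N₀) (n≤1+n _)) n≥) n≤))

C-drop : ∀ x k → x C suc k ≤ (x ∸ 1) C suc k + x ^ k
C-drop zero    k = m≤m+n _ _
C-drop (suc x) k = begin
  suc x C suc k               ≡⟨ nCk+nC[k+1]≡[n+1]C[k+1] x k ⟨
  x C k + x C suc k           ≡⟨ +-comm (x C k) (x C suc k) ⟩
  x C suc k + x C k           ≤⟨ +-monoʳ-≤ (x C suc k) (≤-trans (≤-trans (m≤m*n (x C k) (k !) {{Data.Nat.Properties._!≢0 k}}) (C-upper x k)) (^-monoˡ-≤ k (n≤1+n x))) ⟩
  x C suc k + suc x ^ k       ∎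
  where open ≤-Reasoning

-- When r divides k, the star on k / r vertices is too large for `starGraph-avoids`. One vertex is
-- therefore given up, and by `C-drop` this costs at most n to the power of the edge size minus one.
star-bound : ∀ {r n k m} s → IsExL (suc r) n k m → suc r * s < k →
  n C suc r ∸ (n ∸ suc s) C suc r ∸ m ≤ n ^ r
star-bound {r} {n} {k} {m} s (_ , max) rs<k = m≤n+o⇒m∸n≤o _ m (m≤n+o⇒m∸n≤o (n C suc r) ((n ∸ suc s) C suc r) (begin
  n C suc r
    ≡⟨ starGraph-size (suc r) n s ⟨
  e[ starGraph (suc r) n s ] + (n ∸ s) C suc r
    ≤⟨ +-mono-≤ (max (starGraph (suc r) n s) (starGraph-avoids (suc r) n s k rs<k)) (C-drop (n ∸ s) r) ⟩
  m + ((n ∸ s ∸ 1) C suc r + (n ∸ s) ^ r)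
    ≤⟨ +-monoʳ-≤ m (+-mono-≤ (≤-reflexive (cong (_C suc r) (trans (∸-+-assoc n s 1) (cong (n ∸_) (+-comm s 1))))) (^-monoˡ-≤ r (m∸n≤m n s))) ⟩
  m + ((n ∸ suc s) C suc r + n ^ r)
    ≡⟨ lem m ((n ∸ suc s) C suc r) (n ^ r) ⟩
  (n ∸ suc s) C suc r + (m + n ^ r) ∎))
  where
  open ≤-Reasoning
  lem : ∀ a b c → a + (b + c) ≡ b + (a + c)
  lem = solve-∀

theorem4p2 : ∀ (r : ℕ) .{{_ : NonZero r}} → 3 ≤ r →
    ∀ (p q : ℕ) .{{_ : NonZero q}} → 0 < p → 2 * p < q →
    ∀ (b : ℕ) → Σ ℕ λ N → ∀ (n : ℕ) → N ≤ n → ∀ (m : ℕ) →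
    IsExL r n ((p * n) / q) m →
    suc b * ∣ m - (n C r ∸ (n ∸ ((p * n) / q) / r) C r) ∣ ≤ n ^ r
-- The summand `suc b` guarantees n ≥ e, so that e times the deficit n^(r - 1) of the star is at
-- most n^r.
theorem4p2 r@(suc (suc r″)) 3≤r p q p>0 q>2p b = suc b + proj₁ upper , bound
  where
  e : ℕ
  e = suc b
  module U = UpperBound r″ p q e p>0 q>2p (s≤s z≤n)
  upper : Σ ℕ λ N → ∀ n → N ≤ n → ¬ U.Counterexample n
  upper = U.impossible
  bound : ∀ n → suc b + proj₁ upper ≤ n → ∀ m → IsExL r n ((p * n) / q) m →
    e * ∣ m - (n C r ∸ (n ∸ ((p * n) / q) / r) C r) ∣ ≤ n ^ r
  bound n n≥ m ex = either (≤-total m (x ∸ y))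
    where
    k s x y : ℕ
    k = (p * n) / q
    s = k / r
    x = n C r
    y = (n ∸ s) C r
    open ≤-Reasoning
    lower : ∀ s → s * r ≤ k → e * (x ∸ (n ∸ s) C r ∸ m) ≤ n ^ r
    lower zero    _    = ≤-trans (≤-reflexive (trans (cong (λ z → e * (z ∸ m)) (n∸n≡0 x)) (trans (cong (e *_) (0∸n≡0 m)) (*-zeroʳ e)))) z≤n
    lower (suc s) rs≤k = *-mono-≤ (≤-trans (m≤m+n e _) n≥)
      (star-bound s ex (≤-trans (≤-trans (≤-reflexive (cong suc (*-comm r s))) (m<n+m (s * r) {r} (s≤s z≤n))) rs≤k))
    excess : n ^ r < e * (m ∸ (x ∸ y)) → n ^ r + e * x ≤ e * (m + y)
    excess big = begin
      n ^ r + e * x                                  ≤⟨ +-mono-≤ (<⇒≤ big) (*-monoʳ-≤ e (m≤n+m∸n x y)) ⟩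
      e * (m ∸ (x ∸ y)) + e * (y + (x ∸ y))          ≡⟨ lem e (m ∸ (x ∸ y)) y (x ∸ y) ⟩
      e * (m ∸ (x ∸ y) + (x ∸ y) + y)                ≡⟨ cong (λ z → e * (z + y)) (m∸n+n≡m (<⇒≤ (m<n⇒0<n∸m⁻¹ big))) ⟩
      e * (m + y)                                    ∎
      where
      lem : ∀ e a y z → e * a + e * (y + z) ≡ e * (a + z + y)
      lem = solve-∀
      m<n⇒0<n∸m⁻¹ : n ^ r < e * (m ∸ (x ∸ y)) → x ∸ y < m
      m<n⇒0<n∸m⁻¹ big = ≰⇒> λ m≤ → <⇒≱ big (≤-trans (≤-reflexive (trans (cong (e *_) (m≤n⇒m∸n≡0 m≤)) (*-zeroʳ e))) z≤n)
    s-large : p * n ≤ q * (r * suc s)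
    s-large = begin
      p * n               ≤⟨ <⇒≤ (proj₂ (div-bounds (p * n) q)) ⟩
      suc k * q           ≤⟨ *-monoˡ-≤ q (proj₂ (div-bounds k r)) ⟩
      suc s * r * q       ≡⟨ lem (suc s) r q ⟩
      q * (r * suc s)     ∎
      where
      lem : ∀ s r q → s * r * q ≡ q * (r * s)
      lem = solve-∀
    either : m ≤ x ∸ y ⊎ x ∸ y ≤ m → e * ∣ m - (x ∸ y) ∣ ≤ n ^ r
    either (inj₁ m≤) = ≤-trans (≤-reflexive (cong (e *_) (m≤n⇒∣m-n∣≡n∸m m≤))) (lower s (proj₁ (div-bounds k r)))
    either (inj₂ m≥) = ≤-trans (≤-reflexive (cong (e *_) (m≤n⇒∣n-m∣≡n∸m m≥))) (≮⇒≥ too-many)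
      where
      too-many : ¬ (n ^ r < e * (m ∸ (x ∸ y)))
      too-many big with proj₁ ex
      ... | G , avoids , size = proj₂ upper n (≤-trans (m≤n+m _ e) n≥) (record
        { G = G ; k = k ; s = s ; k-small = proj₁ (div-bounds (p * n) q) ; s-large = s-large ; avoids = avoids
        ; excess = subst (λ z → n ^ r + e * x ≤ e * (z + y)) (sym size) (excess big) })
theorem4p2 (suc zero) (s≤s ())
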